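{- Let $G$ be a graph with $\Delta(G)\geq 5$ such that the subgraph $G_{\geq 5}$ is acyclic. Then all proper $(\chi'(G)+1)$-edge colorings of $G$ are Kempe equivalent.
   Context: All graphs are finite, without loops and multiple edges. $G_{\geq 5}$ denotes the subgraph of $G$ induced by the set of vertices of degree at least $5$. A proper $t$-edge coloring of $G$ is a map $f:E(G)\to\{1,\dots,t\}$ with $f(e)\neq f(e')$ for adjacent edges $e,e'$. $\Delta(G)$ is the maximum degree, $\chi'(G)$ the chromatic index. For a proper $t$-edge coloring $f$ and colors $a,b$, $G_f(a,b)$ is the subgraph induced by the edges colored $a$ or $b$; switching colors $a$ and $b$ on one connected component of $G_f(a,b)$ is an interchange. Two proper $t$-edge colorings are Kempe equivalent if one can be obtained from the other by a sequence of interchanges. -}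

module Defs where

open import Data.Nat using (ℕ; zero; suc; _≤_; _+_)
open import Data.Fin as Fin using (Fin)
open import Data.Bool using (Bool; true; false)
open import Data.List using (List; []; _∷_; _++_; [_]; length; filterᵇ; allFin)
open import Data.List.Relation.Unary.All using (All)
open import Data.List.Relation.Unary.Linked using (Linked)
open import Data.List.Relation.Unary.Unique.Propositional using (Unique)
open import Data.Product using (Σ; ∃; _×_; _,_)
open import Data.Sum using (_⊎_)
open import Relation.Nullary using (¬_; yes; no)
open import Relation.Binary.PropositionalEquality using (_≡_; _≢_)
open import Relation.Binary.Construct.Closure.ReflexiveTransitive using (Star)

record Graph (n : ℕ) : Set where
  field
    adj    : Fin n → Fin n → Bool
    sym    : ∀ u v → adj u v ≡ adj v u
    irrefl : ∀ v → adj v v ≡ false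

module _ {n : ℕ} (G : Graph n) where
  open Graph G

  Adj : Fin n → Fin n → Set
  Adj u v = adj u v ≡ true

  deg : Fin n → ℕ
  deg v = length (filterᵇ (adj v) (allFin n))

  MaxDegreeAtLeast : ℕ → Set
  MaxDegreeAtLeast k = ∃ λ v → k ≤ deg v

  record CycleIn (P : Fin n → Set) : Set where
    field
      x      : Fin n
      xs     : List (Fin n)
      long   : 2 ≤ length xs
      unique : Unique (x ∷ xs)
      inP    : All P (x ∷ xs)
      closed : Linked Adj ((x ∷ xs) ++ [ x ])

  HighDegreeAcyclic : Set
  HighDegreeAcyclic = ¬ CycleIn (λ v → 5 ≤ deg v)

  -- edges, each represented once by its endpoints u < v
  record Edge : Set where
    constructor edge
    field
      u   : Fin n
      v   : Fin n
      u<v : u Fin.< v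
      uv  : Adj u v

  Incident : Fin n → Edge → Set
  Incident w e = (Edge.u e ≡ w) ⊎ (Edge.v e ≡ w)

  AdjEdges : Edge → Edge → Set
  AdjEdges e e' = ¬ (Edge.u e ≡ Edge.u e' × Edge.v e ≡ Edge.v e')
                × ∃ λ w → Incident w e × Incident w e'

  Coloring : ℕ → Set
  Coloring t = Edge → Fin t

  Proper : {t : ℕ} → Coloring t → Set
  Proper f = ∀ e e' → AdjEdges e e' → f e ≢ f e'

  Colorable : ℕ → Set
  Colorable t = Σ (Coloring t) Proper

  IsChromaticIndex : ℕ → Set
  IsChromaticIndex k = Colorable k × (∀ t → Colorable t → k ≤ t)

  module _ {t : ℕ} (f : Coloring t) (a b : Fin t) where
    ColAB : Edge → Set
    ColAB e = (f e ≡ a) ⊎ (f e ≡ b)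

    LinkAB : Edge → Edge → Set
    LinkAB e e' = ColAB e × ColAB e' × AdjEdges e e'

    InComponent : Edge → Edge → Set
    InComponent e₀ e = ColAB e₀ × Star LinkAB e₀ e

  swap : {t : ℕ} → Fin t → Fin t → Fin t → Fin t
  swap a b c with c Fin.≟ a
  ... | yes _ = b
  ... | no _ with c Fin.≟ b
  ...   | yes _ = a
  ...   | no _ = c

  Interchange : {t : ℕ} → Coloring t → Coloring t → Set
  Interchange {t} f g =
    Σ (Fin t) λ a → Σ (Fin t) λ b → a ≢ b × Σ Edge λ e₀ → ColAB f a b e₀ ×
      (∀ e → (InComponent f a b e₀ e → g e ≡ swap a b (f e))
           × (¬ InComponent f a b e₀ e → g e ≡ f e))

  -- Kempe equivalence: a finite sequence of interchanges (colorings
  -- compared pointwise at the end, as functions on E(G))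
  KempeEquivalent : {t : ℕ} → Coloring t → Coloring t → Set
  KempeEquivalent {t} f g =
    Σ (Coloring t) λ h → Star Interchange f h × (∀ e → h e ≡ g e)

-- Colourings are treated as colourings of vertex pairs, and one Kempe step may interchange two colours a, b on
-- several components at once; at the end such a step is decomposed into interchanges of single components.
--
-- By Fournier's fan argument (every failing fan produces the next vertex of a non-backtracking walk through
-- vertices of large degree, which form a forest) any (p+1)-colouring is equivalent to one with p colours, where
-- p ≥ 5 and G is p-colourable.  Two p-colourings f, g are compared by recolouring a matching M with the new colour
-- and passing to G − M, with M a colour class of g when p ≥ 6.
--
-- When p = 5, M is a matching that covers all vertices of degree at least 5 and has no augmenting path of one or
-- three edges, so that G − M has maximum degree 4.  A graph of maximum degree 4 that can be exhausted by deleting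
-- vertices of degree at most 3 has all its 5-colourings equivalent: a vertex q with three neighbours is put
-- back by treating a colouring as a colouring φ of G − q with a system of distinct representatives of the lists
-- of colours missing at the three neighbours.  The obstruction is that all three lists equal {c,d}; then φ is
-- represented by the extendable colourings one interchange away, and an interchange of c and d itself is
-- bypassed by shifting colours along a path that alternates between an edge of a fixed colour i and an edge
-- coloured c or d.  If G − M cannot be exhausted, let S be the 4-regular core that is left.  Acyclicity yields a
-- vertex x ∈ S whose M-partner x′ is outside S and which has an uncovered neighbour u ∈ S; exchanging xx′ for
-- xu in M makes the core smaller.
module Submission where

open import Defs
import Axiom.UniquenessOfIdentityProofs as UIP
open import Data.Bool as Bool using (Bool; false; true)
open import Data.Empty using (⊥; ⊥-elim)
open import Data.Fin as Fin using (Fin; fromℕ<; toℕ)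
import Data.Fin.Properties as Finₚ
open import Data.List using (List; []; [_]; _++_; _∷_; allFin; cartesianProduct; concatMap; filter; filterᵇ; length; map; upTo)
open import Data.List.Membership.Propositional using (_∈_; _∉_; find; lose)
open import Data.List.Membership.Propositional.Properties using (∈-++⁺ʳ; ∈-++⁺ˡ; ∈-++⁻; ∈-allFin; ∈-cartesianProduct⁺; ∈-concatMap⁺; ∈-filter⁺; ∈-filter⁻; ∈-map⁺; ∈-map⁻; ∈-upTo⁺; ∈-upTo⁻; ∈-∃++)
open import Data.List.Properties using (filter-notAll; length-map; length-tabulate; length-upTo)
open import Data.List.Relation.Unary.All as All using (All; []; _∷_)
open import Data.List.Relation.Unary.All.Properties using (++⁻ˡ; map⁺; ¬All⇒Any¬)
open import Data.List.Relation.Unary.AllPairs as AllPairs using ([]; _∷_)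
open import Data.List.Relation.Unary.Any as Any using (here; there)
open import Data.List.Relation.Unary.Linked as Linked using (Linked; [-]; []; _∷_)
open import Data.List.Relation.Unary.Unique.Propositional using (Unique)
open import Data.List.Relation.Unary.Unique.Propositional.Properties using (allFin⁺; filter⁺; upTo⁺)
open import Data.Nat as ℕ using (_+_; _<_; _∸_; _≤_; suc; s≤s; zero; z≤n; ℕ)
open import Data.Nat.Properties using (+-comm; +-identityʳ; +-monoʳ-≤; +-suc; <-asym; <-irrefl; <-≤-trans; <⇒≱; m∸n+n≡m; m≤n+m; m≤n⇒m≤1+n; n≤1+n; ≤-<-trans; ≤-irrelevant; ≤-pred; ≤-refl; ≤-reflexive; ≤-trans; ≤∧≢⇒<; ≰⇒>)
open import Data.Product using (_,_; _×_; proj₁; proj₂; Σ; ∃)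
open import Data.Sum as Sum using ([_,_]′; _⊎_; inj₁; inj₂)
open import Data.Unit using (⊤)
open import Function using (_∘_; case_of_; id)
open import Relation.Binary.Construct.Closure.ReflexiveTransitive as Star using (Star; _◅_; _◅◅_; ε)
open import Relation.Binary.Definitions using (tri<; tri>; tri≈)
open import Relation.Binary.PropositionalEquality using (_≡_; _≢_; cong; cong₂; refl; subst; subst₂; sym; trans; ≢-sym)
open import Relation.Nullary using (Dec; no; yes; ¬_)
open import Relation.Nullary.Decidable using (_×-dec_; _⊎-dec_; dec-true; does; map′; ¬?)
open import Relation.Unary using (Decidable)

-- The descent on the number of colours cannot pass p = 5: acyclicity of the part of large degree
-- says nothing about G - M once its maximum degree is 4, so there M has to be chosen for its own
-- sake.
--
-- In the extension over q, each neighbour of q has degree at most 3 in G - q and so misses at least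
-- two of the five colours. By Hall's condition three such lists lack distinct representatives only
-- if all equal one pair {c,d}. An interchange of any other pair is harmless, in particular every
-- interchange that involves a colour seen at a neighbour of q. This guides the bypass: φ and its
-- (c,d)-switched copy undergo the same shift by harmless moves, after which a chosen neighbour of q
-- sees c or d. The two results still differ in c and d only, and that interchange is now harmless
-- too.
--
-- Short augmenting paths are excluded for the sake of x: if no suitable edge xu existed, one could
-- walk through vertices of degree at least 5 without ever turning back, since a dead end would
-- yield an augmenting path.

module _ {A : Set} where

  unique-⊆-length : (xs ys : List A) → Unique xs → (∀ {x} → x ∈ xs → x ∈ ys) → length xs ≤ length ys
  unique-⊆-length [] ys _ _ = z≤n
  unique-⊆-length (x ∷ xs) ys (x∉ ∷ uxs) sub with ∈-∃++ (sub (here refl))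
  ... | as , bs , refl = ≤-trans (s≤s (unique-⊆-length xs (as ++ bs) uxs sub′)) (≤-reflexive (lem as))
    where
    lem : ∀ cs → suc (length (cs ++ bs)) ≡ length (cs ++ x ∷ bs)
    lem [] = refl
    lem (c ∷ cs) = cong suc (lem cs)
    sub′ : ∀ {z} → z ∈ xs → z ∈ as ++ bs
    sub′ {z} z∈ with ∈-++⁻ as (sub (there z∈))
    ... | inj₁ p = ∈-++⁺ˡ p
    ... | inj₂ (there p) = ∈-++⁺ʳ as p
    ... | inj₂ (here refl) = ⊥-elim (All.lookup x∉ z∈ refl)

unique-bounded-length : ∀ {p} {xs : List ℕ} → Unique xs → All (_< p) xs → length xs ≤ p
unique-bounded-length {p} {xs} u bd =
  ≤-trans (unique-⊆-length xs (upTo p) u (λ x∈ → ∈-upTo⁺ (All.lookup bd x∈))) (≤-reflexive (length-upTo p))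

_∈ℕ?_ : (x : ℕ) (xs : List ℕ) → Dec (x ∈ xs)
x ∈ℕ? xs = Any.any? (x ℕ.≟_) xs

unique-exhausts : ∀ {p} {xs : List ℕ} → Unique xs → All (_< p) xs → length xs ≡ p → ∀ {x} → x < p → x ∈ xs
unique-exhausts {p} {xs} u bd eq {x} x<p with x ∈ℕ? xs
... | yes x∈ = x∈
... | no x∉ = ⊥-elim (<-irrefl eq (unique-bounded-length (All.tabulate (λ y∈ x≡y → x∉ (subst (_∈ xs) (sym x≡y) y∈)) ∷ u) (x<p ∷ bd)))

opaque
  fresh : ∀ {p} (xs : List ℕ) → length xs < p → ∃ λ x → x < p × x ∉ xs
  fresh {p} xs len with Any.any? (λ x → ¬? (x ∈ℕ? xs)) (upTo p)
  ... | yes any = let x , x∈ , x∉ = find any in x , ∈-upTo⁻ x∈ , x∉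
  ... | no none = ⊥-elim (<⇒≱ len (≤-trans (≤-reflexive (sym (length-upTo p)))
          (unique-⊆-length (upTo p) xs (upTo-unique p) λ {x} x∈ → case x ∈ℕ? xs of λ where
             (yes q) → q
             (no q) → ⊥-elim (none (lose x∈ q)))))
    where
    upTo-unique : ∀ m → Unique (upTo m)
    upTo-unique = upTo⁺

-- Colourings of vertex pairs and simultaneous interchanges.

In : ℕ → ℕ → ℕ → Set
In a b x = x ≡ a ⊎ x ≡ b

in? : ∀ a b x → Dec (In a b x)
in? a b x = (x ℕ.≟ a) ⊎-dec (x ℕ.≟ b)

module _ {n : ℕ} where

  V : Set
  V = Fin n

  record Gph : Set₁ where
    no-eta-equality
    field
      rel     : V → V → Set
      rel?    : ∀ u v → Dec (rel u v)
      rel-sym : ∀ {u v} → rel u v → rel v u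
      rel-irr : ∀ {u} → ¬ rel u u
  open Gph public

  -- A wrapper around `rel`, from whose type the graph can be inferred even when `rel` computes, as
  -- it does for subgraphs.
  record E (G : Gph) (u v : V) : Set where
    constructor mkE
    field unE : rel G u v
  open E public

  E? : ∀ G u v → Dec (E G u v)
  E? G u v = map′ mkE unE (rel? G u v)

  E-sym : ∀ {G u v} → E G u v → E G v u
  E-sym {G} (mkE e) = mkE (rel-sym G e)

  E-irr : ∀ {G u} → ¬ E G u u
  E-irr {G} (mkE e) = rel-irr G e

  E-≢ : ∀ {G u v} → E G u v → u ≢ v
  E-≢ e refl = E-irr e

  -- The value on a pair of non-adjacent vertices is junk.
  Col : Set
  Col = V → V → ℕ

  record Ok (p : ℕ) (G : Gph) (c : Col) : Set where
    field
      symm   : ∀ {u v} → E G u v → c u v ≡ c v u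
      bound  : ∀ {u v} → E G u v → c u v < p
      proper : ∀ {u v w} → E G u v → E G u w → c u v ≡ c u w → v ≡ w
  open Ok public

  record Sees (G : Gph) (c : Col) (u : V) (a : ℕ) : Set where
    constructor see
    field
      to  : V
      edg : E G u to
      clr : c u to ≡ a

  sees? : ∀ G c u a → Dec (Sees G c u a)
  sees? G c u a = map′ (λ (v , e , q) → see v e q) (λ (see v e q) → v , e , q)
                       (Finₚ.any? (λ v → E? G u v ×-dec (c u v ℕ.≟ a)))

  Misses : Gph → Col → V → ℕ → Set
  Misses G c u a = ¬ Sees G c u a

  -- Between proper colourings this says exactly that the second is obtained from the first by
  -- interchanging a and b on some components of the (a,b)-coloured subgraph.
  record K (a b : ℕ) (G : Gph) (c d : Col) : Set where
    constructor mkK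
    field at : ∀ {u v} → E G u v → c u v ≡ d u v ⊎ (In a b (c u v) × In a b (d u v))
  open K public

  Step : ℕ → Gph → Col → Col → Set
  Step p G c d = Ok p G c × Ok p G d × ∃ λ a → ∃ λ b → K a b G c d

  Kempe : ℕ → Gph → Col → Col → Set
  Kempe p G = Star (Step p G)

  Complete : ℕ → Gph → Set
  Complete p G = ∀ {c d} → Ok p G c → Ok p G d → Kempe p G c d

  K-refl : ∀ {a b G c} → K a b G c c
  K-refl = mkK λ _ → inj₁ refl

  K-sym : ∀ {a b G c d} → K a b G c d → K a b G d c
  K-sym k = mkK λ e → case at k e of λ where
    (inj₁ q) → inj₁ (sym q)
    (inj₂ (x , y)) → inj₂ (y , x)

  K-swap : ∀ {a b G c d} → K a b G c d → K b a G c d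
  K-swap k = mkK λ e → Sum.map₂ (λ (x , y) → Sum.swap x , Sum.swap y) (at k e)

  K-trans : ∀ {a b G c d e} → K a b G c d → K a b G d e → K a b G c e
  K-trans {a} {b} k l = mkK λ e → case (at k e , at l e) of λ where
    (inj₁ p , inj₁ q) → inj₁ (trans p q)
    (inj₁ p , inj₂ (x , y)) → inj₂ (subst (In a b) (sym p) x , y)
    (inj₂ (x , y) , inj₁ q) → inj₂ (x , subst (In a b) q y)
    (inj₂ (x , y) , inj₂ (z , w)) → inj₂ (x , w)

  K-in : ∀ {a b G c d u v} → K a b G c d → E G u v → In a b (c u v) → In a b (d u v)
  K-in {a} {b} k e i with at k e
  ... | inj₁ p = subst (In a b) p i
  ... | inj₂ (_ , y) = y

  K-out : ∀ {a b G c d u v} → K a b G c d → E G u v → ¬ In a b (c u v) → c u v ≡ d u v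
  K-out k e i with at k e
  ... | inj₁ p = p
  ... | inj₂ (x , _) = ⊥-elim (i x)

  record Agree (G : Gph) (c d : Col) : Set where
    constructor mkA
    field agr : ∀ {u v} → E G u v → c u v ≡ d u v
  open Agree public

  Ok-agree : ∀ {p G c d} → Agree G c d → Ok p G c → Ok p G d
  symm (Ok-agree ag ok) e = trans (sym (agr ag e)) (trans (symm ok e) (agr ag (E-sym e)))
  bound (Ok-agree {p} ag ok) e = subst (_< p) (agr ag e) (bound ok e)
  proper (Ok-agree ag ok) e f q = proper ok e f (trans (agr ag e) (trans q (sym (agr ag f))))

  step-kempe : ∀ {p G c d a b} → Ok p G c → Ok p G d → K a b G c d → Kempe p G c d
  step-kempe ok ok′ k = (ok , ok′ , _ , _ , k) ◅ ε

  agree-kempe : ∀ {p G c d} → Ok p G c → Agree G c d → Kempe p G c d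
  agree-kempe ok ag = step-kempe {a = 0} {0} ok (Ok-agree ag ok) (mkK λ e → inj₁ (agr ag e))

  Kempe-sym : ∀ {p G c d} → Kempe p G c d → Kempe p G d c
  Kempe-sym = Star.reverse (λ (ok , ok′ , a , b , k) → ok′ , ok , a , b , K-sym k)

  Kempe-ok : ∀ {p G c d} → Ok p G c → Kempe p G c d → Ok p G d
  Kempe-ok ok ε = ok
  Kempe-ok ok ((_ , ok′ , _) ◅ r) = Kempe-ok ok′ r

  -- Later arguments look at an interchange only through the missing colours at a vertex: `Same`
  -- says that those among `a`, `b` stay, `Flip` that they trade places. A vertex that sees both
  -- colours, or neither, throughout satisfies both.
  record Same (a b : ℕ) (G : Gph) (c d : Col) (u : V) : Set where
    constructor mkSame
    field
      same⇒ : ∀ {x} → In a b x → Sees G c u x → Sees G d u x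
      same⇐ : ∀ {x} → In a b x → Sees G d u x → Sees G c u x
  open Same public

  record Flip (a b : ℕ) (G : Gph) (c d : Col) (u : V) : Set where
    constructor mkFlip
    field
      a⇒b : Sees G c u a → Sees G d u b
      b⇒a : Sees G c u b → Sees G d u a
      a⇐b : Sees G d u a → Sees G c u b
      b⇐a : Sees G d u b → Sees G c u a
  open Flip public

  K-sees : ∀ {a b G c d u x} → K a b G c d → ¬ In a b x → Sees G c u x → Sees G d u x
  K-sees {a} {b} k ¬i (see v e q) = see v e (trans (sym (K-out k e (λ i → ¬i (subst (In a b) q i)))) q)

  K-misses : ∀ {a b G c d u x} → K a b G c d → ¬ In a b x → Misses G c u x → Misses G d u x
  K-misses k ¬i m s = m (K-sees (K-sym k) ¬i s)

  -- Bounding every duplicate-free list of neighbours makes the passage to subgraphs immediate.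
  DegLe : Gph → V → ℕ → Set
  DegLe G u k = (vs : List V) → Unique vs → All (E G u) vs → length vs ≤ k

  all-sees : ∀ {p G c u} → Ok p G c → (xs : List ℕ) → Unique xs → All (Sees G c u) xs →
             ∃ λ vs → Unique vs × All (E G u) vs × map (c u) vs ≡ xs
  all-sees ok [] _ [] = [] , [] , [] , refl
  all-sees {c = c} {u} ok (x ∷ xs) (x∉ ∷ uxs) (see v e q ∷ ss) with all-sees ok xs uxs ss
  ... | vs , uvs , es , eq = v ∷ vs ,
        All.tabulate (λ {w} w∈ v≡w → All.lookup x∉ (subst (_∈ xs) (trans (cong (c u) (sym v≡w)) q) (subst (c u w ∈_) eq (∈-map⁺ (c u) w∈))) refl) ∷ uvs
        , e ∷ es , cong₂ _∷_ q eq

  sees-length : ∀ {p G c u k} → Ok p G c → DegLe G u k → (xs : List ℕ) → Unique xs → All (Sees G c u) xs → length xs ≤ k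
  sees-length {c = c} {u} {k} ok deg xs uxs ss with all-sees ok xs uxs ss
  ... | vs , uvs , es , eq = subst (_≤ k) (trans (sym (length-map (c u) vs)) (cong length eq)) (deg vs uvs es)

  opaque
    some-missing : ∀ {p G c u k} → Ok p G c → DegLe G u k → (xs : List ℕ) → Unique xs → k < length xs → ∃ λ x → x ∈ xs × Misses G c u x
    some-missing {G = G} {c} {u} ok deg xs uxs len with All.all? (sees? G c u) xs
    ... | yes all = ⊥-elim (<⇒≱ len (sees-length ok deg xs uxs all))
    ... | no ¬all = let x , x∈ , m = find (¬All⇒Any¬ (sees? G c u) xs ¬all) in x , x∈ , m

-- Deleting and recolouring an edge; Kempe chains.

module _ {n : ℕ} where

  private
    W : Set
    W = Fin n

  data Pair (v w : W) : W → W → Set where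
    fwd : Pair v w v w
    bwd : Pair v w w v

  pair? : ∀ v w u x → Dec (Pair v w u x)
  pair? v w u x = map′ (λ { (inj₁ (refl , refl)) → fwd ; (inj₂ (refl , refl)) → bwd })
                       (λ { fwd → inj₁ (refl , refl) ; bwd → inj₂ (refl , refl) })
                       (((u Fin.≟ v) ×-dec (x Fin.≟ w)) ⊎-dec ((u Fin.≟ w) ×-dec (x Fin.≟ v)))

  pair-sym : ∀ {v w u x} → Pair v w u x → Pair v w x u
  pair-sym fwd = bwd
  pair-sym bwd = fwd

  _∖_ : Gph {n} → W × W → Gph
  rel (G ∖ (v , w)) u x = E G u x × ¬ Pair v w u x
  rel? (G ∖ (v , w)) u x = E? G u x ×-dec ¬? (pair? v w u x)
  rel-sym (G ∖ _) (e , q) = E-sym e , q ∘ pair-sym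
  rel-irr (G ∖ _) (e , _) = E-irr e

  upd : Col → W → W → ℕ → Col
  upd c v w a u x with pair? v w u x
  ... | yes _ = a
  ... | no _ = c u x

  upd-on : ∀ (c : Col) {v w a u x} → Pair v w u x → upd c v w a u x ≡ a
  upd-on c {v} {w} {a} {u} {x} p with pair? v w u x
  ... | yes _ = refl
  ... | no q = ⊥-elim (q p)

  upd-off : ∀ (c : Col) {v w a u x} → ¬ Pair v w u x → upd c v w a u x ≡ c u x
  upd-off c {v} {w} {a} {u} {x} q with pair? v w u x
  ... | yes p = ⊥-elim (q p)
  ... | no _ = refl

  Ok-⊆ : ∀ {p} {G H : Gph {n}} {c} → (∀ {u v} → E H u v → E G u v) → Ok p G c → Ok p H c
  symm (Ok-⊆ s ok) e = symm ok (s e)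
  bound (Ok-⊆ s ok) e = bound ok (s e)
  proper (Ok-⊆ s ok) e f = proper ok (s e) (s f)

  ∖-⊆ : ∀ {G : Gph {n}} {v w u x} → E (G ∖ (v , w)) u x → E G u x
  ∖-⊆ (mkE (e , _)) = e

  module _ {G : Gph {n}} {v w : W} where

    upd-ok : ∀ {p c a} → v ≢ w → Ok p (G ∖ (v , w)) c → a < p →
             Misses (G ∖ (v , w)) c v a → Misses (G ∖ (v , w)) c w a → Ok p G (upd c v w a)
    symm (upd-ok {p} {c} {a} v≢w ok a< mv mw) {u} {x} e with pair? v w u x
    ... | yes q = sym (upd-on c (pair-sym q))
    ... | no q = trans (symm ok (mkE (e , q))) (sym (upd-off c (q ∘ pair-sym)))
    bound (upd-ok {p} {c} {a} v≢w ok a< mv mw) {u} {x} e with pair? v w u x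
    ... | yes _ = a<
    ... | no q = bound ok (mkE (e , q))
    proper (upd-ok {p} {c} {a} v≢w ok a< mv mw) {u} {x} {y} e f eq with pair? v w u x | pair? v w u y
    ... | yes fwd | yes fwd = refl
    ... | yes fwd | yes bwd = ⊥-elim (v≢w refl)
    ... | yes bwd | yes fwd = ⊥-elim (v≢w refl)
    ... | yes bwd | yes bwd = refl
    ... | yes fwd | no q = ⊥-elim (mv (see y (mkE (f , q)) (sym eq)))
    ... | yes bwd | no q = ⊥-elim (mw (see y (mkE (f , q)) (sym eq)))
    ... | no q | yes fwd = ⊥-elim (mv (see x (mkE (e , q)) eq))
    ... | no q | yes bwd = ⊥-elim (mw (see x (mkE (e , q)) eq))
    ... | no q | no r = proper ok (mkE (e , q)) (mkE (f , r)) eq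

    sees-lift : ∀ {c : Col} {a u x} → Sees (G ∖ (v , w)) c u x → Sees G (upd c v w a) u x
    sees-lift {c} {a} (see y (mkE (e , q)) eq) = see y e (trans (upd-off c q) eq)

    sees-split : ∀ {c : Col} {a u x} → Sees G (upd c v w a) u x → ((u ≡ v ⊎ u ≡ w) × x ≡ a) ⊎ Sees (G ∖ (v , w)) c u x
    sees-split {c} {a} {u} {x} (see y e eq) with pair? v w u y
    ... | yes fwd = inj₁ (inj₁ refl , sym eq)
    ... | yes bwd = inj₁ (inj₂ refl , sym eq)
    ... | no q = inj₂ (see y (mkE (e , q)) eq)

    upd-self : ∀ {p c} → Ok p G c → E G v w → Agree G c (upd c v w (c v w))
    upd-self {c = c} ok e = mkA λ {u} {x} f → aux f (pair? v w u x)
      where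
      aux : ∀ {u x} → E G u x → Dec (Pair v w u x) → c u x ≡ upd c v w (c v w) u x
      aux f (yes fwd) = sym (upd-on c {v} {w} fwd)
      aux f (yes bwd) = trans (sym (symm ok e)) (sym (upd-on c {v} {w} bwd))
      aux f (no q) = sym (upd-off c q)

    sees-sub : ∀ {c : Col} {u x} → Sees (G ∖ (v , w)) c u x → Sees G c u x
    sees-sub (see y (mkE (e , _)) eq) = see y e eq

    sees-unsub : ∀ {p c u x} → Ok p G c → E G v w → Sees G c u x → ((u ≡ v ⊎ u ≡ w) × x ≡ c v w) ⊎ Sees (G ∖ (v , w)) c u x
    sees-unsub {c = c} {u} ok e (see y f eq) with pair? v w u y
    ... | yes fwd = inj₁ (inj₁ refl , sym eq)
    ... | yes bwd = inj₁ (inj₂ refl , trans (sym eq) (sym (symm ok e)))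
    ... | no q = inj₂ (see y (mkE (f , q)) eq)

    upd-K : ∀ {p c a b d} → Ok p G c → E G v w → In a b (c v w) → In a b d → K a b G c (upd c v w d)
    upd-K {c = c} {a} {b} {d} ok e i j = mkK λ {u} {x} f → aux (pair? v w u x)
      where
      aux : ∀ {u x} → Dec (Pair v w u x) → c u x ≡ upd c v w d u x ⊎ (In a b (c u x) × In a b (upd c v w d u x))
      aux (yes fwd) = inj₂ (i , subst (In a b) (sym (upd-on c {v} {w} fwd)) j)
      aux (yes bwd) = inj₂ (subst (In a b) (symm ok e) i , subst (In a b) (sym (upd-on c {v} {w} bwd)) j)
      aux (no q) = inj₁ (sym (upd-off c q))

    recolour-ok : ∀ {p c a} → Ok p G c → E G v w → a < p → Misses G c v a → Misses G c w a → Ok p G (upd c v w a)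
    recolour-ok ok e a< mv mw = upd-ok (E-≢ e) (Ok-⊆ ∖-⊆ ok) a< (mv ∘ sees-sub) (mw ∘ sees-sub)

  -- The outcome of interchanging `a` and `b` along the path that starts at `v`. Of the path itself
  -- only `chRest` is remembered: there is a single other end, and inner vertices keep what they
  -- see. An empty path has `chEnd` equal to `v`.
  record Chain (p : ℕ) (G : Gph {n}) (c : Col) (a b : ℕ) (v : W) : Set where
    field
      chCol   : Col
      chEnd   : W
      chOk    : Ok p G chCol
      chMove  : K a b G c chCol
      chStart : Flip a b G c chCol v
      chRest  : ∀ u → u ≡ v ⊎ u ≡ chEnd ⊎ Same a b G c chCol u
      chEach  : ∀ u → Same a b G c chCol u ⊎ Flip a b G c chCol u
  open Chain public

  same-refl : ∀ {a b} {G : Gph {n}} {c : Col} {u} → Same a b G c c u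
  same-refl = mkSame (λ _ s → s) (λ _ s → s)

  unseen-pair : ∀ {a b G c} {d : Col} {u : W} → Same a b G c d u ⊎ Flip a b G c d u → Misses G c u a → Misses G c u b →
                Misses G d u a × Misses G d u b
  unseen-pair (inj₁ s) ma mb = ma ∘ same⇐ s (inj₁ refl) , mb ∘ same⇐ s (inj₂ refl)
  unseen-pair (inj₂ f) ma mb = mb ∘ a⇐b f , ma ∘ b⇐a f

  module _ {a b : ℕ} {G H : Gph {n}} {c d c′ d′ : Col {n}} {u : W} (f : ∀ {x} → Sees G c u x → Sees H c′ u x) (f′ : ∀ {x} → Sees H c′ u x → Sees G c u x)
           (g : ∀ {x} → Sees G d u x → Sees H d′ u x) (g′ : ∀ {x} → Sees H d′ u x → Sees G d u x) where

    same-cong : Same a b G c d u → Same a b H c′ d′ u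
    same-cong s = mkSame (λ i z → g (same⇒ s i (f′ z))) (λ i z → f (same⇐ s i (g′ z)))

    flip-cong : Flip a b G c d u → Flip a b H c′ d′ u
    flip-cong s = mkFlip (g ∘ a⇒b s ∘ f′) (g ∘ b⇒a s ∘ f′) (f ∘ a⇐b s ∘ g′) (f ∘ b⇐a s ∘ g′)

  flip-swap : ∀ {a b G c d} {u : W} → Flip a b G c d u → Flip b a G c d u
  flip-swap s = mkFlip (b⇒a s) (a⇒b s) (b⇐a s) (a⇐b s)

  same-swap : ∀ {a b G c d} {u : W} → Same a b G c d u → Same b a G c d u
  same-swap s = mkSame (same⇒ s ∘ Sum.swap) (same⇐ s ∘ Sum.swap)

  -- The (a,b)-chain from v is found by deleting its first edge vw (coloured b), interchanging along
  -- the (b,a)-chain from w, and putting vw back with colour a.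
  chain-fuel : ∀ k (ps : List (W × W)) → length ps ≤ k → ∀ {p G c a b v} → (∀ {u x} → E G u x → (u , x) ∈ ps) →
               Ok p G c → a < p → b < p → a ≢ b → Misses G c v a → Chain p G c a b v
  chain-fuel k ps len {p} {G} {c} {a} {b} {v} cov ok a< b< a≢b ma with sees? G c v b
  ... | no mb = record
    { chCol = c ; chEnd = v ; chOk = ok ; chMove = K-refl
    ; chStart = mkFlip (⊥-elim ∘ ma) (⊥-elim ∘ mb) (⊥-elim ∘ ma) (⊥-elim ∘ mb)
    ; chRest = λ u → inj₂ (inj₂ same-refl) ; chEach = λ u → inj₁ same-refl }
  chain-fuel zero [] len cov ok a< b< a≢b ma | yes (see w e q) = case cov e of λ ()
  chain-fuel (suc k) ps len {p} {G} {c} {a} {b} {v} cov ok a< b< a≢b ma | yes (see w e q) = finish (sees? G c w a)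
    where
    G′ : Gph {n}
    G′ = G ∖ (v , w)
    ok₀ : Ok p G′ c
    ok₀ = Ok-⊆ ∖-⊆ ok
    split : ∀ {u x} → Sees G c u x → ((u ≡ v ⊎ u ≡ w) × x ≡ b) ⊎ Sees G′ c u x
    split s with sees-unsub ok e s
    ... | inj₁ (i , j) = inj₁ (i , trans j q)
    ... | inj₂ z = inj₂ z
    mva : Misses G′ c v a
    mva = ma ∘ sees-sub
    mvb : Misses G′ c v b
    mvb (see y (mkE (f , r)) z) = r (subst (Pair v w v) (sym (proper ok f e (trans z (sym q)))) fwd)
    mwb : Misses G′ c w b
    mwb (see y (mkE (f , r)) z) = r (subst (Pair v w w) (sym (proper ok f (E-sym e) (trans z (trans (sym q) (symm ok e))))) bwd)
    v≢w : v ≢ w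
    v≢w = E-≢ e

    module Extend {c₁ : Col} (ok₁ : Ok p G′ c₁) (k₁ : K a b G′ c c₁) (mva₁ : Misses G′ c₁ v a) (mvb₁ : Misses G′ c₁ v b) (mwa₁ : Misses G′ c₁ w a) where
      c′ : Col
      c′ = upd c₁ v w a
      ok′ : Ok p G c′
      ok′ = upd-ok v≢w ok₁ a< mva₁ mwa₁
      on : ∀ {u x} → Pair v w u x → In a b (c′ u x)
      on r = inj₁ (upd-on c₁ r)
      k′ : K a b G c c′
      k′ = mkK λ {u} {x} f → aux f (pair? v w u x)
        where
        aux : ∀ {u x} → E G u x → Dec (Pair v w u x) → c u x ≡ c′ u x ⊎ (In a b (c u x) × In a b (c′ u x))
        aux f (yes fwd) = inj₂ (inj₂ q , on fwd)
        aux f (yes bwd) = inj₂ (inj₂ (trans (sym (symm ok e)) q) , on bwd)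
        aux {u} {x} f (no r) = subst (λ z → c u x ≡ z ⊎ (In a b (c u x) × In a b z)) (sym (upd-off c₁ r)) (at k₁ (mkE (f , r)))
      split′ : ∀ {u x} → Sees G c′ u x → ((u ≡ v ⊎ u ≡ w) × x ≡ a) ⊎ Sees G′ c₁ u x
      split′ = sees-split
      lift′ : ∀ {u x} → Sees G′ c₁ u x → Sees G c′ u x
      lift′ = sees-lift
      va : Sees G c′ v a
      va = see w e (upd-on c₁ {v} {w} fwd)
      wa : Sees G c′ w a
      wa = see v (E-sym e) (upd-on c₁ {v} {w} bwd)
      vb : Sees G c v b
      vb = see w e q
      wb : Sees G c w b
      wb = see v (E-sym e) (trans (sym (symm ok e)) q)
      start′ : Flip a b G c c′ v
      start′ = mkFlip (⊥-elim ∘ ma) (λ _ → va) (λ _ → vb) λ s → case split′ s of λ where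
        (inj₁ (_ , z)) → ⊥-elim (a≢b (sym z))
        (inj₂ s′) → ⊥-elim (mvb₁ s′)
      off : ∀ {u x} → u ≢ v → u ≢ w → Sees G c u x → Sees G′ c u x
      off p₁ p₂ s with split s
      ... | inj₁ (inj₁ z , _) = ⊥-elim (p₁ z)
      ... | inj₁ (inj₂ z , _) = ⊥-elim (p₂ z)
      ... | inj₂ s′ = s′
      off′ : ∀ {u x} → u ≢ v → u ≢ w → Sees G c′ u x → Sees G′ c₁ u x
      off′ p₁ p₂ s with split′ s
      ... | inj₁ (inj₁ z , _) = ⊥-elim (p₁ z)
      ... | inj₁ (inj₂ z , _) = ⊥-elim (p₂ z)
      ... | inj₂ s′ = s′

    finish : Dec (Sees G c w a) → Chain p G c a b v
    finish (no mwa) = record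
      { chCol = c′ ; chEnd = w ; chOk = ok′ ; chMove = k′ ; chStart = start′
      ; chRest = λ u → case u Fin.≟ v of λ where
          (yes r) → inj₁ r
          (no r) → case u Fin.≟ w of λ where
            (yes s) → inj₂ (inj₁ s)
            (no s) → inj₂ (inj₂ (other u r s))
      ; chEach = λ u → case u Fin.≟ v of λ where
          (yes refl) → inj₂ start′
          (no r) → case u Fin.≟ w of λ where
            (yes refl) → inj₂ flip-w
            (no s) → inj₁ (other u r s) }
      where
      open Extend ok₀ K-refl mva mvb (mwa ∘ sees-sub)
      other : ∀ u → u ≢ v → u ≢ w → Same a b G c c′ u
      other u r s = mkSame (λ _ z → lift′ (off r s z)) (λ _ z → sees-sub (off′ r s z))
      flip-w : Flip a b G c c′ w
      flip-w = mkFlip (⊥-elim ∘ mwa) (λ _ → wa) (λ _ → wb) λ s → case split′ s of λ where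
        (inj₁ (_ , z)) → ⊥-elim (a≢b (sym z))
        (inj₂ s′) → ⊥-elim (mwb s′)
    finish (yes swa) = record
      { chCol = c′ ; chEnd = chEnd ih ; chOk = ok′ ; chMove = k′ ; chStart = start′
      ; chRest = λ u → case u Fin.≟ v of λ where
          (yes r) → inj₁ r
          (no r) → case u Fin.≟ w of λ where
            (yes refl) → inj₂ (inj₂ same-w)
            (no s) → case chRest ih u of λ where
              (inj₁ z) → ⊥-elim (s z)
              (inj₂ (inj₁ z)) → inj₂ (inj₁ z)
              (inj₂ (inj₂ z)) → inj₂ (inj₂ (same-up u r s (same-swap z)))
      ; chEach = λ u → case u Fin.≟ v of λ where
          (yes refl) → inj₂ start′
          (no r) → case u Fin.≟ w of λ where
            (yes refl) → inj₁ same-w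
            (no s) → case chEach ih u of λ where
              (inj₁ z) → inj₁ (same-up u r s (same-swap z))
              (inj₂ z) → inj₂ (flip-cong sees-sub (off r s) lift′ (off′ r s) (flip-swap z)) }
      where
      P? : ∀ (q : W × W) → Dec (¬ Pair v w (proj₁ q) (proj₂ q))
      P? (u , x) = ¬? (pair? v w u x)
      ih : Chain p G′ c b a w
      ih = chain-fuel k (filter P? ps)
             (≤-pred (≤-trans (filter-notAll P? ps (lose (cov e) (λ z → z fwd))) len))
             (λ { (mkE (f , r)) → ∈-filter⁺ P? (cov f) r }) ok₀ b< a< (a≢b ∘ sym) mwb
      -- Without `vw` the vertex `v` sees neither colour, so the shorter chain cannot reach it and
      -- `a` stays free there.
      mv₁ : Misses G′ (chCol ih) v b × Misses G′ (chCol ih) v a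
      mv₁ = unseen-pair (chEach ih v) mvb mva
      swa′ : Sees G′ c w a
      swa′ with split swa
      ... | inj₁ (_ , z) = ⊥-elim (a≢b z)
      ... | inj₂ s = s
      open Extend (chOk ih) (K-swap (chMove ih)) (proj₂ mv₁) (proj₁ mv₁) (mwb ∘ b⇐a (chStart ih))
      same-w : Same a b G c c′ w
      same-w = mkSame (λ { (inj₁ refl) _ → wa ; (inj₂ refl) _ → lift′ (b⇒a (chStart ih) swa′) })
                      (λ { (inj₁ refl) _ → swa ; (inj₂ refl) _ → wb })
      same-up : ∀ u → u ≢ v → u ≢ w → Same a b G′ c (chCol ih) u → Same a b G c c′ u
      same-up u r s = same-cong sees-sub (off r s) lift′ (off′ r s)

  opaque
    chain : ∀ {p G c a b v} → Ok p G c → a < p → b < p → a ≢ b → Misses G c v a → Chain p G c a b v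
    chain = chain-fuel _ (cartesianProduct (allFin n) (allFin n)) ≤-refl
              (λ {u} {x} _ → ∈-cartesianProduct⁺ (∈-allFin u) (∈-allFin x))

-- Colourings of a graph as extensions of colourings with one vertex deleted.

Rel : ℕ → ℕ → ℕ → ℕ → Set
Rel s t a b = a ≡ b ⊎ (In s t a × In s t b)

same : ∀ {s t a} → Rel s t a a
same = inj₁ refl

module _ {n : ℕ} where

  _⊖_ : Gph {n} → Fin n → Gph {n}
  rel (G ⊖ q) u v = E G u v × u ≢ q × v ≢ q
  rel? (G ⊖ q) u v = E? G u v ×-dec ¬? (u Fin.≟ q) ×-dec ¬? (v Fin.≟ q)
  rel-sym (G ⊖ q) (e , a , b) = E-sym e , b , a
  rel-irr (G ⊖ q) (e , _) = E-irr e

  ⊖-⊆ : ∀ {G : Gph {n}} {q u v} → E (G ⊖ q) u v → E G u v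
  ⊖-⊆ (mkE (e , _)) = e

  -- A colouring of G is a colouring φ of H = G ⊖ q together with distinct representatives σ of the lists
  -- L φ y of colours that are available for the edges qy.
  module Vertex (G : Gph {n}) (q : Fin n) where

    H : Gph {n}
    H = G ⊖ q

    X : Col {n} → (Fin n → ℕ) → Col {n}
    X φ σ u v with u Fin.≟ q | v Fin.≟ q
    ... | yes _ | _ = σ v
    ... | no _ | yes _ = σ u
    ... | no _ | no _ = φ u v

    X-q : ∀ {φ σ v} → X φ σ q v ≡ σ v
    X-q {v = v} with q Fin.≟ q | v Fin.≟ q
    ... | yes _ | _ = refl
    ... | no z | _ = ⊥-elim (z refl)

    X-q′ : ∀ {φ σ u} → u ≢ q → X φ σ u q ≡ σ u
    X-q′ {u = u} u≢ with u Fin.≟ q | q Fin.≟ q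
    ... | yes z | _ = ⊥-elim (u≢ z)
    ... | no _ | yes _ = refl
    ... | no _ | no z = ⊥-elim (z refl)

    X-off : ∀ {φ σ u v} → u ≢ q → v ≢ q → X φ σ u v ≡ φ u v
    X-off {u = u} {v} u≢ v≢ with u Fin.≟ q | v Fin.≟ q
    ... | yes z | _ = ⊥-elim (u≢ z)
    ... | no _ | yes z = ⊥-elim (v≢ z)
    ... | no _ | no _ = refl

    L : Col {n} → Fin n → ℕ → Set
    L φ y a = a < 5 × Misses H φ y a

    record SDR (φ : Col {n}) (σ : Fin n → ℕ) : Set where
      constructor mkSDR
      field
        lists : ∀ {y} → E G q y → L φ y (σ y)
        inj   : ∀ {y y′} → E G q y → E G q y′ → σ y ≡ σ y′ → y ≡ y′
    open SDR public

    data View (u v : Fin n) : Set where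
      atl : u ≡ q → View u v
      atr : u ≢ q → v ≡ q → View u v
      off : u ≢ q → v ≢ q → View u v

    view : ∀ u v → View u v
    view u v with u Fin.≟ q | v Fin.≟ q
    ... | yes z | _ = atl z
    ... | no a | yes z = atr a z
    ... | no a | no b = off a b

    X-ok : ∀ {φ σ} → Ok 5 H φ → SDR φ σ → Ok 5 G (X φ σ)
    symm (X-ok ok s) {u} {v} e with view u v
    ... | atl refl = trans X-q (sym (X-q′ (E-≢ (E-sym e))))
    ... | atr a refl = trans (X-q′ a) (sym X-q)
    ... | off a b = trans (X-off a b) (trans (symm ok (mkE (e , a , b))) (sym (X-off b a)))
    bound (X-ok ok s) {u} {v} e with view u v
    ... | atl refl = subst (_< 5) (sym X-q) (proj₁ (lists s e))
    ... | atr a refl = subst (_< 5) (sym (X-q′ a)) (proj₁ (lists s (E-sym e)))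
    ... | off a b = subst (_< 5) (sym (X-off a b)) (bound ok (mkE (e , a , b)))
    proper (X-ok {φ} {σ} ok s) {u} {v} {w} e f eq with view u v | view u w
    ... | atl refl | _ = inj s e f (trans (sym X-q) (trans eq X-q))
    ... | atr a refl | atl z = ⊥-elim (a z)
    ... | atr a refl | atr _ refl = refl
    ... | atr a refl | off _ b = ⊥-elim (proj₂ (lists s (E-sym e)) (see w (mkE (f , a , b)) (trans (sym (X-off a b)) (trans (sym eq) (X-q′ a)))))
    ... | off a _ | atl z = ⊥-elim (a z)
    ... | off a b | atr _ refl = ⊥-elim (proj₂ (lists s (E-sym f)) (see v (mkE (e , a , b)) (trans (sym (X-off a b)) (trans eq (X-q′ a)))))
    ... | off a b | off _ b′ = proper ok (mkE (e , a , b)) (mkE (f , a , b′)) (trans (sym (X-off a b)) (trans eq (X-off a b′)))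

    X-K : ∀ {s t φ φ′ σ σ′} → K s t H φ φ′ → (∀ y → E G q y → Rel s t (σ y) (σ′ y)) → K s t G (X φ σ) (X φ′ σ′)
    X-K {s} {t} {φ} {φ′} {σ} {σ′} k r = mkK λ {u} {v} e → aux e (view u v)
      where
      aux : ∀ {u v} → E G u v → View u v → Rel s t (X φ σ u v) (X φ′ σ′ u v)
      aux {v = v} e (atl refl) = subst₂ (Rel s t) (sym X-q) (sym X-q) (r v e)
      aux {u} e (atr a refl) = subst₂ (Rel s t) (sym (X-q′ a)) (sym (X-q′ a)) (r u (E-sym e))
      aux e (off a b) = subst₂ (Rel s t) (sym (X-off a b)) (sym (X-off a b)) (at k (mkE (e , a , b)))

    split : ∀ {ρ} → Ok 5 G ρ → Ok 5 H ρ × SDR ρ (ρ q) × Agree G ρ (X ρ (ρ q))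
    split {ρ} ok = Ok-⊆ ⊖-⊆ ok
      , mkSDR (λ {y} e → bound ok e , λ { (see v (mkE (f , a , b)) z) → b (sym (proper ok (E-sym e) f (trans (symm ok (E-sym e)) (sym z)))) })
              (λ e f z → proper ok e f z)
      , mkA λ {u} {v} e → aux e (view u v)
      where
      aux : ∀ {u v} → E G u v → View u v → ρ u v ≡ X ρ (ρ q) u v
      aux e (atl refl) = sym X-q
      aux e (atr a refl) = trans (symm ok e) (sym (X-q′ a))
      aux e (off a b) = sym (X-off a b)

    record Enum (y₁ y₂ y₃ : Fin n) : Set where
      constructor mkEnum
      field
        d₁₂ : y₁ ≢ y₂
        d₁₃ : y₁ ≢ y₃
        d₂₃ : y₂ ≢ y₃
        e₁  : E G q y₁
        e₂  : E G q y₂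
        e₃  : E G q y₃
        exh : ∀ {y} → E G q y → y ≡ y₁ ⊎ y ≡ y₂ ⊎ y ≡ y₃
    open Enum public

    rot : ∀ {y₁ y₂ y₃} → Enum y₁ y₂ y₃ → Enum y₂ y₃ y₁
    rot en = mkEnum (d₂₃ en) (≢-sym (d₁₂ en)) (≢-sym (d₁₃ en)) (e₂ en) (e₃ en) (e₁ en)
               (λ e → case exh en e of λ { (inj₁ z) → inj₂ (inj₂ z) ; (inj₂ (inj₁ z)) → inj₁ z ; (inj₂ (inj₂ z)) → inj₂ (inj₁ z) })

    swap₂₃ : ∀ {y₁ y₂ y₃} → Enum y₁ y₂ y₃ → Enum y₁ y₃ y₂
    swap₂₃ en = mkEnum (d₁₃ en) (d₁₂ en) (≢-sym (d₂₃ en)) (e₁ en) (e₃ en) (e₂ en)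
               (λ e → case exh en e of λ { (inj₁ z) → inj₁ z ; (inj₂ (inj₁ z)) → inj₂ (inj₂ z) ; (inj₂ (inj₂ z)) → inj₂ (inj₁ z) })

    asg : (y₁ y₂ : Fin n) → ℕ → ℕ → ℕ → Fin n → ℕ
    asg y₁ y₂ a b c v with v Fin.≟ y₁ | v Fin.≟ y₂
    ... | yes _ | _ = a
    ... | no _ | yes _ = b
    ... | no _ | no _ = c

    module _ {y₁ y₂ y₃ : Fin n} (en : Enum y₁ y₂ y₃) where

      asg₁ : ∀ {a b c} → asg y₁ y₂ a b c y₁ ≡ a
      asg₁ with y₁ Fin.≟ y₁ | y₁ Fin.≟ y₂
      ... | yes _ | _ = refl
      ... | no z | _ = ⊥-elim (z refl)

      asg₂ : ∀ {a b c} → asg y₁ y₂ a b c y₂ ≡ b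
      asg₂ with y₂ Fin.≟ y₁ | y₂ Fin.≟ y₂
      ... | yes z | _ = ⊥-elim (d₁₂ en (sym z))
      ... | no _ | yes _ = refl
      ... | no _ | no z = ⊥-elim (z refl)

      asg₃ : ∀ {a b c} → asg y₁ y₂ a b c y₃ ≡ c
      asg₃ with y₃ Fin.≟ y₁ | y₃ Fin.≟ y₂
      ... | yes z | _ = ⊥-elim (d₁₃ en (sym z))
      ... | no _ | yes z = ⊥-elim (d₂₃ en (sym z))
      ... | no _ | no z = refl

    record T3 {y₁ y₂ y₃} (en : Enum y₁ y₂ y₃) (φ : Col {n}) (a b c : ℕ) : Set where
      constructor mkT
      field
        l₁ : L φ y₁ a
        l₂ : L φ y₂ b
        l₃ : L φ y₃ c
        n₁₂ : a ≢ b
        n₁₃ : a ≢ c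
        n₂₃ : b ≢ c
    open T3 public

    S : ∀ {y₁ y₂ y₃} (en : Enum y₁ y₂ y₃) (φ : Col {n}) (a b c : ℕ) → Col {n}
    S {y₁} {y₂} en φ a b c = X φ (asg y₁ y₂ a b c)

    module _ {y₁ y₂ y₃ : Fin n} (en : Enum y₁ y₂ y₃) where

      each₃ : (P : Fin n → Set) → P y₁ → P y₂ → P y₃ → ∀ {y} → E G q y → P y
      each₃ P p₁ p₂ p₃ e with exh en e
      ... | inj₁ refl = p₁
      ... | inj₂ (inj₁ refl) = p₂
      ... | inj₂ (inj₂ refl) = p₃

      T3-sdr : ∀ {φ a b c} → T3 en φ a b c → SDR φ (asg y₁ y₂ a b c)
      T3-sdr {φ} {a} {b} {c} t = mkSDR
        (λ e → each₃ (λ y → L φ y (asg y₁ y₂ a b c y))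
                 (subst (L φ y₁) (sym (asg₁ en)) (l₁ t)) (subst (L φ y₂) (sym (asg₂ en)) (l₂ t)) (subst (L φ y₃) (sym (asg₃ en)) (l₃ t)) e)
        (λ {y} {y′} e f → each₃ (λ y → ∀ {y′} → E G q y′ → σ y ≡ σ y′ → y ≡ y′)
          (λ f → each₃ (λ y′ → σ y₁ ≡ σ y′ → y₁ ≡ y′) (λ _ → refl)
                   (λ z → ⊥-elim (n₁₂ t (trans (sym (asg₁ en)) (trans z (asg₂ en)))))
                   (λ z → ⊥-elim (n₁₃ t (trans (sym (asg₁ en)) (trans z (asg₃ en))))) f)
          (λ f → each₃ (λ y′ → σ y₂ ≡ σ y′ → y₂ ≡ y′)
                   (λ z → ⊥-elim (n₁₂ t (trans (sym (asg₁ en)) (trans (sym z) (asg₂ en)))))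
                   (λ _ → refl)
                   (λ z → ⊥-elim (n₂₃ t (trans (sym (asg₂ en)) (trans z (asg₃ en))))) f)
          (λ f → each₃ (λ y′ → σ y₃ ≡ σ y′ → y₃ ≡ y′)
                   (λ z → ⊥-elim (n₁₃ t (trans (sym (asg₁ en)) (trans (sym z) (asg₃ en)))))
                   (λ z → ⊥-elim (n₂₃ t (trans (sym (asg₂ en)) (trans (sym z) (asg₃ en)))))
                   (λ _ → refl) f) e f)
        where
        σ : Fin n → ℕ
        σ = asg y₁ y₂ a b c

      sdr-T3 : ∀ {φ σ} → SDR φ σ → T3 en φ (σ y₁) (σ y₂) (σ y₃)
      sdr-T3 s = mkT (lists s (e₁ en)) (lists s (e₂ en)) (lists s (e₃ en))
                     (d₁₂ en ∘ inj s (e₁ en) (e₂ en)) (d₁₃ en ∘ inj s (e₁ en) (e₃ en)) (d₂₃ en ∘ inj s (e₂ en) (e₃ en))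

      S-σ : ∀ {φ σ} → Ok 5 H φ → SDR φ σ → Kempe 5 G (X φ σ) (S en φ (σ y₁) (σ y₂) (σ y₃))
      S-σ {φ} {σ} ok s = step-kempe {a = 0} {0} (X-ok ok s) (X-ok ok (T3-sdr (sdr-T3 s)))
        (X-K K-refl (λ y e → inj₁ (each₃ (λ y → σ y ≡ asg y₁ y₂ (σ y₁) (σ y₂) (σ y₃) y) (sym (asg₁ en)) (sym (asg₂ en)) (sym (asg₃ en)) e)))

      extension-step : ∀ {φ φ′ a b c a′ b′ c′} s t → Ok 5 H φ → Ok 5 H φ′ → K s t H φ φ′ → T3 en φ a b c → T3 en φ′ a′ b′ c′ →
           Rel s t a a′ → Rel s t b b′ → Rel s t c c′ → Kempe 5 G (S en φ a b c) (S en φ′ a′ b′ c′)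
      extension-step {φ} {φ′} {a} {b} {c} {a′} {b′} {c′} s t ok ok′ k x x′ r₁ r₂ r₃ = step-kempe (X-ok ok (T3-sdr x)) (X-ok ok′ (T3-sdr x′))
        (X-K k λ y e → each₃ (λ y → Rel s t (asg y₁ y₂ a b c y) (asg y₁ y₂ a′ b′ c′ y))
           (subst₂ (Rel s t) (sym (asg₁ en)) (sym (asg₁ en)) r₁) (subst₂ (Rel s t) (sym (asg₂ en)) (sym (asg₂ en)) r₂)
           (subst₂ (Rel s t) (sym (asg₃ en)) (sym (asg₃ en)) r₃) e)

      T3-rot : ∀ {φ a b c} → T3 en φ a b c → T3 (rot en) φ b c a
      T3-rot t = mkT (l₂ t) (l₃ t) (l₁ t) (n₂₃ t) (≢-sym (n₁₂ t)) (≢-sym (n₁₃ t))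

      -- Case analyses are carried out for one preferred neighbour of `q`; this relabelling carries
      -- them over to the other two.
      S-rot : ∀ {φ a b c} → Ok 5 H φ → T3 en φ a b c → Kempe 5 G (S en φ a b c) (S (rot en) φ b c a)
      S-rot {φ} {a} {b} {c} ok t = step-kempe {a = 0} {0} (X-ok ok (T3-sdr t)) (X-ok ok (sdr′ (T3-rot t)))
        (X-K K-refl (λ y e → inj₁ (each₃ (λ y → asg y₁ y₂ a b c y ≡ asg y₂ y₃ b c a y)
          (trans (asg₁ en) (sym (asg₃ (rot en)))) (trans (asg₂ en) (sym (asg₁ (rot en)))) (trans (asg₃ en) (sym (asg₂ (rot en)))) e)))
        where
        sdr′ : T3 (rot en) φ b c a → SDR φ (asg y₂ y₃ b c a)
        sdr′ t′ = mkSDR (λ e → subst (L φ _) (eqs e) (lists (T3-sdr t) e)) (λ e f z → inj (T3-sdr t) e f (trans (eqs e) (trans z (sym (eqs f)))))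
          where
          eqs : ∀ {y} → E G q y → asg y₁ y₂ a b c y ≡ asg y₂ y₃ b c a y
          eqs = each₃ (λ y → asg y₁ y₂ a b c y ≡ asg y₂ y₃ b c a y)
            (trans (asg₁ en) (sym (asg₃ (rot en)))) (trans (asg₂ en) (sym (asg₁ (rot en)))) (trans (asg₃ en) (sym (asg₂ (rot en))))

infix 4 _#_
_#_ : ℕ → List ℕ → Set
x # [] = ⊤
x # (y ∷ ys) = x ≢ y × x # ys

∉-# : ∀ {x} ys → x ∉ ys → x # ys
∉-# [] _ = _
∉-# (y ∷ ys) x∉ = (λ { refl → x∉ (here refl) }) , ∉-# ys (x∉ ∘ there)

opaque
  fresh# : ∀ {p} (xs : List ℕ) → length xs < p → ∃ λ x → x < p × x # xs
  fresh# xs len with fresh xs len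
  ... | x , x< , x∉ = x , x< , ∉-# xs x∉

five : ∀ {a b c d e x} → a < 5 → b < 5 → c < 5 → d < 5 → e < 5 → b # a ∷ [] → c # a ∷ b ∷ [] → d # a ∷ b ∷ c ∷ [] → e # a ∷ b ∷ c ∷ d ∷ [] →
       x < 5 → x ≡ a ⊎ x ≡ b ⊎ x ≡ c ⊎ x ≡ d ⊎ x ≡ e
five {a} {b} {c} {d} {e} a< b< c< d< e< (ba , _) (ca , cb , _) (da , db , dc , _) (ea , eb , ec , ed , _) x<
  with unique-exhausts {5} {e ∷ d ∷ c ∷ b ∷ a ∷ []}
         ((ed ∷ ec ∷ eb ∷ ea ∷ []) ∷ (dc ∷ db ∷ da ∷ []) ∷ (cb ∷ ca ∷ []) ∷ (ba ∷ []) ∷ [] ∷ [])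
         (e< ∷ d< ∷ c< ∷ b< ∷ a< ∷ []) refl x<
... | here z = inj₂ (inj₂ (inj₂ (inj₂ z)))
... | there (here z) = inj₂ (inj₂ (inj₂ (inj₁ z)))
... | there (there (here z)) = inj₂ (inj₂ (inj₁ z))
... | there (there (there (here z))) = inj₂ (inj₁ z)
... | there (there (there (there (here z)))) = inj₁ z

opaque
  one-missing : ∀ {n} {G : Gph {n}} {c u} → Ok 5 G c → DegLe G u 4 → ∃ λ x → x < 5 × Misses G c u x
  one-missing ok deg with some-missing ok deg (upTo 5) (upTo⁺ 5) (≤-reflexive refl)
  ... | x , x∈ , m = x , ∈-upTo⁻ x∈ , m

-- All extensions of one colouring are equivalent.

module Unique-class {n : ℕ} (G : Gph {n}) (q : Fin n) (deg : ∀ v → DegLe (G ⊖ q) v 4) where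
  open Vertex G q

  module _ {y₁ y₂ y₃ : Fin n} (en : Enum y₁ y₂ y₃) {φ : Col {n}} (ok : Ok 5 H φ) where

    private
      go : ∀ {a b c a′ b′ c′} s t → T3 en φ a b c → T3 en φ a′ b′ c′ → Rel s t a a′ → Rel s t b b′ → Rel s t c c′ →
           Kempe 5 G (S en φ a b c) (S en φ a′ b′ c′)
      go s t = extension-step en s t ok ok K-refl

    change₁ : ∀ {a b c a′} → T3 en φ a b c → T3 en φ a′ b c → Kempe 5 G (S en φ a b c) (S en φ a′ b c)
    change₁ {a} {a′ = a′} x y = go a a′ x y (inj₂ (inj₁ refl , inj₂ refl)) same same

    change₂ : ∀ {a b c b′} → T3 en φ a b c → T3 en φ a b′ c → Kempe 5 G (S en φ a b c) (S en φ a b′ c)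
    change₂ {b = b} {b′ = b′} x y = go b b′ x y same (inj₂ (inj₁ refl , inj₂ refl)) same

    change₃ : ∀ {a b c c′} → T3 en φ a b c → T3 en φ a b c′ → Kempe 5 G (S en φ a b c) (S en φ a b c′)
    change₃ {c = c} {c′ = c′} x y = go c c′ x y same same (inj₂ (inj₁ refl , inj₂ refl))

    exchange₁₂ : ∀ {a b c} → T3 en φ a b c → T3 en φ b a c → Kempe 5 G (S en φ a b c) (S en φ b a c)
    exchange₁₂ {a} {b} x y = go a b x y (inj₂ (inj₁ refl , inj₂ refl)) (inj₂ (inj₂ refl , inj₁ refl)) same

    -- Since `a` is unoccupied at `q`, `y₃` moves there first and thereby makes room for `y₂`.
    shift : ∀ {x a b c} → T3 en φ x b c → T3 en φ x c a → b ≢ a → Kempe 5 G (S en φ x b c) (S en φ x c a)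
    shift {x} {a} {b} {c} t t′ b≢a = change₃ t m ◅◅ change₂ m t′
      where
      m : T3 en φ x b a
      m = mkT (l₁ t) (l₂ t) (l₃ t′) (n₁₂ t) (n₁₃ t′) b≢a

    -- The edges move one after the other unless each wants the colour of the other, and then a
    -- single exchange does it.
    change₁₂ : ∀ {a b c a′ b′} → T3 en φ a b c → T3 en φ a′ b′ c → Kempe 5 G (S en φ a b c) (S en φ a′ b′ c)
    change₁₂ {a} {b} {c} {a′} {b′} t t′ with a′ ℕ.≟ b | b′ ℕ.≟ a
    ... | no z | _ = let m = mkT (l₁ t′) (l₂ t) (l₃ t) z (n₁₃ t′) (n₂₃ t) in change₁ t m ◅◅ change₂ m t′
    ... | yes _ | no z = let m = mkT (l₁ t) (l₂ t′) (l₃ t) (≢-sym z) (n₁₃ t) (n₂₃ t′) in change₂ t m ◅◅ change₁ m t′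
    ... | yes refl | yes refl = exchange₁₂ t t′

  -- The one case in which no single exchange of two colours helps is a cyclic rotation.
  module Rotation {y₁ y₂ y₃ : Fin n} (en : Enum y₁ y₂ y₃) {φ : Col {n}} (ok : Ok 5 H φ) {a b c : ℕ}
                  (σ : T3 en φ a b c) (τ : T3 en φ b c a) where

    Goal : Set
    Goal = Kempe 5 G (S en φ a b c) (S en φ b c a)

    -- The spare colour breaks the cycle: `y₁` parks at `x`, the other two move on, and `y₁` follows
    -- last.
    has-x : ∀ {x} → L φ y₁ x → x # a ∷ b ∷ c ∷ [] → Goal
    has-x {x} l (xa , xb , xc , _) = change₁ en ok σ m₁ ◅◅ shift en ok m₁ m₂ (n₁₃ τ) ◅◅ change₁ en ok m₂ τ
      where
      m₁ : T3 en φ x b c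
      m₁ = mkT l (l₂ σ) (l₃ σ) xb xc (n₂₃ σ)
      m₂ : T3 en φ x c a
      m₂ = mkT l (l₂ τ) (l₃ τ) xc xa (n₂₃ τ)

    via : ∀ {φ′ s t a₁ b₁ c₁ a₂ b₂ c₂} → Ok 5 H φ′ → K s t H φ φ′ → T3 en φ′ a₁ b₁ c₁ → T3 en φ′ a₂ b₂ c₂ →
          Rel s t a a₁ → Rel s t b b₁ → Rel s t c c₁ → Rel s t b a₂ → Rel s t c b₂ → Rel s t a c₂ →
          Kempe 5 G (S en φ′ a₁ b₁ c₁) (S en φ′ a₂ b₂ c₂) → Goal
    via {s = s} {t} ok′ k x y r₁ r₂ r₃ r₄ r₅ r₆ path =
      extension-step en s t ok ok′ k σ x r₁ r₂ r₃ ◅◅ path ◅◅ Kempe-sym (extension-step en s t ok ok′ k τ y r₄ r₅ r₆)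

    -- Recolouring `y₁z` with `m` makes `x` a spare colour at `y₁` and leaves the lists of `y₂`,
    -- `y₃` alone. The colour `m` leaves the list of `y₁`, so whichever of the two extensions used
    -- it there is carried to `x` by the same interchange.
    recolour : ∀ {x z m} → E H y₁ z → φ y₁ z ≡ x → x < 5 → x # a ∷ b ∷ c ∷ [] → z ≢ y₂ → z ≢ y₃ → m ≡ a ⊎ m ≡ b → Misses H φ z m → Goal
    recolour {x} {z} {m} e q x< (xa , xb , xc , _) z₂ z₃ mi mz = case mi of λ where
        (inj₁ refl) → via ok₁ k (mkT ly (keep (d₁₂ en) z₂ (l₂ σ)) (keep (d₁₃ en) z₃ (l₃ σ)) xb xc (n₂₃ σ))
                          (mkT (keep₁ (≢-sym (n₁₂ σ)) (l₁ τ)) (keep (d₁₂ en) z₂ (l₂ τ)) (keep (d₁₃ en) z₃ (l₃ τ)) (n₁₂ τ) (n₁₃ τ) (n₂₃ τ))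
                          (inj₂ (inj₂ refl , inj₁ refl)) same same same same same
                          (shift en ok₁ (mkT ly (keep (d₁₂ en) z₂ (l₂ σ)) (keep (d₁₃ en) z₃ (l₃ σ)) xb xc (n₂₃ σ))
                               (mkT ly (keep (d₁₂ en) z₂ (l₂ τ)) (keep (d₁₃ en) z₃ (l₃ τ)) xc xa (n₂₃ τ)) (n₁₃ τ)
                           ◅◅ change₁ en ok₁ (mkT ly (keep (d₁₂ en) z₂ (l₂ τ)) (keep (d₁₃ en) z₃ (l₃ τ)) xc xa (n₂₃ τ))
                                 (mkT (keep₁ (≢-sym (n₁₂ σ)) (l₁ τ)) (keep (d₁₂ en) z₂ (l₂ τ)) (keep (d₁₃ en) z₃ (l₃ τ)) (n₁₂ τ) (n₁₃ τ) (n₂₃ τ)))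
        (inj₂ refl) → via ok₁ k (mkT (keep₁ (n₁₂ σ) (l₁ σ)) (keep (d₁₂ en) z₂ (l₂ σ)) (keep (d₁₃ en) z₃ (l₃ σ)) (n₁₂ σ) (n₁₃ σ) (n₂₃ σ))
                          (mkT ly (keep (d₁₂ en) z₂ (l₂ τ)) (keep (d₁₃ en) z₃ (l₃ τ)) xc xa (n₂₃ τ))
                          same same same (inj₂ (inj₂ refl , inj₁ refl)) same same
                          (change₁ en ok₁ (mkT (keep₁ (n₁₂ σ) (l₁ σ)) (keep (d₁₂ en) z₂ (l₂ σ)) (keep (d₁₃ en) z₃ (l₃ σ)) (n₁₂ σ) (n₁₃ σ) (n₂₃ σ))
                                (mkT ly (keep (d₁₂ en) z₂ (l₂ σ)) (keep (d₁₃ en) z₃ (l₃ σ)) xb xc (n₂₃ σ))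
                           ◅◅ shift en ok₁ (mkT ly (keep (d₁₂ en) z₂ (l₂ σ)) (keep (d₁₃ en) z₃ (l₃ σ)) xb xc (n₂₃ σ))
                               (mkT ly (keep (d₁₂ en) z₂ (l₂ τ)) (keep (d₁₃ en) z₃ (l₃ τ)) xc xa (n₂₃ τ)) (n₁₃ τ))
      where
      lm : L φ y₁ m
      lm = case mi of λ { (inj₁ refl) → l₁ σ ; (inj₂ refl) → l₁ τ }
      φ₁ : Col {n}
      φ₁ = upd φ y₁ z m
      ok₁ : Ok 5 H φ₁
      ok₁ = recolour-ok ok e (proj₁ lm) (proj₂ lm) mz
      k : K x m H φ φ₁
      k = upd-K ok e (inj₁ q) (inj₂ refl)
      x≢m : x ≢ m
      x≢m refl = proj₂ lm (see z e q)
      ly : L φ₁ y₁ x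
      ly = x< , λ s → case sees-split s of λ where
        (inj₁ (_ , w)) → x≢m w
        (inj₂ (see w (mkE (f , r)) w′)) → r (subst (Pair y₁ z y₁) (sym (proper ok f e (trans w′ (sym q)))) fwd)
      keep : ∀ {y j} → y₁ ≢ y → z ≢ y → L φ y j → L φ₁ y j
      keep p p′ (j< , mj) = j< , λ s → case sees-split s of λ where
        (inj₁ (inj₁ w , _)) → p (sym w)
        (inj₁ (inj₂ w , _)) → p′ (sym w)
        (inj₂ s′) → mj (sees-sub s′)
      keep₁ : ∀ {j} → j ≢ m → L φ y₁ j → L φ₁ y₁ j
      keep₁ p (j< , mj) = j< , λ s → case sees-split s of λ where
        (inj₁ (_ , w)) → p w
        (inj₂ s′) → mj (sees-sub s′)

  module RotationCore {y₁ y₂ y₃ : Fin n} (en : Enum y₁ y₂ y₃) {φ : Col {n}} (ok : Ok 5 H φ) {a b c : ℕ}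
                      (σ : T3 en φ a b c) (τ : T3 en φ b c a) where
    open Rotation en ok σ τ

    -- If `z` sees both `a` and `b`, it misses `c` or `x′`, called `m`. An interchange along the
    -- (m,a)-chain from `z` makes it miss `a`, and `recolour` applies unless the chain ends at a
    -- neighbour of `q` and spoils a needed list. In that event the altered list itself joins the
    -- two extensions.
    core : ∀ {x x′ z} → E H y₁ z → φ y₁ z ≡ x → x < 5 → x # a ∷ b ∷ c ∷ [] → x′ < 5 → x′ # a ∷ b ∷ c ∷ x ∷ [] → z ≢ y₂ → z ≢ y₃ → Goal
    core {x} {x′} {z} e q x< x# x′< x′# z₂ z₃ with sees? H φ z a | sees? H φ z b
    ... | no mz | _ = recolour e q x< x# z₂ z₃ (inj₁ refl) mz
    ... | yes _ | no mz = recolour e q x< x# z₂ z₃ (inj₂ refl) mz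
    ... | yes sa | yes sb with one-missing ok (deg z)
    ... | m , m< , mz = pick (five (proj₁ (l₁ σ)) (proj₁ (l₂ σ)) (proj₁ (l₃ σ)) x< x′< (≢-sym (n₁₂ σ) , _) (≢-sym (n₁₃ σ) , ≢-sym (n₂₃ σ) , _) x# x′# m<)
      where
      m≢a : m ≢ a
      m≢a refl = mz sa
      m≢x : m ≢ x
      m≢x refl = mz (see y₁ (E-sym e) (trans (sym (symm ok e)) q))
      ch : Chain 5 H φ m a z
      ch = chain ok m< (proj₁ (l₁ σ)) m≢a mz
      φ₁ : Col {n}
      φ₁ = chCol ch
      ok₁ : Ok 5 H φ₁
      ok₁ = chOk ch
      k : K m a H φ φ₁
      k = chMove ch
      keep : ∀ {y j} → ¬ In m a j → L φ y j → L φ₁ y j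
      keep ¬i (j< , mj) = j< , K-misses k ¬i mj
      stay : ∀ {y j} → Same m a H φ φ₁ y → L φ y j → L φ₁ y j
      stay {y} {j} s (j< , mj) with in? m a j
      ... | yes i = j< , mj ∘ same⇐ s i
      ... | no ¬i = keep ¬i (j< , mj)
      out : ∀ {j} → j ≢ m → j ≢ a → ¬ In m a j
      out p _ (inj₁ r) = p r
      out _ p (inj₂ r) = p r
      base : T3 en φ₁ a b c → T3 en φ₁ b c a → Goal
      base t t′ = via ok₁ k t t′ same same same same same same
        (Rotation.recolour en ok₁ t t′ e (trans (sym (K-out k e (λ i → out (≢-sym m≢x) (proj₁ x#) (subst (In m a) q i)))) q) x< x# z₂ z₃ (inj₁ refl)
           (λ s → mz (b⇐a (chStart ch) s)))
      σt : L φ₁ y₁ a → L φ₁ y₂ b → L φ₁ y₃ c → T3 en φ₁ a b c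
      σt i j l = mkT i j l (n₁₂ σ) (n₁₃ σ) (n₂₃ σ)
      τt : L φ₁ y₁ b → L φ₁ y₂ c → L φ₁ y₃ a → T3 en φ₁ b c a
      τt i j l = mkT i j l (n₁₂ τ) (n₁₃ τ) (n₂₃ τ)
      status : ∀ y → y ≢ z → y ≡ chEnd ch ⊎ Same m a H φ φ₁ y
      status y p with chRest ch y
      ... | inj₁ r = ⊥-elim (p r)
      ... | inj₂ r = r
      y₁≢z : y₁ ≢ z
      y₁≢z = E-≢ e
      -- Besides `z` the chain has one end only, so a flip at `y₁` spares `y₂` and `y₃`.
      stay₁ : Same m a H φ φ₁ y₁ ⊎ (Flip m a H φ φ₁ y₁ × Same m a H φ φ₁ y₂ × Same m a H φ φ₁ y₃)
      stay₁ with status y₁ y₁≢z | chEach ch y₁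
      ... | inj₂ s | _ = inj₁ s
      ... | inj₁ _ | inj₁ s = inj₁ s
      ... | inj₁ r | inj₂ f = inj₂ (f , others (≢-sym z₂) (d₁₂ en) , others (≢-sym z₃) (d₁₃ en))
        where
        others : ∀ {y} → y ≢ z → y₁ ≢ y → Same m a H φ φ₁ y
        others {y} p p′ with status y p
        ... | inj₁ r′ = ⊥-elim (p′ (trans r (sym r′)))
        ... | inj₂ s = s
      pick : m ≡ a ⊎ m ≡ b ⊎ m ≡ c ⊎ m ≡ x ⊎ m ≡ x′ → Goal
      pick (inj₁ r) = ⊥-elim (m≢a r)
      pick (inj₂ (inj₁ refl)) = ⊥-elim (mz sb)
      pick (inj₂ (inj₂ (inj₂ (inj₁ r)))) = ⊥-elim (m≢x r)
      pick (inj₂ (inj₂ (inj₁ refl))) = done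
        where
        kb : ∀ {y} → L φ y b → L φ₁ y b
        kb = keep (out (n₂₃ σ) (≢-sym (n₁₂ σ)))
        both₃ : Misses H φ₁ y₃ c × Misses H φ₁ y₃ a
        both₃ = unseen-pair (chEach ch y₃) (proj₂ (l₃ σ)) (proj₂ (l₃ τ))
        c₃ : L φ₁ y₃ c
        c₃ = proj₁ (l₃ σ) , proj₁ both₃
        a₃ : L φ₁ y₃ a
        a₃ = proj₁ (l₃ τ) , proj₂ both₃
        done : Goal
        done with stay₁
        ... | inj₂ (f , s₂′ , _) = via ok₁ k t t′ (inj₂ (inj₂ refl , inj₁ refl)) same (inj₂ (inj₁ refl , inj₂ refl)) same same same (exchange₁₂ en ok₁ t t′)
          where
          t : T3 en φ₁ c b a
          t = mkT (proj₁ (l₃ σ) , proj₂ (l₁ σ) ∘ a⇐b f) (kb (l₂ σ)) a₃ (≢-sym (n₂₃ σ)) (≢-sym (n₁₃ σ)) (≢-sym (n₁₂ σ))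
          t′ : T3 en φ₁ b c a
          t′ = τt (kb (l₁ τ)) (stay s₂′ (l₂ τ)) a₃
        ... | inj₁ s₁′ with status y₂ (≢-sym z₂) | chEach ch y₂
        ...   | inj₂ s | _ = base (σt (stay s₁′ (l₁ σ)) (kb (l₂ σ)) c₃) (τt (kb (l₁ τ)) (stay s (l₂ τ)) a₃)
        ...   | inj₁ _ | inj₁ s = base (σt (stay s₁′ (l₁ σ)) (kb (l₂ σ)) c₃) (τt (kb (l₁ τ)) (stay s (l₂ τ)) a₃)
        ...   | inj₁ _ | inj₂ f = via ok₁ k t t′ same same same same (inj₂ (inj₁ refl , inj₂ refl)) (inj₂ (inj₂ refl , inj₁ refl)) (exchange₁₂ en ok₁ t t′)
          where
          t : T3 en φ₁ a b c
          t = σt (stay s₁′ (l₁ σ)) (kb (l₂ σ)) c₃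
          t′ : T3 en φ₁ b a c
          t′ = mkT (kb (l₁ τ)) (proj₁ (l₁ σ) , proj₂ (l₂ τ) ∘ b⇐a f) c₃ (≢-sym (n₁₂ σ)) (n₂₃ σ) (n₁₃ σ)
      pick (inj₂ (inj₂ (inj₂ (inj₂ refl)))) = done
        where
        kb : ∀ {y} → L φ y b → L φ₁ y b
        kb = keep (out (≢-sym (proj₁ (proj₂ x′#))) (≢-sym (n₁₂ σ)))
        kc : ∀ {y} → L φ y c → L φ₁ y c
        kc = keep (out (≢-sym (proj₁ (proj₂ (proj₂ x′#)))) (≢-sym (n₁₃ σ)))
        done : Goal
        done with stay₁
        ... | inj₂ (f , _ , s₃′) = via ok₁ k t t′ (inj₂ (inj₂ refl , inj₁ refl)) same same same same same
                                     (shift en ok₁ t m′ (n₁₃ τ) ◅◅ change₁ en ok₁ m′ t′)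
          where
          t : T3 en φ₁ x′ b c
          t = mkT (x′< , proj₂ (l₁ σ) ∘ a⇐b f) (kb (l₂ σ)) (kc (l₃ σ)) (proj₁ (proj₂ x′#)) (proj₁ (proj₂ (proj₂ x′#))) (n₂₃ σ)
          t′ : T3 en φ₁ b c a
          t′ = τt (kb (l₁ τ)) (kc (l₂ τ)) (stay s₃′ (l₃ τ))
          m′ : T3 en φ₁ x′ c a
          m′ = mkT (l₁ t) (l₂ t′) (l₃ t′) (n₁₃ t) (proj₁ x′#) (n₂₃ t′)
        ... | inj₁ s₁′ with status y₃ (≢-sym z₃) | chEach ch y₃
        ...   | inj₂ s | _ = base (σt (stay s₁′ (l₁ σ)) (kb (l₂ σ)) (kc (l₃ σ))) (τt (kb (l₁ τ)) (kc (l₂ τ)) (stay s (l₃ τ)))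
        ...   | inj₁ _ | inj₁ s = base (σt (stay s₁′ (l₁ σ)) (kb (l₂ σ)) (kc (l₃ σ))) (τt (kb (l₁ τ)) (kc (l₂ τ)) (stay s (l₃ τ)))
        ...   | inj₁ _ | inj₂ f = via ok₁ k t t′ same same same same same (inj₂ (inj₂ refl , inj₁ refl)) (change₃ en ok₁ t m₁ ◅◅ change₂ en ok₁ m₁ m₂ ◅◅ change₁ en ok₁ m₂ t′)
          where
          lx : L φ₁ y₃ x′
          lx = x′< , proj₂ (l₃ τ) ∘ a⇐b f
          t : T3 en φ₁ a b c
          t = σt (stay s₁′ (l₁ σ)) (kb (l₂ σ)) (kc (l₃ σ))
          t′ : T3 en φ₁ b c x′
          t′ = mkT (kb (l₁ τ)) (kc (l₂ τ)) lx (n₂₃ σ) (≢-sym (proj₁ (proj₂ x′#))) (≢-sym (proj₁ (proj₂ (proj₂ x′#))))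
          m₁ : T3 en φ₁ a b x′
          m₁ = mkT (l₁ t) (l₂ t) lx (n₁₂ σ) (≢-sym (proj₁ x′#)) (≢-sym (proj₁ (proj₂ x′#)))
          m₂ : T3 en φ₁ a c x′
          m₂ = mkT (l₁ t) (l₂ t′) lx (n₁₃ σ) (≢-sym (proj₁ x′#)) (≢-sym (proj₁ (proj₂ (proj₂ x′#))))

  module _ {y₁ y₂ y₃ : Fin n} (en : Enum y₁ y₂ y₃) {φ : Col {n}} (ok : Ok 5 H φ) where

    unrotate : ∀ {a b c} → T3 en φ a b c → T3 en φ b c a → Kempe 5 G (S (rot en) φ b c a) (S (rot en) φ c a b) →
               Kempe 5 G (S en φ a b c) (S en φ b c a)
    unrotate σ τ g = S-rot en ok σ ◅◅ g ◅◅ Kempe-sym (S-rot en ok τ)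

    rotation : ∀ {a b c} → T3 en φ a b c → T3 en φ b c a → Kempe 5 G (S en φ a b c) (S en φ b c a)
    rotation {a} {b} {c} σ τ with fresh# {5} (a ∷ b ∷ c ∷ []) (s≤s (s≤s (s≤s (s≤s z≤n))))
    ... | x , x< , x# with fresh# {5} (a ∷ b ∷ c ∷ x ∷ []) ≤-refl
    ... | x′ , x′< , x′# = main
      where
      σ₂ : T3 (rot en) φ b c a
      σ₂ = T3-rot en σ
      τ₂ : T3 (rot en) φ c a b
      τ₂ = T3-rot en τ
      σ₃ : T3 (rot (rot en)) φ c a b
      σ₃ = T3-rot (rot en) σ₂
      τ₃ : T3 (rot (rot en)) φ a b c
      τ₃ = T3-rot (rot en) τ₂
      x#₂ : x # b ∷ c ∷ a ∷ []
      x#₂ = let (p , q , r , _) = x# in q , r , p , _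
      x#₃ : x # c ∷ a ∷ b ∷ []
      x#₃ = let (p , q , r , _) = x# in r , p , q , _
      x′#₂ : x′ # b ∷ c ∷ a ∷ x ∷ []
      x′#₂ = let (p , q , r , s) = x′# in q , r , p , s
      x′#₃ : x′ # c ∷ a ∷ b ∷ x ∷ []
      x′#₃ = let (p , q , r , s) = x′# in r , p , q , s
      by₂ : Kempe 5 G (S (rot en) φ b c a) (S (rot en) φ c a b) → Kempe 5 G (S en φ a b c) (S en φ b c a)
      by₂ = unrotate σ τ
      by₃ : Kempe 5 G (S (rot (rot en)) φ c a b) (S (rot (rot en)) φ a b c) → Kempe 5 G (S en φ a b c) (S en φ b c a)
      by₃ g = by₂ (S-rot (rot en) ok σ₂ ◅◅ g ◅◅ Kempe-sym (S-rot (rot en) ok τ₂))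
      sym-x : ∀ {u v} → E H u v → φ u v ≡ x → φ v u ≡ x
      sym-x e q = trans (sym (symm ok e)) q
      uniq : ∀ {u v w} → E H u v → φ u v ≡ x → E H u w → φ u w ≡ x → v ≡ w
      uniq e q f r = proper ok e f (trans q (sym r))
      main : Kempe 5 G (S en φ a b c) (S en φ b c a)
      main with sees? H φ y₁ x
      ... | no m = Rotation.has-x en ok σ τ (x< , m) x#
      ... | yes (see z e q) with z Fin.≟ y₂ | z Fin.≟ y₃
      ...   | no z₂ | no z₃ = RotationCore.core en ok σ τ e q x< x# x′< x′# z₂ z₃
      -- If `x` joins `y₁` to another neighbour of `q`, then the `x`-edge of the remaining
      -- neighbour, if present, avoids both, and the argument starts there instead.
      ...   | yes refl | _ = case sees? H φ y₃ x of λ where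
        (no m) → by₃ (Rotation.has-x (rot (rot en)) ok σ₃ τ₃ (x< , m) x#₃)
        (yes (see w f r)) → by₃ (RotationCore.core (rot (rot en)) ok σ₃ τ₃ f r x< x#₃ x′< x′#₃
            (λ { refl → d₂₃ en (uniq e q (E-sym f) (sym-x f r)) })
            (λ { refl → d₁₃ en (uniq (E-sym e) (sym-x e q) (E-sym f) (sym-x f r)) }))
      ...   | no _ | yes refl = case sees? H φ y₂ x of λ where
        (no m) → by₂ (Rotation.has-x (rot en) ok σ₂ τ₂ (x< , m) x#₂)
        (yes (see w f r)) → by₂ (RotationCore.core (rot en) ok σ₂ τ₂ f r x< x#₂ x′< x′#₂
            (λ { refl → d₁₂ en (uniq (E-sym e) (sym-x e q) (E-sym f) (sym-x f r)) })
            (λ { refl → d₂₃ en (sym (uniq e q (E-sym f) (sym-x f r))) }))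

    change₁₃ : ∀ {a b c a′ c′} → T3 en φ a b c → T3 en φ a′ b c′ → Kempe 5 G (S en φ a b c) (S en φ a′ b c′)
    change₁₃ m m′ = S-rot en ok m ◅◅ S-rot (rot en) ok (T3-rot en m)
      ◅◅ change₁₂ (rot (rot en)) ok (T3-rot (rot en) (T3-rot en m)) (T3-rot (rot en) (T3-rot en m′))
      ◅◅ Kempe-sym (S-rot (rot en) ok (T3-rot en m′)) ◅◅ Kempe-sym (S-rot en ok m′)

    -- As soon as one edge can take its target colour at once, a change at the other two remains.
    -- Otherwise every target is occupied, which leaves exchanges and the two cyclic rotations.
    unique-T3 : ∀ {a b c a′ b′ c′} → T3 en φ a b c → T3 en φ a′ b′ c′ → Kempe 5 G (S en φ a b c) (S en φ a′ b′ c′)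
    unique-T3 {a} {b} {c} {a′} {b′} {c′} t t′ with (a′ ℕ.≟ b) | (a′ ℕ.≟ c)
    ... | no p | no q = let m = mkT (l₁ t′) (l₂ t) (l₃ t) p q (n₂₃ t) in
          change₁ en ok t m ◅◅ S-rot en ok m ◅◅ change₁₂ (rot en) ok (T3-rot en m) (T3-rot en t′) ◅◅ Kempe-sym (S-rot en ok t′)
    ... | yes refl | _ = from-b (c′ ℕ.≟ a) (b′ ℕ.≟ c)
      where
      from-b : Dec (c′ ≡ a) → Dec (b′ ≡ c) → Kempe 5 G (S en φ a b c) (S en φ b b′ c′)
      from-b (yes refl) (yes refl) = rotation t t′
      from-b (no p) _ = let m = mkT (l₁ t) (l₂ t) (l₃ t′) (n₁₂ t) (≢-sym p) (n₁₃ t′) in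
          change₃ en ok t m ◅◅ change₁₂ en ok m t′
      from-b (yes refl) (no p) with b′ ℕ.≟ a
      ... | yes refl = ⊥-elim (n₂₃ t′ refl)
      ... | no p′ = let m = mkT (l₁ t) (l₂ t′) (l₃ t) (≢-sym p′) (n₁₃ t) p in
          change₂ en ok t m ◅◅ change₁₃ m t′
    ... | no _ | yes refl = from-c (b′ ℕ.≟ a) (c′ ℕ.≟ b)
      where
      from-c : Dec (b′ ≡ a) → Dec (c′ ≡ b) → Kempe 5 G (S en φ a b c) (S en φ c b′ c′)
      from-c (yes refl) (yes refl) = Kempe-sym (rotation t′ t)
      from-c (no p) _ = let m = mkT (l₁ t) (l₂ t′) (l₃ t) (≢-sym p) (n₁₃ t) (≢-sym (n₁₂ t′)) in
          change₂ en ok t m ◅◅ change₁₃ m t′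
      from-c (yes refl) (no p) with c′ ℕ.≟ a
      ... | yes refl = ⊥-elim (n₂₃ t′ refl)
      ... | no p′ = let m = mkT (l₁ t) (l₂ t) (l₃ t′) (n₁₂ t) (≢-sym p′) (≢-sym p) in
          change₃ en ok t m ◅◅ change₁₂ en ok m t′

    unique : ∀ {σ τ} → SDR φ σ → SDR φ τ → Kempe 5 G (X φ σ) (X φ τ)
    unique s t = S-σ en ok s ◅◅ unique-T3 (sdr-T3 en s) (sdr-T3 en t) ◅◅ Kempe-sym (S-σ en ok t)

-- Lifting an interchange between two extendable colourings.

record Two (a b s t u : ℕ) : Set where
  constructor mkTwo
  field
    two₁ : In a b s
    two₂ : In a b t
    two₃ : ¬ In a b u

-- At most one representative is affected by the interchange, so it can follow without colliding
-- with another.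
Few : (a b s t u : ℕ) → Set
Few a b s t u = (¬ In a b s × ¬ In a b t) ⊎ (¬ In a b t × ¬ In a b u) ⊎ (¬ In a b u × ¬ In a b s)

in-third : ∀ {a b s t x} → In a b s → In a b t → s ≢ t → In a b x → x ≡ s ⊎ x ≡ t
in-third (inj₁ refl) (inj₁ refl) n _ = ⊥-elim (n refl)
in-third (inj₁ refl) (inj₂ refl) n i = i
in-third (inj₂ refl) (inj₁ refl) n i = Sum.swap i
in-third (inj₂ refl) (inj₂ refl) n _ = ⊥-elim (n refl)

few-or-two : ∀ a b s t u → s ≢ t → s ≢ u → t ≢ u → Few a b s t u ⊎ Two a b s t u ⊎ Two a b t u s ⊎ Two a b u s t
few-or-two a b s t u st su tu with in? a b s | in? a b t | in? a b u
... | yes i | yes j | yes k = case in-third i j st k of λ { (inj₁ z) → ⊥-elim (su (sym z)) ; (inj₂ z) → ⊥-elim (tu (sym z)) }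
... | yes i | yes j | no k = inj₂ (inj₁ (mkTwo i j k))
... | yes i | no j | yes k = inj₂ (inj₂ (inj₂ (mkTwo k i j)))
... | no i | yes j | yes k = inj₂ (inj₂ (inj₁ (mkTwo j k i)))
... | yes i | no j | no k = inj₁ (inj₂ (inj₁ (j , k)))
... | no i | yes j | no k = inj₁ (inj₂ (inj₂ (k , i)))
... | no i | no j | _ = inj₁ (inj₁ (i , j))

module _ {n : ℕ} where

  both-seen : ∀ {p q a b} {G : Gph {n}} {c d : Col} {u} → Ok p G c → Ok q G d → a ≢ b → K a b G c d →
              Sees G c u a → Sees G c u b → Sees G d u a × Sees G d u b
  both-seen {a = a} {b} {c = c} {u = u} ok ok′ a≢b k (see v e q) (see w f r) with K-in k e (inj₁ q) | K-in k f (inj₂ r)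
  ... | inj₁ x | inj₂ y = see v e x , see w f y
  ... | inj₂ x | inj₁ y = see w f y , see v e x
  ... | inj₁ x | inj₁ y = ⊥-elim (a≢b (trans (sym q) (trans (cong (c u) (proper ok′ e f (trans x (sym y)))) r)))
  ... | inj₂ x | inj₂ y = ⊥-elim (a≢b (trans (sym q) (trans (cong (c u) (proper ok′ e f (trans x (sym y)))) r)))

  one-seen : ∀ {a b x} {G : Gph {n}} {c d : Col} {u} → K a b G c d → In a b x → Sees G c u x → Sees G d u a ⊎ Sees G d u b
  one-seen {a} {b} k i (see v e q) = Sum.map (see v e) (see v e) (K-in k e (subst (In a b) (sym q) i))

  opaque
    -- The number of the two colours that a vertex sees is invariant; if it is one, that colour
    -- either stays or turns into the other.
    K-status : ∀ {p q a b} {G : Gph {n}} {c d : Col} → Ok p G c → Ok q G d → K a b G c d → ∀ u → Same a b G c d u ⊎ Flip a b G c d u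
    K-status {a = a} {b} {G} {c} {d} ok ok′ k u with a ℕ.≟ b
    ... | yes refl = inj₁ (mkSame (λ { (inj₁ refl) s → [ id , id ]′ (one-seen k (inj₁ refl) s) ; (inj₂ refl) s → [ id , id ]′ (one-seen k (inj₁ refl) s) })
                                  (λ { (inj₁ refl) s → [ id , id ]′ (one-seen (K-sym k) (inj₁ refl) s) ; (inj₂ refl) s → [ id , id ]′ (one-seen (K-sym k) (inj₁ refl) s) }))
    ... | no a≢b with sees? G c u a | sees? G c u b | sees? G d u a | sees? G d u b
    ...   | yes s | yes t | _ | _ = inj₁ (mkSame (λ { (inj₁ refl) _ → proj₁ x ; (inj₂ refl) _ → proj₂ x }) (λ { (inj₁ refl) _ → s ; (inj₂ refl) _ → t }))
      where
          x : Sees G d u a × Sees G d u b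
          x = both-seen ok ok′ a≢b k s t
    ...   | _ | _ | yes s | yes t = inj₁ (mkSame (λ { (inj₁ refl) _ → s ; (inj₂ refl) _ → t }) (λ { (inj₁ refl) _ → proj₁ x ; (inj₂ refl) _ → proj₂ x }))
      where
          x : Sees G c u a × Sees G c u b
          x = both-seen ok′ ok a≢b (K-sym k) s t
    ...   | yes s | no t | yes s′ | no t′ = inj₁ (mkSame (λ { (inj₁ refl) _ → s′ ; (inj₂ refl) z → ⊥-elim (t z) }) (λ { (inj₁ refl) _ → s ; (inj₂ refl) z → ⊥-elim (t′ z) }))
    ...   | no s | yes t | no s′ | yes t′ = inj₁ (mkSame (λ { (inj₁ refl) z → ⊥-elim (s z) ; (inj₂ refl) _ → t′ }) (λ { (inj₁ refl) z → ⊥-elim (s′ z) ; (inj₂ refl) _ → t }))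
    ...   | yes s | no t | no s′ | yes t′ = inj₂ (mkFlip (λ _ → t′) (⊥-elim ∘ t) (⊥-elim ∘ s′) (λ _ → s))
    ...   | no s | yes t | yes s′ | no t′ = inj₂ (mkFlip (⊥-elim ∘ s) (λ _ → s′) (λ _ → t) (⊥-elim ∘ t′))
    ...   | yes s | no t | no s′ | no t′ = ⊥-elim ([ s′ , t′ ]′ (one-seen k (inj₁ refl) s))
    ...   | no s | yes t | no s′ | no t′ = ⊥-elim ([ s′ , t′ ]′ (one-seen k (inj₂ refl) t))
    ...   | no s | no t | yes s′ | no t′ = ⊥-elim ([ s , t ]′ (one-seen (K-sym k) (inj₁ refl) s′))
    ...   | no s | no t | no s′ | yes t′ = ⊥-elim ([ s , t ]′ (one-seen (K-sym k) (inj₂ refl) t′))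
    ...   | no s | no t | no s′ | no t′ = inj₁ (mkSame (λ { (inj₁ refl) z → ⊥-elim (s z) ; (inj₂ refl) z → ⊥-elim (t z) })
                                                       (λ { (inj₁ refl) z → ⊥-elim (s′ z) ; (inj₂ refl) z → ⊥-elim (t′ z) }))

opaque
  two-missing : ∀ {n} {J : Gph {n}} {φ α y} → Ok 5 J φ → DegLe J y 3 → α < 5 → ∃ λ o → o ≢ α × o < 5 × Misses J φ y o
  two-missing {α = α} ok dg α< with fresh# {5} (α ∷ []) (s≤s (s≤s z≤n))
  ... | x , x< , xα , _ with fresh# {5} (α ∷ x ∷ []) (s≤s (s≤s (s≤s z≤n)))
  ... | x₂ , x₂< , x₂α , x₂x , _ with fresh# {5} (α ∷ x ∷ x₂ ∷ []) (s≤s (s≤s (s≤s (s≤s z≤n))))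
  ... | x₃ , x₃< , x₃α , x₃x , x₃x₂ , _ with fresh# {5} (α ∷ x ∷ x₂ ∷ x₃ ∷ []) ≤-refl
  ... | x₄ , x₄< , x₄α , x₄x , x₄x₂ , x₄x₃ , _
    with some-missing ok dg (x₄ ∷ x₃ ∷ x₂ ∷ x ∷ []) ((x₄x₃ ∷ x₄x₂ ∷ x₄x ∷ []) ∷ (x₃x₂ ∷ x₃x ∷ []) ∷ (x₂x ∷ []) ∷ [] ∷ []) ≤-refl
  ... | o , here refl , m = o , x₄α , x₄< , m
  ... | o , there (here refl) , m = o , x₃α , x₃< , m
  ... | o , there (there (here refl)) , m = o , x₂α , x₂< , m
  ... | o , there (there (there (here refl))) , m = o , xα , x< , m

module Extension {n : ℕ} (G : Gph {n}) (q : Fin n) (deg : ∀ v → DegLe (G ⊖ q) v 4)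
                 (degq : ∀ {y} → E G q y → DegLe (G ⊖ q) y 3) where
  open Vertex G q public
  open Unique-class G q deg public

  transfer : ∀ {φ φ′ a b x y} → K a b H φ φ′ → ¬ In a b x → L φ y x → L φ′ y x
  transfer k ¬i (x< , m) = x< , K-misses k ¬i m

  opaque
    transfer-in : ∀ {φ φ′ a b x y} → a < 5 → b < 5 → Ok 5 H φ → Ok 5 H φ′ → K a b H φ φ′ → In a b x → L φ y x → ∃ λ x′ → In a b x′ × L φ′ y x′
    transfer-in {y = y} a< b< ok ok′ k i (x< , m) with K-status ok ok′ k y | i
    ... | inj₁ s | _ = _ , i , x< , m ∘ same⇐ s i
    ... | inj₂ f | inj₁ refl = _ , inj₂ refl , b< , m ∘ b⇐a f
    ... | inj₂ f | inj₂ refl = _ , inj₁ refl , a< , m ∘ a⇐b f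

  another : ∀ {φ α y} → Ok 5 H φ → E G q y → α < 5 → ∃ λ o → o ≢ α × L φ y o
  another ok e α< = two-missing ok (degq e) α<

  module _ {y₁ y₂ y₃ : Fin n} (en : Enum y₁ y₂ y₃) {φ φ′ : Col {n}} {a b : ℕ} (a< : a < 5) (b< : b < 5)
           (ok : Ok 5 H φ) (ok′ : Ok 5 H φ′) (k : K a b H φ φ′) where

    few-lift : ∀ {s t u} → T3 en φ s t u → Few a b s t u → ∃ λ s′ → ∃ λ t′ → ∃ λ u′ → T3 en φ′ s′ t′ u′ × Rel a b s s′ × Rel a b t t′ × Rel a b u u′
    few-lift {s} {t} {u} σ few = aux few
      where
      tr : ∀ {x y} → L φ y x → ∃ λ x′ → L φ′ y x′ × Rel a b x x′ × (∀ {o} → ¬ In a b o → x ≢ o → x′ ≢ o)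
      tr {x} l with in? a b x
      ... | yes i = let x′ , i′ , l′ = transfer-in a< b< ok ok′ k i l in x′ , l′ , inj₂ (i , i′) , λ ¬i _ z → ¬i (subst (In a b) z i′)
      ... | no ¬i = x , transfer k ¬i l , same , λ _ z → z
      aux : Few a b s t u → ∃ λ s′ → ∃ λ t′ → ∃ λ u′ → T3 en φ′ s′ t′ u′ × Rel a b s s′ × Rel a b t t′ × Rel a b u u′
      aux (inj₁ (i , j)) = let u′ , l , r , ne = tr (l₃ σ) in
        s , t , u′ , mkT (transfer k i (l₁ σ)) (transfer k j (l₂ σ)) l (n₁₂ σ) (≢-sym (ne i (≢-sym (n₁₃ σ)))) (≢-sym (ne j (≢-sym (n₂₃ σ)))) , same , same , r
      aux (inj₂ (inj₁ (i , j))) = let s′ , l , r , ne = tr (l₁ σ) in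
        s′ , t , u , mkT l (transfer k i (l₂ σ)) (transfer k j (l₃ σ)) (ne i (n₁₂ σ)) (ne j (n₁₃ σ)) (n₂₃ σ) , r , same , same
      aux (inj₂ (inj₂ (i , j))) = let t′ , l , r , ne = tr (l₂ σ) in
        s , t′ , u , mkT (transfer k j (l₁ σ)) l (transfer k i (l₃ σ)) (≢-sym (ne j (≢-sym (n₁₂ σ)))) (n₁₃ σ) (ne i (n₂₃ σ)) , same , r , same

    link : ∀ {s t u s′ t′ u′ s₁ t₁ u₁ s₁′ t₁′ u₁′} → T3 en φ s t u → T3 en φ′ s′ t′ u′ → T3 en φ s₁ t₁ u₁ → T3 en φ′ s₁′ t₁′ u₁′ →
           Rel a b s₁ s₁′ → Rel a b t₁ t₁′ → Rel a b u₁ u₁′ → Kempe 5 G (S en φ s t u) (S en φ′ s′ t′ u′)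
    link σ τ σ₁ τ₁ r₁ r₂ r₃ = unique-T3 en ok σ σ₁ ◅◅ extension-step en a b ok ok′ k σ₁ τ₁ r₁ r₂ r₃ ◅◅ unique-T3 en ok′ τ₁ τ

    link-few : ∀ {s t u s′ t′ u′} → T3 en φ s t u → T3 en φ′ s′ t′ u′ → Few a b s t u → Kempe 5 G (S en φ s t u) (S en φ′ s′ t′ u′)
    link-few σ τ few = let _ , _ , _ , τ₁ , r₁ , r₂ , r₃ = few-lift σ few in link σ τ σ τ₁ r₁ r₂ r₃

    -- Equal affected positions allow a direct step, because the third colour survives the
    -- interchange. If only `y₁` is common, other representatives with matching positions are built
    -- on one side; the extensions of a single colouring being equivalent, any matching pair will
    -- do.
    link-two : ∀ {s t u s′ t′ u′} → T3 en φ s t u → T3 en φ′ s′ t′ u′ → Two a b s t u → Two a b s′ t′ u′ ⊎ Two a b u′ s′ t′ →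
               Kempe 5 G (S en φ s t u) (S en φ′ s′ t′ u′)
    link-two σ τ (mkTwo i j h) (inj₁ (mkTwo i′ j′ h′)) =
      link σ τ σ (mkT (l₁ τ) (l₂ τ) (transfer k h (l₃ σ)) (n₁₂ τ) (λ { refl → h i′ }) (λ { refl → h j′ })) (inj₂ (i , i′)) (inj₂ (j , j′)) same
    link-two {s} {t} {u} {s′} {t′} {u′} σ τ (mkTwo i j h) (inj₂ (mkTwo j′ i′ h′)) =
      go (transfer-in a< b< ok′ ok (K-sym k) j′ (l₃ τ)) (transfer-in a< b< ok ok′ k j (l₂ σ))
      where
      Goal : Set
      Goal = Kempe 5 G (S en φ s t u) (S en φ′ s′ t′ u′)
      lt′ : L φ y₂ t′
      lt′ = transfer (K-sym k) h′ (l₂ τ)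
      both : In a b s → L φ y₃ s → In a b s′ → L φ′ y₂ s′ → Goal
      both ix lx ix′ lx′ = decide (sees? H φ y₁ t)
        where
        -- The second colour `o` in the list of `y₁` now lies outside {a,b}, so there are extensions
        -- on both sides in which only `y₂` and `y₃` are affected.
        stuck : Sees H φ y₁ t → (∃ λ o → o ≢ s × L φ y₁ o) → Goal
        stuck st (o , o≢s , lo) = link σ τ (mkT lo (l₂ σ) lx (λ { refl → proj₂ lo st }) o≢s (≢-sym (n₁₂ σ)))
              (mkT (transfer k o∉ lo) lx′ (l₃ τ) (λ { refl → o∉ ix′ }) (λ { refl → o∉ j′ }) (n₁₃ τ)) same (inj₂ (j , ix′)) (inj₂ (ix , j′))
          where
          o∉ : ¬ In a b o
          o∉ io with in-third i j (n₁₂ σ) io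
          ... | inj₁ z = o≢s z
          ... | inj₂ refl = proj₂ lo st
        decide : Dec (Sees H φ y₁ t) → Goal
        decide (no mt) = link σ τ (mkT (proj₁ (l₂ σ) , mt) lt′ lx (λ { refl → h′ j }) (≢-sym (n₁₂ σ)) (λ { refl → h′ ix })) τ (inj₂ (j , i′)) same (inj₂ (ix , j′))
        decide (yes st) = stuck st (another ok (e₁ en) (proj₁ (l₁ σ)))
      go : (∃ λ x → In a b x × L φ y₃ x) → (∃ λ x′ → In a b x′ × L φ′ y₂ x′) → Goal
      go (x , ix , lx) (x′ , ix′ , lx′) = decide (x ℕ.≟ s) (x′ ℕ.≟ s′)
        where
        decide : Dec (x ≡ s) → Dec (x′ ≡ s′) → Goal
        decide (no x≢) _ = link σ τ (mkT (l₁ σ) lt′ lx (λ { refl → h′ i }) (≢-sym x≢) (λ { refl → h′ ix })) τ (inj₂ (i , i′)) same (inj₂ (ix , j′))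
        decide (yes _) (no x≢) = link σ τ σ (mkT (l₁ τ) lx′ (transfer k h (l₃ σ)) (≢-sym x≢) (λ { refl → h i′ }) (λ { refl → h ix′ })) (inj₂ (i , i′)) (inj₂ (j , ix′)) same
        decide (yes refl) (yes refl) = both ix lx ix′ lx′

  unrot : ∀ {y₁ y₂ y₃} (en : Enum y₁ y₂ y₃) {φ φ′ s t u s′ t′ u′} → Ok 5 H φ → Ok 5 H φ′ → T3 en φ s t u → T3 en φ′ s′ t′ u′ →
          Kempe 5 G (S (rot en) φ t u s) (S (rot en) φ′ t′ u′ s′) → Kempe 5 G (S en φ s t u) (S en φ′ s′ t′ u′)
  unrot en ok ok′ σ τ g = S-rot en ok σ ◅◅ g ◅◅ Kempe-sym (S-rot en ok′ τ)

  -- Two pairs among three neighbours intersect, so rotation and reversal bring every remaining case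
  -- to the two patterns of `link-two`.
  link-ext : ∀ {y₁ y₂ y₃} (en : Enum y₁ y₂ y₃) {φ φ′ a b s t u s′ t′ u′} → a < 5 → b < 5 → Ok 5 H φ → Ok 5 H φ′ → K a b H φ φ′ →
             T3 en φ s t u → T3 en φ′ s′ t′ u′ → Kempe 5 G (S en φ s t u) (S en φ′ s′ t′ u′)
  link-ext en {φ} {φ′} {a} {b} {s} {t} {u} {s′} {t′} {u′} a< b< ok ok′ k σ τ
    = decide (few-or-two a b s t u (n₁₂ σ) (n₁₃ σ) (n₂₃ σ)) (few-or-two a b s′ t′ u′ (n₁₂ τ) (n₁₃ τ) (n₂₃ τ))
    where
    decide : Few a b s t u ⊎ Two a b s t u ⊎ Two a b t u s ⊎ Two a b u s t → Few a b s′ t′ u′ ⊎ Two a b s′ t′ u′ ⊎ Two a b t′ u′ s′ ⊎ Two a b u′ s′ t′ → Kempe 5 G (S en φ s t u) (S en φ′ s′ t′ u′)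
    decide (inj₁ f) _ = link-few en a< b< ok ok′ k σ τ f
    decide (inj₂ _) (inj₁ f) = Kempe-sym (link-few en a< b< ok′ ok (K-sym k) τ σ f)
    decide (inj₂ (inj₁ x)) (inj₂ (inj₁ y)) = link-two en a< b< ok ok′ k σ τ x (inj₁ y)
    decide (inj₂ (inj₁ x)) (inj₂ (inj₂ (inj₂ y))) = link-two en a< b< ok ok′ k σ τ x (inj₂ y)
    decide (inj₂ (inj₂ (inj₂ x))) (inj₂ (inj₁ y)) = Kempe-sym (link-two en a< b< ok′ ok (K-sym k) τ σ y (inj₂ x))
    decide (inj₂ (inj₂ (inj₁ x))) (inj₂ (inj₂ (inj₁ y))) = unrot en ok ok′ σ τ (link-two (rot en) a< b< ok ok′ k (T3-rot en σ) (T3-rot en τ) x (inj₁ y))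
    decide (inj₂ (inj₂ (inj₁ x))) (inj₂ (inj₁ y)) = unrot en ok ok′ σ τ (link-two (rot en) a< b< ok ok′ k (T3-rot en σ) (T3-rot en τ) x (inj₂ y))
    decide (inj₂ (inj₁ x)) (inj₂ (inj₂ (inj₁ y))) = Kempe-sym (unrot en ok′ ok τ σ (link-two (rot en) a< b< ok′ ok (K-sym k) (T3-rot en τ) (T3-rot en σ) y (inj₂ x)))
    decide (inj₂ (inj₂ (inj₂ x))) (inj₂ (inj₂ y)) = unrot en ok ok′ σ τ (unrot (rot en) ok ok′ (T3-rot en σ) (T3-rot en τ)
            (link-two (rot (rot en)) a< b< ok ok′ k (T3-rot (rot en) (T3-rot en σ)) (T3-rot (rot en) (T3-rot en τ)) x (Sum.swap y)))
    decide (inj₂ (inj₂ (inj₁ x))) (inj₂ (inj₂ (inj₂ y))) = Kempe-sym (unrot en ok′ ok τ σ (unrot (rot en) ok′ ok (T3-rot en τ) (T3-rot en σ)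
            (link-two (rot (rot en)) a< b< ok′ ok (K-sym k) (T3-rot (rot en) (T3-rot en τ)) (T3-rot (rot en) (T3-rot en σ)) y (inj₂ x))))

  link-sdr : ∀ {y₁ y₂ y₃} (en : Enum y₁ y₂ y₃) {φ φ′ a b σ τ} → a < 5 → b < 5 → Ok 5 H φ → Ok 5 H φ′ → K a b H φ φ′ →
             SDR φ σ → SDR φ′ τ → Kempe 5 G (X φ σ) (X φ′ τ)
  link-sdr en a< b< ok ok′ k σ τ = S-σ en ok σ ◅◅ link-ext en a< b< ok ok′ k (sdr-T3 en σ) (sdr-T3 en τ) ◅◅ Kempe-sym (S-σ en ok′ τ)

-- `Step` admits arbitrary numbers as interchanged colours, but one that is not below `p` occurs on
-- no edge and can be replaced.
K-bounded : ∀ {n p a b} {G : Gph {n}} {c d : Col} → 0 < p → Ok p G c → Ok p G d → K a b G c d → ∃ λ a′ → ∃ λ b′ → a′ < p × b′ < p × K a′ b′ G c d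
K-bounded {p = p} {a} {b} 0<p ok ok′ k with a ℕ.<? p | b ℕ.<? p
... | yes a< | yes b< = a , b , a< , b< , k
... | no a≮ | yes b< = b , b , b< , b< , mkK λ e → Sum.map₂ (λ { (i , j) → f i (bound ok e) , f j (bound ok′ e) }) (at k e)
  where
  f : ∀ {x} → In a b x → x < p → In b b x
  f (inj₁ refl) x< = ⊥-elim (a≮ x<)
  f (inj₂ z) _ = inj₁ z
... | yes a< | no b≮ = a , a , a< , a< , mkK λ e → Sum.map₂ (λ { (i , j) → f i (bound ok e) , f j (bound ok′ e) }) (at k e)
  where
  f : ∀ {x} → In a b x → x < p → In a a x
  f (inj₂ refl) x< = ⊥-elim (b≮ x<)
  f (inj₁ z) _ = inj₁ z
... | no a≮ | no b≮ = 0 , 0 , 0<p , 0<p , mkK λ e → Sum.map₂ (λ { (i , j) → f i (bound ok e) , f j (bound ok′ e) }) (at k e)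
  where
  f : ∀ {x} → In a b x → x < p → In 0 0 x
  f (inj₁ refl) x< = ⊥-elim (a≮ x<)
  f (inj₂ refl) x< = ⊥-elim (b≮ x<)

-- Interchanges of disjoint colour pairs commute; `comb` is the fourth corner of the square spanned
-- by φ, φ′ and ψ.
module Comb {n : ℕ} {G : Gph {n}} {a b p x : ℕ} (disj : ∀ {y} → In a b y → ¬ In p x y)
            {k : ℕ} {φ φ′ ψ : Col {n}} (ok : Ok k G φ) (ok′ : Ok k G φ′) (okψ : Ok k G ψ)
            (m : K a b G φ φ′) (m′ : K p x G φ ψ) where

  comb : Col {n}
  comb u v with in? p x (φ u v)
  ... | yes _ = ψ u v
  ... | no _ = φ′ u v

  data CView (u v : Fin n) (r : ℕ) : Set where
    isP : In p x (φ u v) → In p x r → r ≡ ψ u v → φ u v ≡ φ′ u v → CView u v r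
    isA : In a b (φ u v) → In a b r → r ≡ φ′ u v → φ u v ≡ ψ u v → CView u v r
    isO : ¬ In a b r → ¬ In p x r → φ u v ≡ r → r ≡ φ′ u v → r ≡ ψ u v → CView u v r

  cview : ∀ {u v} → E G u v → CView u v (comb u v)
  cview {u} {v} e with in? p x (φ u v)
  ... | yes i = isP i (K-in m′ e i) refl (K-out m e (λ j → disj j i))
  ... | no ¬i with in? a b (φ u v)
  ...   | yes j = isA j (K-in m e j) refl (K-out m′ e ¬i)
  ...   | no ¬j = isO (¬j ∘ subst (In a b) (sym q)) (¬i ∘ subst (In p x) (sym q)) q refl (trans (sym q) (K-out m′ e ¬i))
    where q = K-out m e ¬j

  comb-ok : Ok k G comb
  symm comb-ok {u} {v} e with cview e | cview (E-sym e)
  ... | isP _ _ q _ | isP _ _ r _ = trans q (trans (symm okψ e) (sym r))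
  ... | isP i _ _ _ | isA j _ _ _ = ⊥-elim (disj j (subst (In p x) (symm ok e) i))
  ... | isP i _ _ _ | isO _ j s _ _ = ⊥-elim (j (subst (In p x) (trans (symm ok e) s) i))
  ... | isA i _ _ _ | isP j _ _ _ = ⊥-elim (disj (subst (In a b) (symm ok e) i) j)
  ... | isA _ _ q _ | isA _ _ r _ = trans q (trans (symm ok′ e) (sym r))
  ... | isA i _ _ _ | isO j _ s _ _ = ⊥-elim (j (subst (In a b) (trans (symm ok e) s) i))
  ... | isO _ j s _ _ | isP i _ _ _ = ⊥-elim (j (subst (In p x) (trans (sym (symm ok e)) s) i))
  ... | isO j _ s _ _ | isA i _ _ _ = ⊥-elim (j (subst (In a b) (trans (sym (symm ok e)) s) i))
  ... | isO _ _ s _ _ | isO _ _ s′ _ _ = trans (sym s) (trans (symm ok e) s′)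
  bound comb-ok e with cview e
  ... | isP _ _ q _ = subst (_< k) (sym q) (bound okψ e)
  ... | isA _ _ q _ = subst (_< k) (sym q) (bound ok′ e)
  ... | isO _ _ q _ _ = subst (_< k) q (bound ok e)
  proper comb-ok e f z with cview e | cview f
  ... | isP _ _ q _ | isP _ _ r _ = proper okψ e f (trans (sym q) (trans z r))
  ... | isP _ i _ _ | isA _ j _ _ = ⊥-elim (disj (subst (In a b) (sym z) j) i)
  ... | isP _ i _ _ | isO _ j _ _ _ = ⊥-elim (j (subst (In p x) z i))
  ... | isA _ i _ _ | isP _ j _ _ = ⊥-elim (disj (subst (In a b) z i) j)
  ... | isA _ _ q _ | isA _ _ r _ = proper ok′ e f (trans (sym q) (trans z r))
  ... | isA _ i _ _ | isO j _ _ _ _ = ⊥-elim (j (subst (In a b) z i))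
  ... | isO _ j _ _ _ | isP _ i _ _ = ⊥-elim (j (subst (In p x) (sym z) i))
  ... | isO j _ _ _ _ | isA _ i _ _ = ⊥-elim (j (subst (In a b) (sym z) i))
  ... | isO _ _ s _ _ | isO _ _ s′ _ _ = proper ok e f (trans s (trans z (sym s′)))

  comb-ab : K a b G ψ comb
  comb-ab = mkK λ {u} {v} e → aux (cview e)
    where
    aux : ∀ {u v r} → CView u v r → Rel a b (ψ u v) r
    aux (isP _ _ q _) = inj₁ (sym q)
    aux (isA i j _ s) = inj₂ (subst (In a b) s i , j)
    aux (isO _ _ _ _ q) = inj₁ (sym q)

  comb-px : K p x G φ′ comb
  comb-px = mkK λ {u} {v} e → aux (cview e)
    where
    aux : ∀ {u v r} → CView u v r → Rel p x (φ′ u v) r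
    aux (isP i j _ s) = inj₂ (subst (In p x) s i , j)
    aux (isA _ _ q _) = inj₁ (sym q)
    aux (isO _ _ _ q _) = inj₁ (sym q)

-- Representing colourings that do not extend.

module Reps {n : ℕ} (G : Gph {n}) (q : Fin n) (deg : ∀ v → DegLe (G ⊖ q) v 4)
            (degq : ∀ {y} → E G q y → DegLe (G ⊖ q) y 3) {y₁ y₂ y₃ : Fin n} (en : Vertex.Enum G q y₁ y₂ y₃) where
  open Extension G q deg degq public

  -- With three lists of at least two colours, a colouring fails to extend to G only if all lists are {c,d}.
  record NE (c d : ℕ) (φ : Col {n}) : Set where
    constructor mkNE
    field
      c<   : c < 5
      d<   : d < 5
      c≢d  : c ≢ d
      noc  : ∀ {y} → E G q y → Misses H φ y c
      nod  : ∀ {y} → E G q y → Misses H φ y d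
      rest : ∀ {y x} → E G q y → x < 5 → ¬ In c d x → Sees H φ y x
  open NE public

  unlisted : ∀ {c d φ y x} → NE c d φ → E G q y → In c d x → Misses H φ y x
  unlisted ne e (inj₁ refl) = noc ne e
  unlisted ne e (inj₂ refl) = nod ne e

  list-NE : ∀ {c d φ y x} → NE c d φ → E G q y → L φ y x → In c d x
  list-NE {c} {d} {x = x} ne e (x< , m) with in? c d x
  ... | yes i = i
  ... | no ¬i = ⊥-elim (m (rest ne e x< ¬i))

  NE-pair : ∀ {c d s t φ} → NE c d φ → NE s t φ → ∀ {x} → In s t x → In c d x
  NE-pair ne ne′ (inj₁ refl) = list-NE ne (e₁ en) (c< ne′ , noc ne′ (e₁ en))
  NE-pair ne ne′ (inj₂ refl) = list-NE ne (e₁ en) (d< ne′ , nod ne′ (e₁ en))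

  three-in : ∀ {a b s t u} → In a b s → In a b t → In a b u → s ≢ t → s ≢ u → t ≢ u → ⊥
  three-in i j k st su tu = case in-third i j st k of λ { (inj₁ z) → su (sym z) ; (inj₂ z) → tu (sym z) }

  sdr-three : ∀ {φ σ a b} → SDR φ σ → (∀ {y x} → E G q y → L φ y x → In a b x) → ⊥
  sdr-three s f = three-in (f (e₁ en) (l₁ t)) (f (e₂ en) (l₂ t)) (f (e₃ en) (l₃ t)) (n₁₂ t) (n₁₃ t) (n₂₃ t)
    where t = sdr-T3 en s

  NE-no-sdr : ∀ {c d φ σ} → NE c d φ → ¬ SDR φ σ
  NE-no-sdr ne s = sdr-three s (list-NE ne)

  opaque
    -- Hall's theorem by hand: with `c`, `d` listed at `y₁`, a colour outside {c,d} at `y₂` or `y₃`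
    -- lets the three choices be made greedily, `y₁` last. Without one, both lists are {c,d}, and
    -- everything depends on a third colour at `y₁`.
    dichotomy : ∀ {φ} → Ok 5 H φ → (∃ λ σ → SDR φ σ) ⊎ (∃ λ c → ∃ λ d → NE c d φ)
    -- Avoiding 0 is a dummy demand for the first colour; the second one has to avoid the first.
    dichotomy {φ} ok with another ok (e₁ en) (s≤s (z≤n {4}))
    ... | c , _ , lc with another ok (e₁ en) (proj₁ lc)
    ... | d , d≢c , ld with outside (e₂ en) | outside (e₃ en)
      where
      outside : ∀ {y} → E G q y → (∃ λ e → L φ y e × ¬ In c d e) ⊎ (L φ y c × L φ y d × (∀ {x} → x < 5 → ¬ In c d x → Sees H φ y x))
      outside {y} e with All.all? (λ x → in? c d x ⊎-dec sees? H φ y x) (upTo 5)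
      ... | no ¬all = let x , x∈ , z = find (¬All⇒Any¬ (λ x → in? c d x ⊎-dec sees? H φ y x) (upTo 5) ¬all) in
                      inj₁ (x , (∈-upTo⁻ x∈ , z ∘ inj₂) , z ∘ inj₁)
      ... | yes all = inj₂ (get (another ok e (proj₁ ld)) , get′ (another ok e (proj₁ lc)) , sees)
        where
        sees : ∀ {x} → x < 5 → ¬ In c d x → Sees H φ y x
        sees x< ¬i = [ (λ i → ⊥-elim (¬i i)) , id ]′ (All.lookup all (∈-upTo⁺ x<))
        inn : ∀ {x} → L φ y x → In c d x
        inn (x< , m) = [ id , (λ s → ⊥-elim (m s)) ]′ (All.lookup all (∈-upTo⁺ x<))
        get : (∃ λ o → o ≢ d × L φ y o) → L φ y c
        get (o , o≢d , l) with inn l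
        ... | inj₁ refl = l
        ... | inj₂ z = ⊥-elim (o≢d z)
        get′ : (∃ λ o → o ≢ c × L φ y o) → L φ y d
        get′ (o , o≢c , l) with inn l
        ... | inj₁ z = ⊥-elim (o≢c z)
        ... | inj₂ refl = l
    ... | inj₂ (c₂ , d₂ , r₂) | inj₂ (c₃ , d₃ , r₃) = final (All.all? (λ x → in? c d x ⊎-dec sees? H φ y₁ x) (upTo 5))
      where
      final : Dec (All (λ x → In c d x ⊎ Sees H φ y₁ x) (upTo 5)) → (∃ λ σ → SDR φ σ) ⊎ (∃ λ c → ∃ λ d → NE c d φ)
      final (yes all) = inj₂ (c , d , mkNE (proj₁ lc) (proj₁ ld) (≢-sym d≢c)
          (each₃ en (λ y → Misses H φ y c) (proj₂ lc) (proj₂ c₂) (proj₂ c₃))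
          (each₃ en (λ y → Misses H φ y d) (proj₂ ld) (proj₂ d₂) (proj₂ d₃))
          (λ e x< ¬i → each₃ en (λ y → ∀ {x} → x < 5 → ¬ In c d x → Sees H φ y x)
                         (λ x< ¬i → [ (λ i → ⊥-elim (¬i i)) , id ]′ (All.lookup all (∈-upTo⁺ x<))) r₂ r₃ e x< ¬i))
      final (no ¬all) = let x , x∈ , z = find (¬All⇒Any¬ (λ x → in? c d x ⊎-dec sees? H φ y₁ x) (upTo 5) ¬all) in
          inj₁ (_ , T3-sdr en (mkT (∈-upTo⁻ x∈ , z ∘ inj₂) c₂ d₃ (z ∘ inj₁ ∘ inj₁) (z ∘ inj₁ ∘ inj₂) (≢-sym d≢c)))
    ... | inj₁ (e , le , e∉) | _ = inj₁ (_ , T3-sdr en (proj₂ main))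
      where
      main : ∃ λ σ₁ → T3 en φ σ₁ e (proj₁ (another ok (e₃ en) (proj₁ le)))
      main with another ok (e₃ en) (proj₁ le)
      ... | f , f≢e , lf with f ℕ.≟ c
      ...   | yes refl = d , mkT ld le lf (λ { refl → e∉ (inj₂ refl) }) d≢c (≢-sym f≢e)
      ...   | no f≢c = c , mkT lc le lf (λ { refl → e∉ (inj₁ refl) }) (≢-sym f≢c) (≢-sym f≢e)
    ... | _ | inj₁ (e , le , e∉) = inj₁ (_ , T3-sdr en (proj₂ main))
      where
      main : ∃ λ σ₁ → T3 en φ σ₁ (proj₁ (another ok (e₂ en) (proj₁ le))) e
      main with another ok (e₂ en) (proj₁ le)
      ... | f , f≢e , lf with f ℕ.≟ c
      ...   | yes refl = d , mkT ld lf le d≢c (λ { refl → e∉ (inj₂ refl) }) f≢e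
      ...   | no f≢c = c , mkT lc lf le (≢-sym f≢c) (λ { refl → e∉ (inj₁ refl) }) f≢e

  -- A (p,x)-interchange that breaks the equality of the lists: `yx` gains `x`, `yp` still has `p`,
  -- and the third neighbour can take the other colour of {c,d}.
  record Nbr (c d : ℕ) (φ : Col {n}) (p x : ℕ) (ψ : Col {n}) : Set where
    constructor mkNbr
    field
      p∈   : In c d p
      x∉   : ¬ In c d x
      x<   : x < 5
      okψ  : Ok 5 H ψ
      move : K p x H φ ψ
      yx yp : Fin n
      ex   : E G q yx
      ep   : E G q yp
      lx   : Misses H ψ yx x
      lp   : Misses H ψ yp p
      x≢p  : yx ≢ yp
  open Nbr public

  enum-pair : ∀ {y y′} → E G q y → E G q y′ → y ≢ y′ → ∃ λ y″ → Enum y y′ y″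
  enum-pair e e′ ne with exh en e | exh en e′
  ... | inj₁ refl | inj₁ refl = ⊥-elim (ne refl)
  ... | inj₁ refl | inj₂ (inj₁ refl) = _ , en
  ... | inj₁ refl | inj₂ (inj₂ refl) = _ , swap₂₃ en
  ... | inj₂ (inj₁ refl) | inj₁ refl = _ , swap₂₃ (rot en)
  ... | inj₂ (inj₁ refl) | inj₂ (inj₁ refl) = ⊥-elim (ne refl)
  ... | inj₂ (inj₁ refl) | inj₂ (inj₂ refl) = _ , rot en
  ... | inj₂ (inj₂ refl) | inj₁ refl = _ , rot (rot en)
  ... | inj₂ (inj₂ refl) | inj₂ (inj₁ refl) = _ , swap₂₃ (rot (rot en))
  ... | inj₂ (inj₂ refl) | inj₂ (inj₂ refl) = ⊥-elim (ne refl)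

  p<5 : ∀ {c d φ p} → NE c d φ → In c d p → p < 5
  p<5 ne (inj₁ refl) = c< ne
  p<5 ne (inj₂ refl) = d< ne

  other : ∀ {c d φ p} → NE c d φ → In c d p → ∃ λ p′ → In c d p′ × p′ ≢ p
  other {c} {d} ne (inj₁ refl) = d , inj₂ refl , ≢-sym (c≢d ne)
  other {c} {d} ne (inj₂ refl) = c , inj₁ refl , c≢d ne

  pair-sdr : ∀ {θ p x yx yp} → E G q yx → E G q yp → yx ≢ yp → L θ yx x → L θ yp p →
             (∀ {y} → E G q y → ∃ λ o → L θ y o × o ≢ x × o ≢ p) → p ≢ x → ∃ λ σ → SDR θ σ
  pair-sdr ex ep ne lx lp third p≢x with enum-pair ex ep ne
  ... | y″ , en′ with third (e₃ en′)
  ... | o , lo , ox , op = _ , T3-sdr en′ (mkT lx lp lo (≢-sym p≢x) (≢-sym ox) (≢-sym op))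

  -- The fourth corner stays extendable: the (a,b)-interchange does not touch `x` at `yx` or `p` at
  -- `yp`, and the third neighbour uses the other colour of {c,d}, or whatever that interchange
  -- turns it into.
  comb-ext : ∀ {c d φ φ′ p x ψ a b} → NE c d φ → Nbr c d φ p x ψ → Ok 5 H φ → Ok 5 H φ′ → a < 5 → b < 5 → K a b H φ φ′ →
             (∀ {y} → In a b y → ¬ In p x y) →
             ∃ λ θ → Ok 5 H θ × (∃ λ σ → SDR θ σ) × K a b H ψ θ × K p x H φ′ θ
  comb-ext {c} {d} {φ} {φ′} {p} {x} {ψ} {a} {b} ne nb ok ok′ a< b< m disj =
    comb , comb-ok , pair-sdr (ex nb) (ep nb) (x≢p nb)
      (x< nb , K-misses comb-ab (λ i → disj i (inj₂ refl)) (lx nb))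
      (p<5 ne (p∈ nb) , K-misses comb-ab (λ i → disj i (inj₁ refl)) (lp nb)) third p≢x , comb-ab , comb-px
    where
    open Comb disj ok ok′ (okψ nb) m (move nb)
    p≢x : p ≢ x
    p≢x refl = x∉ nb (p∈ nb)
    third : ∀ {y} → E G q y → ∃ λ o → L comb y o × o ≢ x × o ≢ p
    third {y} e with other ne (p∈ nb)
    ... | p̄ , p̄∈ , p̄≢p with in? a b p̄
    ...   | no ¬i = p̄ , transfer comb-px out (transfer m ¬i (p<5 ne p̄∈ , unlisted ne e p̄∈)) , (λ { refl → x∉ nb p̄∈ }) , p̄≢p
      where
      out : ¬ In p x p̄
      out (inj₁ z) = p̄≢p z
      out (inj₂ refl) = x∉ nb p̄∈
    ...   | yes i with transfer-in a< b< ok ok′ m i (p<5 ne p̄∈ , unlisted ne e p̄∈)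
    ...     | o , oi , lo = o , transfer comb-px (disj oi) lo , (λ { refl → disj oi (inj₂ refl) }) , (λ { refl → disj oi (inj₁ refl) })

  ext-of : ∀ {c d φ p x ψ} → NE c d φ → Ok 5 H φ → Nbr c d φ p x ψ → ∃ λ σ → SDR ψ σ
  ext-of {c} {d} {φ} {p} {x} {ψ} ne ok nb with other ne (p∈ nb)
  ... | p̄ , p̄∈ , p̄≢p = pair-sdr (ex nb) (ep nb) (x≢p nb) (x< nb , lx nb) (p<5 ne (p∈ nb) , lp nb)
      (λ e → p̄ , transfer (move nb) out (p<5 ne p̄∈ , unlisted ne e p̄∈) , (λ { refl → x∉ nb p̄∈ }) , p̄≢p) (λ { refl → x∉ nb (p∈ nb) })
    where
    out : ¬ In p x p̄
    out (inj₁ z) = p̄≢p z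
    out (inj₂ refl) = x∉ nb p̄∈

  -- The (p,x)-chain from `y₁` ends at no more than one of `y₂`, `y₃`; the other one keeps `p` while
  -- `y₁` gains `x`.
  nbr-exists : ∀ {c d φ p x} → NE c d φ → Ok 5 H φ → In c d p → x < 5 → ¬ In c d x → ∃ λ ψ → Nbr c d φ p x ψ
  nbr-exists {c} {d} {φ} {p} {x} ne ok pi x< xn = chCol ch , nb
    where
    p≢x : p ≢ x
    p≢x refl = xn pi
    ch : Chain 5 H φ p x y₁
    ch = chain ok (p<5 ne pi) x< p≢x (unlisted ne (e₁ en) pi)
    mk : ∀ {y} → E G q y → y₁ ≢ y → Same p x H φ (chCol ch) y → Nbr c d φ p x (chCol ch)
    mk {y} e y₁≢y s = mkNbr pi xn x< (chOk ch) (chMove ch) y₁ y (e₁ en) e (unlisted ne (e₁ en) pi ∘ b⇐a (chStart ch)) (unlisted ne e pi ∘ same⇐ s (inj₁ refl)) y₁≢y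
    nb : Nbr c d φ p x (chCol ch)
    nb with chRest ch y₂ | chRest ch y₃
    ... | inj₁ z | _ = ⊥-elim (d₁₂ en (sym z))
    ... | inj₂ (inj₂ s) | _ = mk (e₂ en) (d₁₂ en) s
    ... | inj₂ (inj₁ _) | inj₁ z = ⊥-elim (d₁₃ en (sym z))
    ... | inj₂ (inj₁ _) | inj₂ (inj₂ s) = mk (e₃ en) (d₁₃ en) s
    ... | inj₂ (inj₁ z) | inj₂ (inj₁ z′) = ⊥-elim (d₂₃ en (trans z (sym z′)))

  -- If {a,b} met {c,d} in both colours or in none, or if all three neighbours behaved alike, the
  -- three lists would still lie in a common pair and could not have distinct representatives.
  nbr-view : ∀ {c d φ ψ σ a b} → NE c d φ → Ok 5 H φ → Ok 5 H ψ → a < 5 → b < 5 → K a b H φ ψ → SDR ψ σ → Nbr c d φ a b ψ ⊎ Nbr c d φ b a ψ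
  nbr-view {c} {d} {φ} {ψ} {σ} {a} {b} ne ok ok′ a< b< m s = aux (in? c d a) (in? c d b)
    where
    mk : ∀ {p x} → In c d p → ¬ In c d x → x < 5 → K p x H φ ψ → Nbr c d φ p x ψ
    mk {p} {x} pi xn x< k = build
      where
      status : ∀ {y} → E G q y → Same p x H φ ψ y ⊎ Flip p x H φ ψ y
      status {y} _ = K-status ok ok′ k y
      pair : ∀ {y y′} → E G q y → E G q y′ → y ≢ y′ → Flip p x H φ ψ y → Same p x H φ ψ y′ → Nbr c d φ p x ψ
      pair e e′ z f s = mkNbr pi xn x< ok′ k _ _ e e′ (unlisted ne e pi ∘ b⇐a f) (unlisted ne e′ pi ∘ same⇐ s (inj₁ refl)) z
      back : ∀ {y z} → E G q y → ¬ In p x z → L ψ y z → In c d z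
      back e ¬i l = list-NE ne e (transfer (K-sym k) ¬i l)
      all-same : (∀ {y} → E G q y → Same p x H φ ψ y) → ⊥
      all-same f = sdr-three s λ {y} {z} e l → case in? p x z of λ where
        (yes i) → list-NE ne e (proj₁ l , proj₂ l ∘ same⇒ (f e) i)
        (no ¬i) → back e ¬i l
      all-flip : (∀ {y} → E G q y → Flip p x H φ ψ y) → ⊥
      all-flip f with other ne pi
      ... | p̄ , p̄∈ , p̄≢p = sdr-three {a = p̄} {x} s λ {y} {z} e l → case in? p x z of λ where
        (yes (inj₁ refl)) → ⊥-elim (proj₂ l (b⇒a (f e) (rest ne e x< xn)))
        (yes (inj₂ r)) → inj₂ r
        (no ¬i) → case in-third p̄∈ pi p̄≢p (back e ¬i l) of λ where
          (inj₁ r) → inj₁ r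
          (inj₂ r) → ⊥-elim (¬i (inj₁ r))
      build : Nbr c d φ p x ψ
      build with status (e₁ en) | status (e₂ en) | status (e₃ en)
      ... | inj₁ s₁ | inj₁ s₂ | inj₁ s₃ = ⊥-elim (all-same (each₃ en (Same p x H φ ψ) s₁ s₂ s₃))
      ... | inj₂ s₁ | inj₂ s₂ | inj₂ s₃ = ⊥-elim (all-flip (each₃ en (Flip p x H φ ψ) s₁ s₂ s₃))
      ... | inj₁ s₁ | inj₂ s₂ | _ = pair (e₂ en) (e₁ en) (≢-sym (d₁₂ en)) s₂ s₁
      ... | inj₂ s₁ | inj₁ s₂ | _ = pair (e₁ en) (e₂ en) (d₁₂ en) s₁ s₂
      ... | _ | inj₁ s₂ | inj₂ s₃ = pair (e₃ en) (e₂ en) (≢-sym (d₂₃ en)) s₃ s₂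
      ... | _ | inj₂ s₂ | inj₁ s₃ = pair (e₂ en) (e₃ en) (d₂₃ en) s₂ s₃
    uniform : (∀ {y z} → In a b z → L ψ y z → E G q y → In c d z) → ⊥
    uniform f = sdr-three s λ {y} {z} e l → case in? a b z of λ where
      (yes i) → f i l e
      (no ¬i) → list-NE ne e (transfer (K-sym m) ¬i l)
    aux : Dec (In c d a) → Dec (In c d b) → Nbr c d φ a b ψ ⊎ Nbr c d φ b a ψ
    aux (yes i) (no j) = inj₁ (mk i j b< m)
    aux (no i) (yes j) = inj₂ (mk j i a< (K-swap m))
    aux (yes i) (yes j) = ⊥-elim (uniform λ { (inj₁ refl) _ _ → i ; (inj₂ refl) _ _ → j })
    aux (no i) (no j) = ⊥-elim (uniform λ {y} z∈ l e → list-NE ne e (let _ , o∈ , lo = transfer-in a< b< ok′ ok (K-sym m) z∈ l in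
        ⊥-elim (case o∈ of λ { (inj₁ z) → i (subst (In c d) z (list-NE ne e lo)) ; (inj₂ z) → j (subst (In c d) z (list-NE ne e lo)) })))

  -- A colouring that does not extend is represented by the extensions of its extendable neighbours.
  data R (φ ρ : Col {n}) : Set where
    ext : ∀ {σ} → SDR φ σ → Agree G ρ (X φ σ) → R φ ρ
    nbr : ∀ {c d p x ψ σ} → NE c d φ → Nbr c d φ p x ψ → SDR ψ σ → Agree G ρ (X ψ σ) → R φ ρ

  private
    to : ∀ {φ σ ρ} → Ok 5 H φ → SDR φ σ → Agree G ρ (X φ σ) → Kempe 5 G ρ (X φ σ)
    to ok s ag = Kempe-sym (agree-kempe (X-ok ok s) (mkA λ e → sym (agr ag e)))

  record Conn (φ ψ : Col {n}) : Set where
    constructor mkConn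
    field conn : ∀ {ρ ρ′} → R φ ρ → R ψ ρ′ → Kempe 5 G ρ ρ′
  open Conn public

  -- Disjoint colour pairs meet at the fourth corner of their square. Overlapping ones are joined
  -- through a further neighbour with a fresh colour `o`; five colours just suffice for `o` to avoid
  -- `c`, `d`, `x` and `x′`.
  nbrs-linked : ∀ {c d φ p x p′ x′ ψ ψ′ σ σ′} → NE c d φ → Ok 5 H φ → Nbr c d φ p x ψ → Nbr c d φ p′ x′ ψ′ → SDR ψ σ → SDR ψ′ σ′ →
                Kempe 5 G (X ψ σ) (X ψ′ σ′)
  nbrs-linked {c} {d} {φ} ne ok = main
    where
    far : ∀ {p x p′ x′ ψ ψ′ σ σ′} → Nbr c d φ p x ψ → Nbr c d φ p′ x′ ψ′ → p ≢ p′ → x ≢ x′ → SDR ψ σ → SDR ψ′ σ′ → Kempe 5 G (X ψ σ) (X ψ′ σ′)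
    far {p} {x} {p′} {x′} nb nb′ pp xx s s′ with comb-ext ne nb ok (okψ nb′) (p<5 ne (p∈ nb′)) (x< nb′) (move nb′)
           (λ { (inj₁ refl) (inj₁ z) → pp (sym z) ; (inj₁ refl) (inj₂ refl) → x∉ nb (p∈ nb′)
              ; (inj₂ refl) (inj₁ refl) → x∉ nb′ (p∈ nb) ; (inj₂ refl) (inj₂ z) → xx (sym z) })
    ... | θ , okθ , (_ , sθ) , k , k′ = link-sdr en (p<5 ne (p∈ nb′)) (x< nb′) (okψ nb) okθ k s sθ
                                     ◅◅ Kempe-sym (link-sdr en (p<5 ne (p∈ nb)) (x< nb) (okψ nb′) okθ k′ s′ sθ)
    through : ∀ {p x p′ x′ ψ ψ′ σ σ′} → Nbr c d φ p x ψ → Nbr c d φ p′ x′ ψ′ → p ≡ p′ → SDR ψ σ → SDR ψ′ σ′ → Kempe 5 G (X ψ σ) (X ψ′ σ′)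
    through {p} {x} {p′} {x′} nb nb′ refl s s′ with other ne (p∈ nb) | fresh# {5} (c ∷ d ∷ x ∷ x′ ∷ []) ≤-refl
    ... | p̄ , p̄∈ , p̄≢p | o , o< , oc , od , ox , ox′ , _ with nbr-exists {x = o} ne ok p̄∈ o< [ oc , od ]′
    ...   | _ , nbo with ext-of ne ok nbo
    ...     | _ , so = far nb nbo (≢-sym p̄≢p) (≢-sym ox) s so ◅◅ far nbo nb′ p̄≢p ox′ so s′
    main : ∀ {p x p′ x′ ψ ψ′ σ σ′} → Nbr c d φ p x ψ → Nbr c d φ p′ x′ ψ′ → SDR ψ σ → SDR ψ′ σ′ → Kempe 5 G (X ψ σ) (X ψ′ σ′)
    main {p} {x} {p′} {x′} nb nb′ s s′ with p ℕ.≟ p′ | x ℕ.≟ x′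
    ... | yes z | _ = through nb nb′ z s s′
    ... | no z | no z′ = far nb nb′ z z′ s s′
    ... | no z | yes refl with fresh# {5} (c ∷ d ∷ x ∷ []) (s≤s (s≤s (s≤s (s≤s z≤n))))
    ...   | o , o< , oc , od , ox , _ with nbr-exists {x = o} ne ok (p∈ nb′) o< [ oc , od ]′
    ...     | _ , nbo with ext-of ne ok nbo
    ...       | _ , so = far nb nbo z (≢-sym ox) s so ◅◅ through nbo nb′ refl so s′

  NE-NE-linked : ∀ {c d φ p x ψ σ} → NE c d φ → Ok 5 H φ → Nbr c d φ p x ψ → SDR ψ σ →
                 ∀ {c′ d′ ψ′ p′ x′ σ′} → NE c′ d′ φ → Nbr c′ d′ φ p′ x′ ψ′ → SDR ψ′ σ′ → Kempe 5 G (X ψ σ) (X ψ′ σ′)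
  NE-NE-linked {c} {d} ne ok nb s {c′} {d′} ne′ nb′ s′ = nbrs-linked ne ok nb (mkNbr (NE-pair ne ne′ (p∈ nb′)) (x∉ nb′ ∘ NE-pair ne′ ne) (x< nb′) (okψ nb′)
      (move nb′) (yx nb′) (yp nb′) (ex nb′) (ep nb′) (lx nb′) (lp nb′) (x≢p nb′)) s s′

  conn-refl : ∀ {φ} → Ok 5 H φ → Conn φ φ
  conn-refl ok = mkConn λ where
    (ext s ag) (ext s′ ag′) → to ok s ag ◅◅ unique en ok s s′ ◅◅ Kempe-sym (to ok s′ ag′)
    (ext s ag) (nbr ne _ _ _) → ⊥-elim (NE-no-sdr ne s)
    (nbr ne _ _ _) (ext s _) → ⊥-elim (NE-no-sdr ne s)
    (nbr ne nb s ag) (nbr ne′ nb′ s′ ag′) → to (okψ nb) s ag ◅◅ NE-NE-linked ne ok nb s ne′ nb′ s′ ◅◅ Kempe-sym (to (okψ nb′) s′ ag′)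

  conn-sym : ∀ {φ ψ} → Conn φ ψ → Conn ψ φ
  conn-sym f = mkConn λ r r′ → Kempe-sym (conn f r′ r)

  represent : ∀ {φ} → Ok 5 H φ → ∃ λ ρ → R φ ρ
  represent ok with dichotomy ok
  ... | inj₁ (_ , s) = _ , ext s (mkA λ _ → refl)
  ... | inj₂ (c , d , ne) with fresh# {5} (c ∷ d ∷ []) (s≤s (s≤s (s≤s z≤n)))
  ...   | o , o< , oc , od , _ with nbr-exists {p = c} {o} ne ok (inj₁ refl) o< [ oc , od ]′
  ...     | _ , nb with ext-of ne ok nb
  ...       | _ , s = _ , nbr ne nb s (mkA λ _ → refl)

  conn-trans : ∀ {φ ψ χ} → Ok 5 H ψ → Conn φ ψ → Conn ψ χ → Conn φ χ
  conn-trans ok f g = mkConn λ r r′ → let _ , m = represent ok in conn f r m ◅◅ conn g m r′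

  private
    -- If ψ extends, it is itself a neighbour of φ. Otherwise a (p,o)-neighbour of φ with {p,o}
    -- disjoint from {a,b} is pushed across the square to a neighbour of ψ.
    good-NE : ∀ {c d φ ψ a b} → NE c d φ → Ok 5 H φ → Ok 5 H ψ → a < 5 → b < 5 → K a b H φ ψ →
              (∃ λ p → In c d p × ¬ In a b p) → Conn φ ψ
    good-NE {c} {d} {φ} {ψ} {a} {b} ne ok ok′ a< b< k (p , pi , pn) = mkConn λ where
        (ext s _) _ → ⊥-elim (NE-no-sdr ne s)
        (nbr ne′ nb s ag) (ext s′ ag′) → to (okψ nb) s ag ◅◅
           [ (λ v → NE-NE-linked ne′ ok nb s ne v s′) , (λ v → NE-NE-linked ne′ ok nb s ne v s′) ]′ (nbr-view ne ok ok′ a< b< k s′)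
           ◅◅ Kempe-sym (to ok′ s′ ag′)
        (nbr ne₁ nb₁ s₁ ag₁) (nbr ne′ nb′ s′ ag′) → to (okψ nb₁) s₁ ag₁ ◅◅ square ne₁ nb₁ s₁ ne′ nb′ s′ ◅◅ Kempe-sym (to (okψ nb′) s′ ag′)
      where
      square : ∀ {c₁ d₁ p₁ x₁ ψ₁ σ₁} → NE c₁ d₁ φ → Nbr c₁ d₁ φ p₁ x₁ ψ₁ → SDR ψ₁ σ₁ →
               ∀ {c′ d′ p′ x′ ψ′ σ′} → NE c′ d′ ψ → Nbr c′ d′ ψ p′ x′ ψ′ → SDR ψ′ σ′ → Kempe 5 G (X ψ₁ σ₁) (X ψ′ σ′)
      square ne₁ nb₁ s₁ ne′ nb′ s′ with fresh# {5} (c ∷ d ∷ a ∷ b ∷ []) ≤-refl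
      ... | o , o< , oc , od , oa , ob , _ with nbr-exists {p = p} {o} ne ok pi o< [ oc , od ]′
      ...   | _ , nb with ext-of ne ok nb | comb-ext ne nb ok ok′ a< b< k (λ { i (inj₁ refl) → pn i ; i (inj₂ refl) → [ oa , ob ]′ i })
      ...     | _ , s | θ , okθ , (_ , sθ) , k₁ , k₂ =
                  NE-NE-linked ne₁ ok nb₁ s₁ ne nb s ◅◅ link-sdr en a< b< (okψ nb) okθ k₁ s sθ
                  ◅◅ [ (λ v → NE-NE-linked ne′ ok′ v sθ ne′ nb′ s′) , (λ v → NE-NE-linked ne′ ok′ v sθ ne′ nb′ s′) ]′ (nbr-view ne′ ok′ okθ (p<5 ne pi) o< k₂ sθ)

  -- The only interchange not covered here swaps the two colours of a non-extendable colouring.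
  conn-good : ∀ {φ ψ a b} → a < 5 → b < 5 → Ok 5 H φ → Ok 5 H ψ → K a b H φ ψ →
              (∀ {c d} → NE c d φ → ∃ λ p → In c d p × ¬ In a b p) → Conn φ ψ
  conn-good {φ} {ψ} {a} {b} a< b< ok ok′ k good = decide (dichotomy ok) (dichotomy ok′)
    where
    decide : (∃ λ σ → SDR φ σ) ⊎ (∃ λ c → ∃ λ d → NE c d φ) → (∃ λ σ → SDR ψ σ) ⊎ (∃ λ c → ∃ λ d → NE c d ψ) → Conn φ ψ
    decide (inj₂ (c , d , ne)) _ = good-NE ne ok ok′ a< b< k (good ne)
    decide (inj₁ (_ , s)) (inj₁ (_ , s′)) = mkConn λ where
      (ext s ag) (ext s′ ag′) → to ok s ag ◅◅ link-sdr en a< b< ok ok′ k s s′ ◅◅ Kempe-sym (to ok′ s′ ag′)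
      (ext _ _) (nbr ne _ _ _) → ⊥-elim (NE-no-sdr ne s′)
      (nbr ne _ _ _) _ → ⊥-elim (NE-no-sdr ne s)
    decide (inj₁ (_ , s)) (inj₂ (c , d , ne)) = conn-sym (good-NE ne ok′ ok a< b< (K-sym k) (outer (in? a b c) (in? a b d)))
      where
      outer : Dec (In a b c) → Dec (In a b d) → ∃ λ p → In c d p × ¬ In a b p
      outer (no i) _ = c , inj₁ refl , i
      outer (yes _) (no j) = d , inj₂ refl , j
      outer (yes i) (yes j) = ⊥-elim (sdr-three s λ {y} {x} e l → case in? a b x of λ where
        (yes x∈) → in-third i j (c≢d ne) x∈
        (no x∉) → list-NE ne e (transfer k x∉ l))

  -- A colour seen at `y₁` is in no list common to the three neighbours, so {a,b} is not the
  -- dangerous pair. Every move of the shifting argument is certified in this form.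
  conn-seen : ∀ {φ ψ a b x} → a < 5 → b < 5 → Ok 5 H φ → Ok 5 H ψ → K a b H φ ψ → In a b x → Sees H φ y₁ x → Conn φ ψ
  conn-seen {φ} {ψ} {a} {b} {x} a< b< ok ok′ k xi s = conn-good a< b< ok ok′ k λ {c} {d} ne → pick ne (in? a b c) (in? a b d)
    where
    pick : ∀ {c d} → NE c d φ → Dec (In a b c) → Dec (In a b d) → ∃ λ p → In c d p × ¬ In a b p
    pick {c} ne (no i) _ = c , inj₁ refl , i
    pick {d = d} ne (yes _) (no j) = d , inj₂ refl , j
    pick ne (yes i) (yes j) = ⊥-elim (unlisted ne (e₁ en) (in-third i j (c≢d ne) xi) s)

module _ {n : ℕ} where

  K-⊆ : ∀ {a b} {G J : Gph {n}} {φ ψ} → (∀ {x y} → E J x y → E G x y) → K a b G φ ψ → K a b J φ ψ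
  K-⊆ f k = mkK λ e → at k (f e)

  K-upd : ∀ {a b r} {G : Gph {n}} {v w} {φ ψ : Col} → K a b (G ∖ (v , w)) φ ψ → φ v w ≡ φ w v → Rel a b (φ v w) r → K a b G φ (upd ψ v w r)
  K-upd {a} {b} {r} {G} {v} {w} {φ} {ψ} k sm rl = mkK λ {x} {y} e → aux e (pair? v w x y)
    where
    aux : ∀ {x y} → E G x y → Dec (Pair v w x y) → Rel a b (φ x y) (upd ψ v w r x y)
    aux e (yes fwd) = subst (Rel a b (φ v w)) (sym (upd-on ψ {v} {w} fwd)) rl
    aux e (yes bwd) = subst₂ (Rel a b) sm (sym (upd-on ψ {v} {w} bwd)) rl
    aux {x} {y} e (no p) = subst (Rel a b (φ x y)) (sym (upd-off ψ p)) (at k (mkE (e , p)))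

  K-upd₂ : ∀ {a b r s} {G : Gph {n}} {v w} {φ ψ : Col} → K a b (G ∖ (v , w)) φ ψ → Rel a b r s → K a b G (upd φ v w r) (upd ψ v w s)
  K-upd₂ {a} {b} {r} {s} {G} {v} {w} {φ} {ψ} k rl = mkK λ {x} {y} e → aux e (pair? v w x y)
    where
    aux : ∀ {x y} → E G x y → Dec (Pair v w x y) → Rel a b (upd φ v w r x y) (upd ψ v w s x y)
    aux e (yes p) = subst₂ (Rel a b) (sym (upd-on φ p)) (sym (upd-on ψ p)) rl
    aux {x} {y} e (no p) = subst₂ (Rel a b) (sym (upd-off φ p)) (sym (upd-off ψ p)) (at k (mkE (e , p)))

-- Shifting colours backwards along an alternating path.

module Caterpillar {n : ℕ} (G : Gph {n}) (q : Fin n) (deg : ∀ v → DegLe (G ⊖ q) v 4)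
                   (degq : ∀ {y} → E G q y → DegLe (G ⊖ q) y 3) {y₁ y₂ y₃ : Fin n} (en : Vertex.Enum G q y₁ y₂ y₃)
                   {c d i : ℕ} (c<5 : c < 5) (d<5 : d < 5) (i<5 : i < 5) (cd : c ≢ d) (i∉ : ¬ In c d i) where
  open Reps G q deg degq en

  Cdi : ℕ → Set
  Cdi x = In c d x ⊎ x ≡ i

  in<5 : ∀ {x} → In c d x → x < 5
  in<5 (inj₁ refl) = c<5
  in<5 (inj₂ refl) = d<5

  in≢i : ∀ {x} → In c d x → x ≢ i
  in≢i j refl = i∉ j

  -- The colours c, d, i at the vertices of P: none is added, and the edges inside P keep theirs.
  record Keep (J : Gph) (P : List (Fin n)) (φ ψ : Col) : Set where
    constructor mkKeep
    field
      old : ∀ {x y} → x ∈ P → E J x y → Cdi (ψ x y) → φ x y ≡ ψ x y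
      fix : ∀ {x y} → x ∈ P → y ∈ P → E J x y → Cdi (φ x y) → φ x y ≡ ψ x y
  open Keep

  keep-refl : ∀ {J P φ} → Keep J P φ φ
  keep-refl = mkKeep (λ _ _ _ → refl) (λ _ _ _ _ → refl)

  keep-trans : ∀ {J P φ ψ χ} → Keep J P φ ψ → Keep J P ψ χ → Keep J P φ χ
  keep-trans k l = mkKeep
    (λ p e z → let q = old l p e z in trans (old k p e (subst Cdi (sym q) z)) q)
    (λ p p′ e z → let q = fix k p p′ e z in trans q (fix l p p′ e (subst Cdi q z)))

  keep-⊆ : ∀ {J J′ P P′ φ ψ} → (∀ {x y} → E J′ x y → E J x y) → (∀ {x} → x ∈ P′ → x ∈ P) → Keep J P φ ψ → Keep J′ P′ φ ψ
  keep-⊆ f g k = mkKeep (λ p e → old k (g p) (f e)) (λ p p′ e → fix k (g p) (g p′) (f e))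

  -- The last edge of a path with edges coloured alternately i and c or d, in a colouring φ, has been
  -- recoloured away from i in ψ, while the preceding edge uv is left out.
  record Half (φ : Col) (u v : Fin n) (ψ : Col) (P : List (Fin n)) : Set where
    field
      κ     : ℕ
      κ∈    : In c d κ
      θ     : Col
      okθ   : Ok 5 H θ
      connθ : Conn φ θ
      keepθ : Keep H (v ∷ P) φ θ
      okψ′  : Ok 5 (H ∖ (u , v)) ψ
      mvψ   : K κ i (H ∖ (u , v)) θ ψ
      keepψ : Keep (H ∖ (u , v)) P φ ψ
      noi   : Misses (H ∖ (u , v)) ψ v i
      θi    : v ≡ y₁ → Sees H θ v i
      avoid : E H u v → κ ≡ φ u v ⊎ Misses (H ∖ (u , v)) ψ v (φ u v)
  open Half

  -- One stage of the path: `vz` is its current `i`-edge, `P` holds the vertices before it, and `v`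
  -- meets `c` and `d` at most through the edge from its predecessor `u`. At the start of the path
  -- `u` equals `v` and there is no such edge.
  record Lev (φ : Col) (u v z : Fin n) (P : List (Fin n)) : Set where
    field
      okφ : Ok 5 H φ
      evz : E H v z
      iz  : φ v z ≡ i
      mis : ∀ {x} → In c d x → Misses (H ∖ (u , v)) φ v x
      ucd : E H u v → In c d (φ u v) × u ∈ P
      v∉  : v ∉ P
      z∉  : z ∉ P
  open Lev

  lev-⊆uv : ∀ {φ u v z P} → Lev φ u v z P → E (H ∖ (u , v)) v z
  lev-⊆uv {u = u} {v} {z} l = mkE (evz l , aux)
    where
    aux : ¬ Pair u v v z
    aux fwd = E-irr (evz l)
    aux bwd = i∉ (subst (In c d) (trans (symm (okφ l) (E-sym (evz l))) (iz l)) (proj₁ (ucd l (E-sym (evz l)))))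

  lev-K : ∀ {φ φ′ u v z P} → Lev φ u v z P → Ok 5 H φ′ → K c d H φ φ′ → Lev φ′ u v z P
  lev-K l ok′ k = record { okφ = ok′ ; evz = evz l ; iz = trans (sym (K-out k (evz l) (i∉ ∘ subst (In c d) (iz l)))) (iz l)
    ; mis = λ { x∈ (see y (mkE (e , p)) r) → mis l (K-in (K-sym k) e (subst (In c d) (sym r) x∈)) (see y (mkE (e , p)) refl) }
    ; ucd = λ e → K-in k e (proj₁ (ucd l e)) , proj₂ (ucd l e) ; v∉ = v∉ l ; z∉ = z∉ l }

  lev-keep : ∀ {φ φ′ u v z P} → Lev φ u v z P → Ok 5 H φ′ → φ′ v z ≡ i → Keep H (v ∷ P) φ φ′ → Lev φ′ u v z P
  lev-keep l ok′ r k = record { okφ = ok′ ; evz = evz l ; iz = r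
    ; mis = λ { x∈ (see y (mkE (e , p)) refl) → let r = old k (here refl) e (inj₁ x∈) in mis l x∈ (see y (mkE (e , p)) r) }
    ; ucd = λ e → let u∈ = proj₂ (ucd l e) in subst (In c d) (fix k (there u∈) (here refl) e (inj₁ (proj₁ (ucd l e)))) (proj₁ (ucd l e)) , u∈
    ; v∉ = v∉ l ; z∉ = z∉ l }

  precompose : ∀ {φ φ₁ u v z ψ P} → Lev φ u v z P → Ok 5 H φ₁ → Conn φ φ₁ → Keep H (v ∷ P) φ φ₁ → Half φ₁ u v ψ P → Half φ u v ψ P
  precompose {φ} {φ₁} {u} {v} {ψ = ψ} l ok₁ cn k h = record { κ = κ h ; κ∈ = κ∈ h ; θ = θ h ; okθ = okθ h ; connθ = conn-trans ok₁ cn (connθ h)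
    ; keepθ = keep-trans k (keepθ h) ; okψ′ = okψ′ h ; mvψ = mvψ h ; keepψ = keep-trans (keep-⊆ ∖-⊆ there k) (keepψ h) ; θi = θi h ; noi = noi h
    ; avoid = λ e → subst (λ z → κ h ≡ z ⊎ Misses (H ∖ (u , v)) ψ v z) (sym (fix k (there (proj₂ (ucd l e))) (here refl) e (inj₁ (proj₁ (ucd l e))))) (avoid h e) }

  module Side {φ u v z P} (l : Lev φ u v z P) where

    v≢z : v ≢ z
    v≢z = E-≢ (evz l)

    zv : φ z v ≡ i
    zv = trans (symm (okφ l) (E-sym (evz l))) (iz l)

    not-vz : ∀ {x y} → x ∈ P → ¬ Pair v z x y
    not-vz p fwd = v∉ l p
    not-vz p bwd = z∉ l p

    -- A path can end where `z` misses one of `c`, `d`: the `i`-edge `vz` takes that colour, which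
    -- frees `i` at `v`.
    last : ∀ {κ} → In c d κ → Misses H φ z κ → Half φ u v (upd φ v z κ) P
    last {κ} κ∈ mz = record { κ = κ ; κ∈ = κ∈ ; θ = φ ; okθ = okφ l ; connθ = conn-refl (okφ l) ; keepθ = keep-refl ; θi = λ _ → see z (evz l) (iz l)
      ; okψ′ = recolour-ok ok₀ e₀ (in<5 κ∈) (mis l κ∈) (mz ∘ sees-sub)
      ; mvψ = upd-K ok₀ e₀ (inj₂ (iz l)) (inj₁ refl)
      ; keepψ = mkKeep (λ p _ _ → sym (upd-off φ (not-vz p))) (λ p _ _ _ → sym (upd-off φ (not-vz p)))
      ; noi = λ s → case sees-split s of λ where
          (inj₁ (_ , r)) → in≢i κ∈ (sym r)
          (inj₂ (see y (mkE (e , p)) r)) → p (subst (Pair v z v) (proper ok₀ e₀ e (trans (iz l) (sym r))) fwd)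
      ; avoid = λ e → av e (κ ℕ.≟ φ u v) }
      where
      e₀ : E (H ∖ (u , v)) v z
      e₀ = lev-⊆uv l
      ok₀ : Ok 5 (H ∖ (u , v)) φ
      ok₀ = Ok-⊆ ∖-⊆ (okφ l)
      av : E H u v → Dec (κ ≡ φ u v) → κ ≡ φ u v ⊎ Misses (H ∖ (u , v)) (upd φ v z κ) v (φ u v)
      av e (yes r) = inj₁ r
      av e (no r) = inj₂ λ s → case sees-split s of λ where
        (inj₁ (_ , r′)) → r (sym r′)
        (inj₂ s′) → mis l (proj₁ (ucd l e)) (sees-sub s′)

  module Side₂ {φ u v z P} (l : Lev φ u v z P) where
    open Side l

    module _ {w : Fin n} (ezw : E H z w) (λ∈ : In c d (φ z w)) where

      w≢v : w ≢ v
      w≢v refl = i∉ (subst (In c d) zv λ∈)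

      z≢w : z ≢ w
      z≢w = E-≢ ezw

      vz≢zw : ¬ Pair z w v z
      vz≢zw fwd = v≢z refl
      vz≢zw bwd = w≢v refl

      -- Giving `zw` the colour `o` takes its old colour away from `z`, so the path ends there; the
      -- preparatory move is harmless because `y₁` sees `o`.
      free : ∀ {o} → o < 5 → ¬ In c d o → o ≢ i → Misses H φ z o → Misses H φ w o → Sees H φ y₁ o →
             Half φ u v (upd (upd φ z w o) v z (φ z w)) P
      free {o} o< o∉ o≢i mz mw so = precompose l ok₁ cn kp (Side.last lev₁ λ∈ mz₁)
        where
        φ₁ : Col
        φ₁ = upd φ z w o
        ok₁ : Ok 5 H φ₁
        ok₁ = recolour-ok (okφ l) ezw o< mz mw
        cn : Conn φ φ₁
        cn = conn-seen (in<5 λ∈) o< (okφ l) ok₁ (upd-K (okφ l) ezw (inj₁ refl) (inj₂ refl)) (inj₂ refl) so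
        ¬cdi : ¬ Cdi o
        ¬cdi (inj₁ r) = o∉ r
        ¬cdi (inj₂ r) = o≢i r
        z∉′ : z ∉ v ∷ P
        z∉′ (here r) = v≢z (sym r)
        z∉′ (there r) = z∉ l r
        kp : Keep H (v ∷ P) φ φ₁
        kp = mkKeep (λ {x} {y} p e r → case pair? z w x y of λ where
                        (yes b) → ⊥-elim (¬cdi (subst Cdi (upd-on φ b) r))
                        (no b) → sym (upd-off φ b))
                    (λ {x} {y} p p′ e r → sym (upd-off φ λ { fwd → z∉′ p ; bwd → z∉′ p′ }))
        lev₁ : Lev φ₁ u v z P
        lev₁ = lev-keep l ok₁ (trans (upd-off φ vz≢zw) (iz l)) kp
        mz₁ : Misses H φ₁ z (φ z w)
        mz₁ s = case sees-split s of λ where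
          (inj₁ (_ , r)) → o∉ (subst (In c d) r λ∈)
          (inj₂ (see y (mkE (e , p)) r)) → p (subst (Pair z w z) (proper (okφ l) ezw e (sym r)) fwd)

      -- The tail beyond `w` has freed `i` at `w`, so `zw` can take `i` and `vz` can take the former
      -- colour of `zw`. The first `i`-edge x₁x₂ of the path, at `y₁`, lies before the tail and
      -- keeps intermediate moves harmless.
      back : ∀ {ψ x₁ x₂} → x₁ ∈ v ∷ z ∷ P → x₂ ∈ v ∷ z ∷ P → x₁ ≡ y₁ → E H x₁ x₂ → φ x₁ x₂ ≡ i → w ∉ P →
             Half φ z w ψ (v ∷ z ∷ P) → Half φ u v (upd (upd ψ z w i) v z (φ z w)) P
      back {ψ} x₁∈ x₂∈ refl ex ix w∉ h = choose (avoid h ezw)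
        where
        λ₀ : ℕ
        λ₀ = φ z w
        A : Gph
        A = H ∖ (z , w)
        ψ₁ ψ₂ : Col
        ψ₁ = upd ψ z w i
        ψ₂ = upd ψ₁ v z λ₀
        B : Gph
        B = (H ∖ (u , v)) ∖ (v , z)
        B∖ : ∀ {x y} → E (B ∖ (z , w)) x y → E A x y
        B∖ (mkE (mkE (mkE (e , _) , _) , p)) = mkE (e , p)
        vA : ∀ {y} → E H v y → E A v y
        vA e = mkE (e , λ { fwd → v≢z refl ; bwd → w≢v refl })
        v-old : ∀ {y} → E H v y → Cdi (ψ v y) → φ v y ≡ ψ v y
        v-old e r = old (keepψ h) (here refl) (vA e) r
        v-off : ∀ {y} → ¬ Pair z w v y
        v-off fwd = v≢z refl
        v-off bwd = w≢v refl
        z-old : ∀ {y} → E A z y → Cdi (ψ z y) → φ z y ≡ ψ z y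
        z-old e r = old (keepψ h) (there (here refl)) e r
        okB : Ok 5 B ψ₁
        okB = upd-ok z≢w (Ok-⊆ B∖ (okψ′ h)) i<5
          (λ { (see y (mkE (mkE (e , p) , p′)) r) → p (subst (Pair v z z) (proper (okφ l) (E-sym (evz l)) (∖-⊆ e) (trans zv (sym (trans (z-old (mkE (∖-⊆ e , p′)) (inj₂ r)) r)))) bwd) })
          (λ { (see y e r) → noi h (see y (B∖ e) r) })
        v-misses : ∀ {x} → In c d x → ∀ {y} → E (H ∖ (u , v)) v y → ψ v y ≢ x
        v-misses x∈ {y} e r = mis l x∈ (see y e (trans (v-old (∖-⊆ e) (inj₁ (subst (In c d) (sym r) x∈))) r))
        z-λ : Misses A ψ z λ₀
        z-λ (see y (mkE (e , p)) r) = p (subst (Pair z w z) (proper (okφ l) ezw e (sym (trans (z-old (mkE (e , p)) (inj₁ (subst (In c d) (sym r) λ∈))) r))) fwd)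
        okψ₂ : Ok 5 (H ∖ (u , v)) ψ₂
        okψ₂ = upd-ok v≢z okB (in<5 λ∈)
          (λ { (see y e r) → v-misses λ∈ (∖-⊆ e) (trans (sym (upd-off ψ v-off)) r) })
          (λ s → case sees-split {G = B} {v = z} {w} s of λ where
             (inj₁ (_ , r)) → in≢i λ∈ r
             (inj₂ (see y e r)) → z-λ (see y (B∖ e) r))
        P-off : ∀ {x y} → x ∈ P → ¬ Pair z w x y
        P-off p fwd = z∉ l p
        P-off p bwd = w∉ p
        ψ₂-off : ∀ {x y} → x ∈ P → ψ₂ x y ≡ ψ x y
        ψ₂-off p = trans (upd-off ψ₁ (not-vz p)) (upd-off ψ (P-off p))
        keepψ₂ : Keep (H ∖ (u , v)) P φ ψ₂
        keepψ₂ = mkKeep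
          (λ p e r → trans (old (keepψ h) (there (there p)) (mkE (∖-⊆ e , P-off p)) (subst Cdi (ψ₂-off p) r)) (sym (ψ₂-off p)))
          (λ p p′ e r → trans (fix (keepψ h) (there (there p)) (there (there p′)) (mkE (∖-⊆ e , P-off p)) r) (sym (ψ₂-off p)))
        noi₂ : Misses (H ∖ (u , v)) ψ₂ v i
        noi₂ s = case sees-split {G = H ∖ (u , v)} {v = v} {z} s of λ where
          (inj₁ (_ , r)) → in≢i λ∈ (sym r)
          (inj₂ (see y (mkE (e , p)) r)) → let r′ = trans (sym (upd-off ψ v-off)) r in
             p (subst (Pair v z v) (proper (okφ l) (evz l) (∖-⊆ e) (trans (iz l) (sym (trans (v-old (∖-⊆ e) (inj₂ r′)) r′)))) fwd)
        avoid₂ : E H u v → Dec (λ₀ ≡ φ u v) → λ₀ ≡ φ u v ⊎ Misses (H ∖ (u , v)) ψ₂ v (φ u v)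
        avoid₂ e (yes r) = inj₁ r
        avoid₂ e (no r) = inj₂ λ s → case sees-split {G = H ∖ (u , v)} {v = v} {z} s of λ where
          (inj₁ (_ , r′)) → r (sym r′)
          (inj₂ (see y f r′)) → v-misses (proj₁ (ucd l e)) (∖-⊆ f) (trans (sym (upd-off ψ v-off)) r′)
        through : ∀ {θ⁻} → Ok 5 H θ⁻ → Conn φ θ⁻ → Keep H (v ∷ P) φ θ⁻ → K λ₀ i A θ⁻ ψ → θ⁻ z w ≡ λ₀ → θ⁻ v z ≡ i → Half φ u v ψ₂ P
        through {θ⁻} ok cn kp k zw vz = record { κ = λ₀ ; κ∈ = λ∈ ; θ = θ⁻ ; okθ = ok ; connθ = cn ; keepθ = kp ; okψ′ = okψ₂
          ; mvψ = K-⊆ ∖-⊆ (K-upd {w = z} (K-⊆ ∖-⊆ (K-upd k (symm ok ezw) (inj₂ (inj₁ zw , inj₂ refl)))) (symm ok (evz l)) (inj₂ (inj₂ vz , inj₁ refl)))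
          ; keepψ = keepψ₂ ; θi = λ _ → see z (evz l) vz ; noi = noi₂ ; avoid = λ e → avoid₂ e (λ₀ ℕ.≟ φ u v) }
        θ-zw : θ h z w ≡ λ₀
        θ-zw = sym (fix (keepθ h) (there (there (here refl))) (here refl) ezw (inj₁ λ∈))
        choose : κ h ≡ λ₀ ⊎ Misses A ψ w λ₀ → Half φ u v ψ₂ P
        -- The pending interchange already uses the colour of `zw`, so `zw` and `vz` simply join it.
        choose (inj₁ r) = through (okθ h) (connθ h)
          (keep-⊆ id (λ { (here x) → there (here x) ; (there x) → there (there (there x)) }) (keepθ h))
          (subst (λ t → K t i A (θ h) ψ) r (mvψ h)) θ-zw
          (trans (sym (fix (keepθ h) (there (here refl)) (there (there (here refl))) (evz l) (inj₂ (iz l)))) (iz l))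
        -- Otherwise `zw` can be put back with its own colour. This completes the pending
        -- interchange, and a new one with that colour and `i` begins.
        choose (inj₂ mw) = through ok⁻ (conn-trans (okθ h) (connθ h) (conn-seen (in<5 (κ∈ h)) i<5 (okθ h) ok⁻ k⁻ (inj₂ refl)
            (see _ ex (trans (sym (fix (keepθ h) (there x₁∈) (there x₂∈) ex (inj₂ ix))) ix)))) kp⁻
            (mkK λ { (mkE (e , p)) → inj₁ (upd-off ψ p) }) (upd-on ψ {z} {w} fwd)
            (trans (upd-off ψ v-off) (trans (sym (fix (keepψ h) (here refl) (there (here refl)) (vA (evz l)) (inj₂ (iz l)))) (iz l)))
          where
          θ⁻ : Col
          θ⁻ = upd ψ z w λ₀
          ok⁻ : Ok 5 H θ⁻
          ok⁻ = upd-ok z≢w (okψ′ h) (in<5 λ∈) z-λ mw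
          k⁻ : K (κ h) i H (θ h) θ⁻
          k⁻ = K-upd (mvψ h) (symm (okθ h) ezw) (inj₁ θ-zw)
          off′ : ∀ {x y} → x ∈ v ∷ P → ¬ Pair z w x y
          off′ (here refl) = v-off
          off′ (there p) = P-off p
          up : ∀ {x} → x ∈ v ∷ P → x ∈ v ∷ z ∷ P
          up (here r) = here r
          up (there r) = there (there r)
          kp⁻ : Keep H (v ∷ P) φ θ⁻
          kp⁻ = mkKeep
            (λ p e r → trans (old (keepψ h) (up p) (mkE (e , off′ p)) (subst Cdi (upd-off ψ (off′ p)) r)) (sym (upd-off ψ (off′ p))))
            (λ p p′ e r → trans (fix (keepψ h) (up p) (up p′) (mkE (e , off′ p)) r) (sym (upd-off ψ (off′ p))))

unique-length-≤n : ∀ {n} (vs : List (Fin n)) → Unique vs → length vs ≤ n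
unique-length-≤n {n} vs u = ≤-trans (unique-⊆-length vs (allFin n) u (λ {x} _ → ∈-allFin x)) (≤-reflexive (length-tabulate {n = n} id))

∉⇒All≢ : ∀ {A : Set} {x : A} {xs} → x ∉ xs → All (x ≢_) xs
∉⇒All≢ x∉ = All.tabulate (λ { y∈ refl → x∉ y∈ })

-- Growing the alternating path and bypassing the interchange of c and d.

module Explore {n : ℕ} (G : Gph {n}) (q : Fin n) (deg : ∀ v → DegLe (G ⊖ q) v 4)
               (degq : ∀ {y} → E G q y → DegLe (G ⊖ q) y 3) {y₁ y₂ y₃ : Fin n} (en : Vertex.Enum G q y₁ y₂ y₃)
               {c d i : ℕ} (c<5 : c < 5) (d<5 : d < 5) (i<5 : i < 5) (cd : c ≢ d) (i∉ : ¬ In c d i) where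
  open Reps G q deg degq en
  open Caterpillar G q deg degq en c<5 d<5 i<5 cd i∉
  open Half
  open Lev

  module _ {φ φ′ : Col {n}} (ne : NE c d φ) (ok : Ok 5 H φ) (ok′ : Ok 5 H φ′) (k : K c d H φ φ′) where

    private
      NE-K : NE c d φ′
      NE-K = mkNE c<5 d<5 cd (λ e → proj₁ (un e)) (λ e → proj₂ (un e)) (λ e x< x∉ → K-sees k x∉ (rest ne e x< x∉))
        where
        un : ∀ {y} → E G q y → Misses H φ′ y c × Misses H φ′ y d
        un {y} e = unseen-pair (K-status ok ok′ k y) (noc ne e) (nod ne e)

    -- The same shift is performed on φ and on φ′, so that the two results again differ only by an
    -- interchange of `c` and `d`.
    record Both (u v : Fin n) (P : List (Fin n)) : Set where
      constructor mkBoth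
      field
        {bψ bψ′} : Col
        half     : Half φ u v bψ P
        half′    : Half φ′ u v bψ′ P
        bK       : K c d (H ∖ (u , v)) bψ bψ′
    open Both

    -- The closure conditions on `P` keep the path from running into itself: a further vertex that
    -- misses `i`, `c` or `d` cannot be in `P`.
    record Inv (u v z : Fin n) (P : List (Fin n)) (x₁ x₂ : Fin n) : Set where
      field
        lev  : Lev φ u v z P
        uniq : Unique P
        cl-i : ∀ {x y} → x ∈ P → E H x y → φ x y ≡ i → y ∈ P
        cl-λ : ∀ {x} → x ∈ P → (∀ {a} → In c d a → Sees H φ x a) ⊎ (∀ {y} → E H x y → In c d (φ x y) → y ∈ P)
        see-i : ∀ {x} → x ∈ P → Sees H φ x i
        x₁∈  : x₁ ∈ v ∷ z ∷ P
        x₂∈  : x₂ ∈ v ∷ z ∷ P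
        x₁≡  : x₁ ≡ y₁
        x₁x₂ : E H x₁ x₂
        x-i  : φ x₁ x₂ ≡ i

    module At {u v z P x₁ x₂} (inv : Inv u v z P x₁ x₂)
              (rec : ∀ {w z′} → Inv z w z′ (v ∷ z ∷ P) x₁ x₂ → Both z w (v ∷ z ∷ P)) where
      open Inv inv
      open Side lev using (v≢z; zv; not-vz)

      lev′ : Lev φ′ u v z P
      lev′ = lev-K lev ok′ k

      finish : ∀ {a} → In c d a → Misses H φ z a → Both u v P
      finish {a} a∈ m with transfer-in c<5 d<5 ok ok′ k a∈ (in<5 a∈ , m)
      ... | a′ , a′∈ , _ , m′ = mkBoth (Side.last lev a∈ m) (Side.last lev′ a′∈ m′) (K-⊆ ∖-⊆ (K-upd₂ (K-⊆ ∖-⊆ k) (inj₂ (a∈ , a′∈))))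

      module _ {w : Fin n} (ezw : E H z w) (λ∈ : In c d (φ z w)) where

        λ∈′ : In c d (φ′ z w)
        λ∈′ = K-in k ezw λ∈

        rewind : w ∉ P → (h : Both z w (v ∷ z ∷ P)) → Both u v P
        rewind w∉ h = mkBoth (Side₂.back lev ezw λ∈ x₁∈ x₂∈ x₁≡ x₁x₂ x-i w∉ (half h))
          (Side₂.back lev′ ezw λ∈′ x₁∈ x₂∈ x₁≡ x₁x₂ (trans (sym (K-out k x₁x₂ (i∉ ∘ subst (In c d) x-i))) x-i) w∉ (half′ h))
          (K-⊆ ∖-⊆ (K-upd₂ {w = z} (K-⊆ ∖-⊆ (K-upd₂ {w = w} (bK h) same)) (inj₂ (λ∈ , λ∈′))))

        w-not-P : (¬ Sees H φ w i) ⊎ (∃ λ a → In c d a × Misses H φ w a) → w ∉ P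
        w-not-P (inj₁ m) w∈ = m (see-i w∈)
        w-not-P (inj₂ (a , a∈ , m)) w∈ with cl-λ w∈
        ... | inj₂ f = z∉ lev (f (E-sym ezw) (subst (In c d) (symm ok ezw) λ∈))
        ... | inj₁ f = m (f a∈)

        -- The other way for a path to end: nothing has to be shifted beyond `w`, and `zw` can take
        -- `i` directly.
        miss-i : Misses H φ w i → Both u v P
        miss-i m = rewind (w-not-P (inj₁ m)) (mkBoth (triv ok m λ∈ (λ { refl → rest ne (e₁ en) i<5 i∉ })) (triv ok′ (K-misses k i∉ m) λ∈′ (λ { refl → rest NE-K (e₁ en) i<5 i∉ })) (K-⊆ ∖-⊆ k))
          where
          triv : ∀ {χ} → Ok 5 H χ → Misses H χ w i → In c d (χ z w) → (w ≡ y₁ → Sees H χ w i) → Half χ z w χ (v ∷ z ∷ P)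
          triv {χ} okχ mχ χ∈ r = record { θi = r ; κ = χ z w ; κ∈ = χ∈ ; θ = χ ; okθ = okχ ; connθ = conn-refl okχ ; keepθ = keep-refl
            ; okψ′ = Ok-⊆ ∖-⊆ okχ ; mvψ = K-refl ; keepψ = keep-refl ; noi = mχ ∘ sees-sub ; avoid = λ _ → inj₁ refl }

        -- Since `w` lacks one of `c`, `d`, it meets the pair through `zw` alone; the path goes on
        -- along `zw` and the `i`-edge at `w`.
        continue : ∀ {a} → (∀ {a} → In c d a → Sees H φ z a) → In c d a → Misses H φ w a → Sees H φ w i → Both u v P
        continue {a} zcd a∈ ma (see z′ e r) = rewind w∉ (rec record
            { lev = record { okφ = ok ; evz = e ; iz = r ; mis = mis-w ; ucd = λ _ → λ∈ , there (here refl) ; v∉ = w∉P′ ; z∉ = λ z′∈ → w∉P′ (cl-i′ z′∈ (E-sym e) (trans (sym (symm ok e)) r)) }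
            ; uniq = ((v≢z ∷ ∉⇒All≢ (v∉ lev)) ∷ ∉⇒All≢ (z∉ lev) ∷ uniq)
            ; cl-i = cl-i′
            ; cl-λ = λ { (here refl) → inj₂ (λ {y} f y∈ → v-nbr f y∈) ; (there (here refl)) → inj₁ zcd ; (there (there p)) → Sum.map₂ (λ g f y∈ → there (there (g f y∈))) (cl-λ p) }
            ; see-i = λ { (here refl) → see z (evz lev) (iz lev) ; (there (here refl)) → see v (E-sym (evz lev)) zv ; (there (there p)) → see-i p }
            ; x₁∈ = there (there x₁∈) ; x₂∈ = there (there x₂∈) ; x₁≡ = x₁≡ ; x₁x₂ = x₁x₂ ; x-i = x-i })
          where
          w∉ : w ∉ P
          w∉ = w-not-P (inj₂ (a , a∈ , ma))
          w∉P′ : w ∉ v ∷ z ∷ P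
          w∉P′ (here refl) = i∉ (subst (In c d) zv λ∈)
          w∉P′ (there (here refl)) = E-irr ezw
          w∉P′ (there (there p)) = w∉ p
          cl-i′ : ∀ {x y} → x ∈ v ∷ z ∷ P → E H x y → φ x y ≡ i → y ∈ v ∷ z ∷ P
          cl-i′ (here refl) f r = there (here (proper ok f (evz lev) (trans r (sym (iz lev)))))
          cl-i′ (there (here refl)) f r = here (proper ok f (E-sym (evz lev)) (trans r (sym zv)))
          cl-i′ (there (there p)) f r = there (there (cl-i p f r))
          v-nbr : ∀ {y} → E H v y → In c d (φ v y) → y ∈ v ∷ z ∷ P
          v-nbr {y} f y∈ with pair? u v v y
          ... | no p = ⊥-elim (mis lev y∈ (see y (mkE (f , p)) refl))
          ... | yes fwd = ⊥-elim (E-irr f)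
          ... | yes bwd = there (there (proj₂ (ucd lev (E-sym f))))
          wz : φ w z ≡ φ z w
          wz = sym (symm ok ezw)
          mis-w : ∀ {x} → In c d x → Misses (H ∖ (z , w)) φ w x
          mis-w {x} x∈ (see y (mkE (f , p)) r) = p (subst (Pair z w w) (proper ok (E-sym ezw) f (trans wz (trans λ≡x (sym r)))) bwd)
            where
            a≢x : a ≢ x
            a≢x refl = ma (see y f r)
            λ≡x : φ z w ≡ x
            λ≡x with in-third a∈ x∈ a≢x λ∈
            ... | inj₁ z≡ = ⊥-elim (ma (see z (E-sym ezw) (trans wz z≡)))
            ... | inj₂ z≡ = z≡

        Stuck : Set
        Stuck = ∃ λ o → o < 5 × ¬ In c d o × o ≢ i × Misses H φ w o × Sees H φ z o

        -- Every vertex misses a colour. At `w` a missing `i`, `c` or `d` ends or prolongs the path,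
        -- and another one helps if `z` misses it as well.
        examine : (∀ {a} → In c d a → Sees H φ z a) → Both u v P ⊎ Stuck
        examine zcd = decide (sees? H φ w i) (one-missing ok (deg w))
          where
          decide : Dec (Sees H φ w i) → (∃ λ o → o < 5 × Misses H φ w o) → Both u v P ⊎ Stuck
          decide (no m) _ = inj₁ (miss-i m)
          decide (yes s) (o , o< , mw) with in? c d o
          ... | yes o∈ = inj₁ (continue zcd o∈ mw s)
          ... | no o∉ with sees? H φ z o
          ...   | yes sz = inj₂ (o , o< , o∉ , (λ { refl → mw s }) , mw , sz)
          ...   | no mz = inj₁ (mkBoth
                    (Side₂.free lev ezw λ∈ o< o∉ (λ { refl → mw s }) mz mw (rest ne (e₁ en) o< o∉))
                    (Side₂.free lev′ ezw λ∈′ o< o∉ (λ { refl → mw s }) (K-misses k o∉ mz) (K-misses k o∉ mw) (rest NE-K (e₁ en) o< o∉))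
                    (K-⊆ ∖-⊆ (K-upd₂ {w = z} (K-⊆ ∖-⊆ (K-upd₂ {w = w} (K-⊆ ∖-⊆ k) same)) (inj₂ (λ∈ , λ∈′)))))

      -- z misses m, and both its neighbours along c and d miss o: an (m,o)-interchange at z makes z and one of them miss o
      both-stuck : ∀ {m w w′ o} → m < 5 → ¬ In c d m → m ≢ i → Misses H φ z m → E H z w → In c d (φ z w) → E H z w′ → In c d (φ z w′) → w ≢ w′ →
                   o < 5 → ¬ In c d o → o ≢ i → m ≢ o → Misses H φ w o → Misses H φ w′ o → Both u v P
      both-stuck {m} {w} {w′} {o} m< m∉ m≢i mz ezw λ∈ ezw′ λ∈′ w≢w′ o< o∉ o≢i m≢o mw mw′ = pick (chRest ch w) (chRest ch w′)
        where
        ch : Chain 5 H φ m o z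
        ch = chain ok m< o< m≢o mz
        φ₁ : Col
        φ₁ = chCol ch
        k₁ : K m o H φ φ₁
        k₁ = chMove ch
        disj : ∀ {y} → In m o y → ¬ In c d y
        disj (inj₁ refl) = m∉
        disj (inj₂ refl) = o∉
        -- The preparation avoids `c` and `d`, so it is repeated on φ′ as the fourth corner of the
        -- square, and the two copies stay in step.
        open Comb {G = H} (λ i j → disj j i) ok ok′ (chOk ch) k k₁
        mo≢ : ∀ {y} → Cdi y → ¬ In m o y
        mo≢ (inj₁ y∈) j = disj j y∈
        mo≢ (inj₂ refl) (inj₁ z) = m≢i (sym z)
        mo≢ (inj₂ refl) (inj₂ z) = o≢i (sym z)
        kp : ∀ {α β : Col} → K m o H α β → Keep H (v ∷ P) α β
        kp kk = mkKeep (λ _ e r → sym (K-out (K-sym kk) e (mo≢ r))) (λ _ _ e r → K-out kk e (mo≢ r))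
        iz′ : ∀ {α β : Col} → K m o H α β → α v z ≡ i → β v z ≡ i
        iz′ kk r = trans (sym (K-out kk (evz lev) (mo≢ (inj₂ r)))) r
        l₁′ : Lev φ₁ u v z P
        l₁′ = lev-keep lev (chOk ch) (iz′ k₁ (iz lev)) (kp k₁)
        l₂′ : Lev comb u v z P
        l₂′ = lev-keep lev′ comb-ok (iz′ comb-px (iz lev′)) (kp comb-px)
        y₁mo : ∀ {χ χ₁ : Col} → NE c d χ → Ok 5 H χ → Ok 5 H χ₁ → K m o H χ χ₁ → Sees H χ₁ y₁ o
        y₁mo ne okχ ok₁ kk = proj₂ (both-seen okχ ok₁ m≢o kk (rest ne (e₁ en) m< m∉) (rest ne (e₁ en) o< o∉))
        conn₁ : ∀ {χ χ₁ : Col} → NE c d χ → Ok 5 H χ → Ok 5 H χ₁ → K m o H χ χ₁ → Conn χ χ₁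
        conn₁ ne okχ ok₁ kk = conn-seen m< o< okχ ok₁ kk (inj₂ refl) (rest ne (e₁ en) o< o∉)
        mz₁ : Misses H φ₁ z o
        mz₁ s = mz (b⇐a (chStart ch) s)
        go : ∀ {w} → E H z w → In c d (φ z w) → Misses H φ w o → Same m o H φ φ₁ w → Both u v P
        go {w} ezw λ∈ mw s = mkBoth
            (precompose lev (chOk ch) (conn₁ ne ok (chOk ch) k₁) (kp k₁)
              (Side₂.free l₁′ ezw in₁ o< o∉ o≢i mz₁ mw₁ (y₁mo ne ok (chOk ch) k₁)))
            (precompose lev′ comb-ok (conn₁ NE-K ok′ comb-ok comb-px) (kp comb-px)
              (Side₂.free l₂′ ezw in₂ o< o∉ o≢i (K-misses comb-ab o∉ mz₁) (K-misses comb-ab o∉ mw₁) (y₁mo NE-K ok′ comb-ok comb-px)))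
            (K-⊆ ∖-⊆ (K-upd₂ {w = z} (K-⊆ ∖-⊆ (K-upd₂ {w = w} (K-⊆ ∖-⊆ comb-ab) same)) (inj₂ (in₁ , in₂))))
          where
          mw₁ : Misses H φ₁ w o
          mw₁ = mw ∘ same⇐ s (inj₂ refl)
          in₁ : In c d (φ₁ z w)
          in₁ = subst (In c d) (K-out k₁ ezw (mo≢ (inj₁ λ∈))) λ∈
          in₂ : In c d (comb z w)
          in₂ = K-in comb-ab ezw in₁
        rest-of : ∀ {w} → E H z w → w ≡ z ⊎ w ≡ chEnd ch ⊎ Same m o H φ φ₁ w → w ≡ chEnd ch ⊎ Same m o H φ φ₁ w
        rest-of e (inj₁ refl) = ⊥-elim (E-irr e)
        rest-of e (inj₂ r) = r
        pick : w ≡ z ⊎ w ≡ chEnd ch ⊎ Same m o H φ φ₁ w → w′ ≡ z ⊎ w′ ≡ chEnd ch ⊎ Same m o H φ φ₁ w′ → Both u v P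
        pick r r′ with rest-of ezw r | rest-of ezw′ r′
        ... | inj₂ s | _ = go ezw λ∈ mw s
        ... | inj₁ _ | inj₂ s = go ezw′ λ∈′ mw′ s
        ... | inj₁ x | inj₁ x′ = ⊥-elim (w≢w′ (trans x (sym x′)))

      at-level : Both u v P
      at-level = decide (sees? H φ z c) (sees? H φ z d) (one-missing ok (deg z))
        where
        decide : Dec (Sees H φ z c) → Dec (Sees H φ z d) → (∃ λ m → m < 5 × Misses H φ z m) → Both u v P
        decide (no m) _ _ = finish (inj₁ refl) m
        decide (yes _) (no m) _ = finish (inj₂ refl) m
        decide (yes (see w e r)) (yes (see w′ e′ r′)) (m , m< , mz) = combine (examine e λ∈ zcd) (examine e′ μ∈ zcd)
          where
          λ∈ : In c d (φ z w)
          λ∈ = inj₁ r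
          μ∈ : In c d (φ z w′)
          μ∈ = inj₂ r′
          zcd : ∀ {a} → In c d a → Sees H φ z a
          zcd (inj₁ refl) = see w e r
          zcd (inj₂ refl) = see w′ e′ r′
          m∉ : ¬ In c d m
          m∉ = mz ∘ zcd
          m≢i : m ≢ i
          m≢i refl = mz (see v (E-sym (evz lev)) zv)
          combine : Both u v P ⊎ Stuck e λ∈ → Both u v P ⊎ Stuck e′ μ∈ → Both u v P
          combine (inj₁ b) _ = b
          combine _ (inj₁ b) = b
          combine (inj₂ (o , o< , o∉ , o≢i , mw , sz)) (inj₂ (o′ , o′< , o′∉ , o′≢i , mw′ , sz′)) =
            both-stuck m< m∉ m≢i mz e λ∈ e′ μ∈ (λ { refl → cd (trans (sym r) r′) }) o< o∉ o≢i (≢-sym (ne-m sz)) mw (subst (Misses H φ w′) same-o mw′)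
            where
            ne-m : ∀ {x} → Sees H φ z x → x ≢ m
            ne-m s refl = mz s
            -- The colours `c`, `d`, `i`, `m`, `o` are all five, and `o′` is none of the first four.
            same-o : o′ ≡ o
            same-o with five c<5 d<5 i<5 m< o< (≢-sym cd , _) (i∉ ∘ inj₁ , i∉ ∘ inj₂ , _) (m∉ ∘ inj₁ , m∉ ∘ inj₂ , m≢i , _)
                             (o∉ ∘ inj₁ , o∉ ∘ inj₂ , o≢i , ne-m sz , _) o′<
            ... | inj₁ x = ⊥-elim (o′∉ (inj₁ x))
            ... | inj₂ (inj₁ x) = ⊥-elim (o′∉ (inj₂ x))
            ... | inj₂ (inj₂ (inj₁ x)) = ⊥-elim (o′≢i x)
            ... | inj₂ (inj₂ (inj₂ (inj₁ x))) = ⊥-elim (ne-m sz′ x)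
            ... | inj₂ (inj₂ (inj₂ (inj₂ x))) = x

    explore : ∀ fuel {u v z P x₁ x₂} → n < fuel + length P → Inv u v z P x₁ x₂ → Both u v P
    explore zero {P = P} lt inv = ⊥-elim (<⇒≱ lt (unique-length-≤n P (Inv.uniq inv)))
    explore (suc f) {P = P} lt inv = At.at-level inv λ inv′ →
      explore f (≤-trans lt (≤-trans (≤-reflexive (sym (+-suc f (length P)))) (+-monoʳ-≤ f (n≤1+n (suc (length P)))))) inv′

    E-∖self : ∀ {y x z} → E H x z → E (H ∖ (y , y)) x z
    E-∖self e = mkE (e , λ { fwd → E-irr e ; bwd → E-irr e })

    -- After the shift `y₁` sees κ, which is `c` or `d`, in place of `i`, so the interchange between
    -- the two shifted colourings is harmless.
    swap-conn : Conn φ φ′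
    swap-conn with rest ne (e₁ en) i<5 i∉
    -- With both `u` and `v` equal to `y₁` the edge left out does not exist, and the shifted
    -- colourings are colourings of all of `H`.
    ... | see z e r = conclude (explore (suc n) {u = y₁} {y₁} {z} {[]} {y₁} {z} (s≤s (≤-reflexive (sym (+-identityʳ n)))) record
        { lev = record { okφ = ok ; evz = e ; iz = r ; mis = λ x∈ s → unlisted ne (e₁ en) x∈ (sees-sub s) ; ucd = λ f → ⊥-elim (E-irr f) ; v∉ = λ () ; z∉ = λ () }
        ; uniq = [] ; cl-i = λ () ; cl-λ = λ () ; see-i = λ () ; x₁∈ = here refl ; x₂∈ = there (here refl) ; x₁≡ = refl ; x₁x₂ = e ; x-i = r })
      where
      conclude : Both y₁ y₁ [] → Conn φ φ′
      conclude (mkBoth {ψ} {ψ′} h h′ kk) = conn-trans okψ₁ (side h okψ₁) (conn-trans okψ₂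
          (conn-seen c<5 d<5 okψ₁ okψ₂ (K-⊆ E-∖self kk) (κ∈ h) (sees-cd h)) (conn-sym (side h′ okψ₂)))
        where
        okψ₁ : Ok 5 H ψ
        okψ₁ = Ok-⊆ E-∖self (okψ′ h)
        okψ₂ : Ok 5 H ψ′
        okψ₂ = Ok-⊆ E-∖self (okψ′ h′)
        side : ∀ {χ ψ} → Half χ y₁ y₁ ψ [] → Ok 5 H ψ → Conn χ ψ
        side h okψ₁ = conn-trans (okθ h) (connθ h) (conn-seen (in<5 (κ∈ h)) i<5 (okθ h) okψ₁ (K-⊆ E-∖self (mvψ h)) (inj₂ refl) (θi h refl))
        sees-cd : ∀ {χ ψ} (h : Half χ y₁ y₁ ψ []) → Sees H ψ y₁ (κ h)
        sees-cd h with θi h refl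
        ... | see y f r with K-in (mvψ h) (E-∖self f) (inj₂ r)
        ...   | inj₁ x = see y f x
        ...   | inj₂ x = ⊥-elim (noi h (see y (E-∖self f) x))

-- Putting back a vertex of degree at most three.

module _ {n : ℕ} where

  complete-cong : ∀ {p} {G J : Gph {n}} → (∀ {x y} → E G x y → E J x y) → (∀ {x y} → E J x y → E G x y) → Complete p G → Complete p J
  complete-cong f g comp ok ok′ = Star.map (λ (o , o′ , a , b , k) → Ok-⊆ g o , Ok-⊆ g o′ , a , b , K-⊆ g k) (comp (Ok-⊆ f ok) (Ok-⊆ f ok′))

  three-degree : {G : Gph {n}} {q : Fin n} → (∀ v → DegLe (G ⊖ q) v 4) → (∀ {y} → E G q y → DegLe (G ⊖ q) y 3) →
                 ∀ {y₁ y₂ y₃} → Vertex.Enum G q y₁ y₂ y₃ → Complete 5 (G ⊖ q) → Complete 5 G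
  three-degree {G} {q} deg degq {y₁} {y₂} {y₃} en comp {ρ} {ρ′} ok ok′ =
    let okφ , s , ag = split ok ; okφ′ , s′ , ag′ = split ok′ in
    conn (walk okφ (comp okφ okφ′)) (ext s ag) (ext s′ ag′)
    where
    open Reps G q deg degq en
    step : ∀ {φ ψ a b} → a < 5 → b < 5 → Ok 5 H φ → Ok 5 H ψ → K a b H φ ψ → Conn φ ψ
    step {φ} {ψ} {a} {b} a< b< ok ok′ k = decide (dichotomy ok)
      where
      decide : (∃ λ σ → SDR φ σ) ⊎ (∃ λ c → ∃ λ d → NE c d φ) → Conn φ ψ
      decide (inj₁ (_ , s)) = conn-good a< b< ok ok′ k (λ ne → ⊥-elim (NE-no-sdr ne s))
      decide (inj₂ (c , d , ne)) = cases (in? a b c) (in? a b d) (fresh# {5} (c ∷ d ∷ []) (s≤s (s≤s (s≤s z≤n))))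
        where
        cases : Dec (In a b c) → Dec (In a b d) → (∃ λ i → i < 5 × i # c ∷ d ∷ []) → Conn φ ψ
        cases (no z) _ _ = conn-good a< b< ok ok′ k (λ ne′ → c , NE-pair ne′ ne (inj₁ refl) , z)
        cases (yes _) (no z) _ = conn-good a< b< ok ok′ k (λ ne′ → d , NE-pair ne′ ne (inj₂ refl) , z)
        cases (yes x) (yes y) (i , i< , ic , id′ , _) = Explore.swap-conn G q deg degq en (c< ne) (d< ne) i< (c≢d ne) [ ic , id′ ]′ ne ok ok′
          (mkK λ e → Sum.map₂ (λ (p , r) → in-third x y (c≢d ne) p , in-third x y (c≢d ne) r) (at k e))
    walk : ∀ {φ ψ} → Ok 5 H φ → Kempe 5 H φ ψ → Conn φ ψ
    walk ok ε = conn-refl ok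
    walk _ ((o , o′ , a , b , k) ◅ r) with K-bounded (s≤s z≤n) o o′ k
    ... | _ , _ , a< , b< , k′ = conn-trans o′ (step a< b< o o′ k′) (walk o′ r)

  -- The edge `vw` accompanies each interchange: an unaffected colour stays, an affected one follows
  -- into another affected common colour. If the common colour after the step is unaffected, it was
  -- free before, and `vw` takes it in advance.
  add-edge : ∀ {p} {G : Gph {n}} {v w} → 0 < p → E G v w → (∀ {φ} → Ok p (G ∖ (v , w)) φ → ∃ λ m → m < p × Misses (G ∖ (v , w)) φ v m × Misses (G ∖ (v , w)) φ w m) →
             Complete p (G ∖ (v , w)) → Complete p G
  add-edge {p} {G} {v} {w} 0<p e common comp {ρ} {ρ′} ok ok′ =
      agree-kempe ok (upd-self ok e) ◅◅ walk (at-edge ok) (comp (Ok-⊆ ∖-⊆ ok) (Ok-⊆ ∖-⊆ ok′)) (at-edge ok′)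
      ◅◅ Kempe-sym (agree-kempe ok′ (upd-self ok′ e))
    where
    J : Gph
    J = G ∖ (v , w)
    record Free (φ : Col) (m : ℕ) : Set where
      constructor mkFree
      field
        okJ : Ok p J φ
        m<  : m < p
        mv₁ : Misses J φ v m
        mw₁ : Misses J φ w m
    open Free
    at-edge : ∀ {ρ} → Ok p G ρ → Free ρ (ρ v w)
    at-edge ok = mkFree (Ok-⊆ ∖-⊆ ok) (bound ok e)
      (λ { (see y (mkE (f , r)) z) → r (subst (Pair v w v) (proper ok e f (sym z)) fwd) })
      (λ { (see y (mkE (f , r)) z) → r (subst (Pair v w w) (proper ok (E-sym e) f (trans (sym (symm ok e)) (sym z))) bwd) })
    full : ∀ {φ m} → Free φ m → Ok p G (upd φ v w m)
    full x = upd-ok (E-≢ e) (okJ x) (m< x) (mv₁ x) (mw₁ x)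
    recol : ∀ {φ m m′} → Free φ m → Free φ m′ → Kempe p G (upd φ v w m) (upd φ v w m′)
    recol {m = m} {m′} x x′ = step-kempe {a = m} {m′} (full x) (full x′) (K-upd₂ K-refl (inj₂ (inj₁ refl , inj₂ refl)))
    move₁ : ∀ {φ ψ a b m m′} → K a b J φ ψ → Rel a b m m′ → Free φ m → Free ψ m′ → Kempe p G (upd φ v w m) (upd ψ v w m′)
    move₁ k r x x′ = step-kempe (full x) (full x′) (K-upd₂ k r)
    walk : ∀ {φ ψ m m′} → Free φ m → Kempe p J φ ψ → Free ψ m′ → Kempe p G (upd φ v w m) (upd ψ v w m′)
    walk x ε x′ = recol x x′
    walk {m = m} x ((o , o′ , a , b , k) ◅ r) x′ with common o′
    ... | m₂ , m₂< , mv₂ , mw₂ with in? a b m | in? a b m₂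
    ...   | yes i | yes j = let y = mkFree o′ m₂< mv₂ mw₂ in move₁ k (inj₂ (i , j)) x y ◅◅ walk y r x′
    ...   | no i | _ = let y = mkFree o′ (m< x) (K-misses k i (mv₁ x)) (K-misses k i (mw₁ x)) in move₁ k same x y ◅◅ walk y r x′
    ...   | yes _ | no j = let y = mkFree o′ m₂< mv₂ mw₂ ; z = mkFree o m₂< (K-misses (K-sym k) j mv₂) (K-misses (K-sym k) j mw₂) in
                          recol x z ◅◅ move₁ k same z y ◅◅ walk y r x′

  degLe-⊆ : ∀ {G J : Gph {n}} {v k} → (∀ {x y} → E J x y → E G x y) → DegLe G v k → DegLe J v k
  degLe-⊆ f dg vs u es = dg vs u (All.map f es)

  degLe-drop : ∀ {G J : Gph {n}} {v w k} → (∀ {x y} → E J x y → E G x y) → E G v w → ¬ E J v w → DegLe G v (suc k) → DegLe J v k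
  degLe-drop {J = J} {v} {w} f e ¬e dg vs u es = ≤-pred (dg (w ∷ vs) (∉⇒All≢ (λ w∈ → ¬e (All.lookup es w∈)) ∷ u) (e ∷ All.map f es))

  degLe-list : ∀ {G : Gph {n}} {v} (ns : List (Fin n)) → (∀ {y} → E G v y → y ∈ ns) → DegLe G v (length ns)
  degLe-list ns cov vs u es = unique-⊆-length vs ns u (λ x∈ → cov (All.lookup es x∈))

  -- The edges at `q` are added singly: the other end misses at least two colours while `q` sees at
  -- most one, so a common missing colour always exists.
  low-degree : ∀ {G : Gph {n}} {q} (ns : List (Fin n)) → length ns ≤ 2 → (∀ {y} → E G q y → y ∈ ns) → (∀ v → DegLe G v 4) →
               Complete 5 (G ⊖ q) → Complete 5 G
  low-degree {G} {q} [] _ cov deg comp = complete-cong ⊖-⊆ (λ e → mkE (e , (λ { refl → case cov e of λ () }) , (λ { refl → case cov (E-sym e) of λ () }))) comp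
  low-degree {G} {q} (y ∷ ns) len cov deg comp with E? G q y
  ... | no ¬e = low-degree ns (≤-trans (n≤1+n _) len) (λ e → case cov e of λ { (here refl) → ⊥-elim (¬e e) ; (there p) → p }) deg comp
  ... | yes e = add-edge (s≤s z≤n) e common
      (low-degree ns (≤-trans (n≤1+n _) len) (λ { (mkE (f , p)) → case cov f of λ { (here refl) → ⊥-elim (p fwd) ; (there r) → r } })
        (λ v → degLe-⊆ ∖-⊆ (deg v))
        (complete-cong (λ { (mkE (f , a , b)) → mkE (mkE (f , λ { fwd → a refl ; bwd → b refl }) , a , b) })
                       (λ { (mkE (mkE (f , _) , a , b)) → mkE (f , a , b) }) comp))
    where
    J : Gph
    J = G ∖ (q , y)
    degq : DegLe J q 1
    degq = degLe-drop ∖-⊆ e (λ { (mkE (_ , p)) → p fwd }) (λ vs u es → ≤-trans (degLe-list (y ∷ ns) cov vs u es) len)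
    degy : DegLe J y 3
    degy = degLe-drop ∖-⊆ (E-sym e) (λ { (mkE (_ , p)) → p bwd }) (deg y)
    common : ∀ {φ} → Ok 5 J φ → ∃ λ m → m < 5 × Misses J φ q m × Misses J φ y m
    common {φ} ok with two-missing {α = 0} ok degy (s≤s z≤n)
    ... | α , _ , α< , mα with two-missing ok degy α<
    ... | β , β≢α , β< , mβ with some-missing ok degq (α ∷ β ∷ []) ((≢-sym β≢α ∷ []) ∷ [] ∷ []) ≤-refl
    ... | x , here refl , m = x , α< , m , mα
    ... | x , there (here refl) , m = x , β< , m , mβ

  nbrs : (G : Gph {n}) → Fin n → List (Fin n)
  nbrs G q = filter (E? G q) (allFin n)

  ∈-nbrs : ∀ {G q y} → E G q y → y ∈ nbrs G q
  ∈-nbrs {G} {q} {y} e = ∈-filter⁺ (E? G q) (∈-allFin y) e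

  nbrs-∈ : ∀ {G q y} → y ∈ nbrs G q → E G q y
  nbrs-∈ {G} {q} y∈ = proj₂ (∈-filter⁻ (E? G q) {xs = allFin n} y∈)

  nbrs-unique : ∀ G q → Unique (nbrs G q)
  nbrs-unique G q = filter⁺ (E? G q) (allFin⁺ n)

  degree-3 : ∀ {G : Gph {n}} {q} → (∀ v → DegLe G v 4) → DegLe G q 3 → Complete 5 (G ⊖ q) → Complete 5 G
  degree-3 {G} {q} deg degq comp = split-list (nbrs G q) (nbrs-unique G q) (All.tabulate nbrs-∈) ∈-nbrs
    where
    split-list : (ns : List (Fin n)) → Unique ns → All (E G q) ns → (∀ {y} → E G q y → y ∈ ns) → Complete 5 G
    split-list [] _ _ cov = low-degree [] z≤n cov deg comp
    split-list (a ∷ []) _ _ cov = low-degree (a ∷ []) (s≤s z≤n) cov deg comp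
    split-list (a ∷ b ∷ []) _ _ cov = low-degree (a ∷ b ∷ []) (s≤s (s≤s z≤n)) cov deg comp
    split-list (a ∷ b ∷ c ∷ d ∷ ns) u es cov = ⊥-elim (case degq (a ∷ b ∷ c ∷ d ∷ ns) u es of λ { (s≤s (s≤s (s≤s ()))) })
    split-list (a ∷ b ∷ c ∷ []) ((ab ∷ ac ∷ []) ∷ (bc ∷ []) ∷ _) (ea ∷ eb ∷ ec ∷ []) cov =
      three-degree (λ v → degLe-⊆ ⊖-⊆ (deg v)) (λ {y} e → degLe-drop ⊖-⊆ (E-sym e) (λ { (mkE (_ , _ , p)) → p refl }) (deg y))
        (Vertex.mkEnum ab ac bc ea eb ec λ e → case cov e of λ
           { (here r) → inj₁ r ; (there (here r)) → inj₂ (inj₁ r) ; (there (there (here r))) → inj₂ (inj₂ r) }) comp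

-- Walks in the forest of big vertices; counting the ends of edges of the top colour.

module _ {n : ℕ} where

  record Big (G : Gph {n}) (v : Fin n) : Set where
    constructor mkBig
    field
      bigs  : List (Fin n)
      bigU  : Unique bigs
      bigE  : All (E G v) bigs
      big≥  : 5 ≤ length bigs

  NoCycle : Gph {n} → Set
  NoCycle G = ∀ x xs → 2 ≤ length xs → Unique (x ∷ xs) → All (Big G) (x ∷ xs) → Linked (E G) ((x ∷ xs) ++ [ x ]) → ⊥

  private
    prefix : ∀ {G : Gph {n}} {v w} y ys → w ∈ ys → Linked (E G) (y ∷ ys) → E G w v →
             ∃ λ zs → ∃ λ rest → 1 ≤ length zs × ys ≡ zs ++ rest × Linked (E G) ((y ∷ zs) ++ [ v ])
    prefix {w = w} y (_ ∷ ys) (here refl) (e ∷ _) f = w ∷ [] , ys , s≤s z≤n , refl , e ∷ f ∷ [-]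
    prefix y (y′ ∷ ys) (there w∈) (e ∷ l) f with prefix y′ ys w∈ l f
    ... | zs , rest , _ , refl , l′ = y′ ∷ zs , rest , s≤s z≤n , refl , e ∷ l′

    unique-++ˡ : ∀ {A : Set} (xs : List A) {ys} → Unique (xs ++ ys) → Unique xs
    unique-++ˡ [] _ = []
    unique-++ˡ (x ∷ xs) (p ∷ u) = ++⁻ˡ xs p ∷ unique-++ˡ xs u

  -- The stretch of the walk from `v` back to `w`, closed by `vw`, would be a cycle of big vertices.
  no-return : ∀ {G : Gph {n}} → NoCycle G → ∀ {v p rest w} → Unique (v ∷ p ∷ rest) → All (Big G) (v ∷ p ∷ rest) → Linked (E G) (v ∷ p ∷ rest) →
              E G v w → w ≢ p → w ∉ v ∷ p ∷ rest
  no-return nc u a l e w≢p (here refl) = E-irr e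
  no-return nc u a l e w≢p (there (here r)) = w≢p r
  no-return {G} nc {v} {p} {rest} {w} u a (e₁ ∷ l) e w≢p (there (there w∈)) with prefix {G} p rest w∈ l (E-sym e)
  ... | zs , rest′ , len , refl , l′ = nc v (p ∷ zs) (s≤s len) (unique-++ˡ (v ∷ p ∷ zs) u) (++⁻ˡ (v ∷ p ∷ zs) a) (e₁ ∷ l′)

  module _ (G : Gph {n}) (T : ℕ) where

    seers : Col → List (Fin n)
    seers f = filter (λ u → sees? G f u T) (allFin n)

    -- In a proper colouring this is twice the number of edges coloured `T`; it is the potential
    -- that fans lower.
    τ : Col → ℕ
    τ f = length (seers f)

    seers⁺ : ∀ {f u} → Sees G f u T → u ∈ seers f
    seers⁺ {f} {u} s = ∈-filter⁺ (λ u → sees? G f u T) (∈-allFin u) s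

    seers⁻ : ∀ {f u} → u ∈ seers f → Sees G f u T
    seers⁻ {f} u∈ = proj₂ (∈-filter⁻ (λ u → sees? G f u T) {xs = allFin n} u∈)

    seers-unique : ∀ f → Unique (seers f)
    seers-unique f = filter⁺ (λ u → sees? G f u T) (allFin⁺ n)

    without : Fin n → List (Fin n) → List (Fin n)
    without v = filter (λ u → ¬? (u Fin.≟ v))

    without-length : ∀ {v xs} → v ∈ xs → length (without v xs) < length xs
    without-length {v} {xs} v∈ = filter-notAll (λ u → ¬? (u Fin.≟ v)) xs (lose v∈ (λ z → z refl))

    τ-less : ∀ {f g v} → Sees G f v T → Misses G g v T → (∀ {u} → Sees G g u T → Sees G f u T) → τ g < τ f
    τ-less {f} {g} {v} s m sub = ≤-<-trans
      (unique-⊆-length (seers g) (without v (seers f)) (seers-unique g)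
        (λ u∈ → let su = seers⁻ u∈ in ∈-filter⁺ (λ u → ¬? (u Fin.≟ v)) (seers⁺ (sub su)) (λ { refl → m su })))
      (without-length (seers⁺ s))

    -- Made for chains: the first end loses `T`, and only the other end may gain it.
    τ-exchange : ∀ {f g v e} → Sees G f v T → Misses G g v T → (∀ u → u ≢ e → Sees G g u T → Sees G f u T) → τ g ≤ τ f
    τ-exchange {f} {g} {v} {e} s m sub = ≤-trans
      (unique-⊆-length (seers g) (e ∷ without v (seers f)) (seers-unique g) cover)
      (without-length (seers⁺ s))
      where
      cover : ∀ {u} → u ∈ seers g → u ∈ e ∷ without v (seers f)
      cover {u} u∈ with u Fin.≟ e
      ... | yes r = here r
      ... | no r = let su = seers⁻ u∈ in there (∈-filter⁺ (λ u → ¬? (u Fin.≟ v)) (seers⁺ (sub u r su)) (λ { refl → m su }))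

    τ-same : ∀ {f g} → (∀ {u} → Sees G g u T → Sees G f u T) → τ g ≤ τ f
    τ-same {f} {g} sub = unique-⊆-length (seers g) (seers f) (seers-unique g) (λ u∈ → seers⁺ (sub (seers⁻ u∈)))

-- Removing the top colour with Vizing fans
module Fournier {n : ℕ} (G : Gph {n}) (p : ℕ) (5≤p : 5 ≤ p) (deg : ∀ v → DegLe G v p) (nc : NoCycle G) where

  T : ℕ
  T = p

  OkT : Col {n} → Set
  OkT = Ok (suc p) G

  below : ∀ {f u v} → OkT f → E G u v → f u v ≢ T → f u v < p
  below ok e ne = ≤∧≢⇒< (≤-pred (bound ok e)) ne

  opaque
    T-misses : ∀ {f v} → OkT f → Sees G f v T → ∃ λ β → β < p × Misses G f v β
    T-misses {f} {v} ok s with some-missing ok (deg v) (upTo (suc p)) (upTo⁺ (suc p)) (≤-reflexive (sym (length-upTo (suc p))))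
    ... | x , x∈ , m = x , ≤∧≢⇒< (≤-pred (∈-upTo⁻ x∈)) (λ { refl → m s }) , m

    full? : ∀ {f} w → OkT f → (∃ λ α → α < p × Misses G f w α) ⊎ Big G w
    full? {f} w ok with All.all? (sees? G f w) (upTo p)
    ... | no ¬all = let x , x∈ , m = find (¬All⇒Any¬ (sees? G f w) (upTo p) ¬all) in inj₁ (x , ∈-upTo⁻ x∈ , m)
    ... | yes all with all-sees ok (upTo p) (upTo⁺ p) all
    ...   | vs , u , es , eq = inj₂ (mkBig vs u es (subst (5 ≤_) (sym (trans (sym (length-map (f w) vs)) (trans (cong length eq) (length-upTo p)))) 5≤p))

  Reduced : Col {n} → Set
  Reduced f = ∃ λ f′ → Kempe (suc p) G f f′ × τ G T f′ < τ G T f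

  -- The last vertex comes first.
  data Fan (f : Col {n}) (z : Fin n) : List (Fin n) → Set where
    base : ∀ {v} → E G z v → f z v ≡ T → Fan f z (v ∷ [])
    ext  : ∀ {v w L} → Fan f z (v ∷ L) → E G z w → w ∉ v ∷ L → Misses G f v (f z w) → Fan f z (w ∷ v ∷ L)

  fan-E : ∀ {f z L y} → Fan f z L → y ∈ L → E G z y
  fan-E (base e _) (here refl) = e
  fan-E (ext _ e _ _) (here refl) = e
  fan-E (ext F _ _ _) (there y∈) = fan-E F y∈

  fan-T : ∀ {f z L} → Fan f z L → ∃ λ v₀ → v₀ ∈ L × f z v₀ ≡ T
  fan-T (base _ r) = _ , here refl , r
  fan-T (ext F _ _ _) = let v₀ , v₀∈ , r = fan-T F in v₀ , there v₀∈ , r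

  top≢T : ∀ {f z v w L} → OkT f → Fan f z (w ∷ v ∷ L) → f z w ≢ T
  top≢T ok (ext F e w∉ _) r = let v₀ , v₀∈ , r₀ = fan-T F in
    w∉ (subst (_∈ _) (proper ok (fan-E F v₀∈) e (trans r₀ (sym r))) v₀∈)

  misses-upd : ∀ {f z v a x y} → y ≢ z → y ≢ v → Misses G f y x → Misses G (upd f z v a) y x
  misses-upd {f} {z} {v} {y = y} y≢z y≢v m (see u e r) = m (see u e (trans (sym (upd-off f {v = z} {v} λ { fwd → y≢z refl ; bwd → y≢v refl })) r))

  fan-upd : ∀ {f z v a L} → v ∉ L → Fan f z L → Fan (upd f z v a) z L
  fan-upd {f} {z} {v} {a} {L} v∉ F = go F v∉
    where
    off : ∀ {y} → E G z y → y ≢ v → upd f z v a z y ≡ f z y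
    off e ne = upd-off f λ { fwd → ne refl ; bwd → E-irr e }
    go : ∀ {L} → Fan f z L → v ∉ L → Fan (upd f z v a) z L
    go (base e r) v∉ = base e (trans (off e (λ { refl → v∉ (here refl) })) r)
    go (ext {y} {w} F e w∉ m) v∉ = ext (go F (v∉ ∘ there)) e w∉
      (subst (Misses G (upd f z v a) y) (sym (off e (λ { refl → v∉ (here refl) })))
        (misses-upd (λ { refl → E-irr (fan-E F (here refl)) }) (λ { refl → v∉ (there (here refl)) }) m))

  -- The last fan edge takes γ and releases its colour to the edge before it, and so on down to the
  -- `T`-edge, which loses `T`.
  shift-down : ∀ {f z v L γ} → OkT f → Fan f z (v ∷ L) → γ < p → Misses G f z γ → Misses G f v γ → Reduced f
  shift-down {f} {z} {v} {[]} {γ} ok (base e r) γ< mz mv = _ , step-kempe {a = T} {γ} ok ok₁ (upd-K ok e (inj₁ r) (inj₂ refl)) ,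
      τ-less G T {v = v} (see z (E-sym e) (trans (sym (symm ok e)) r)) missing sub
    where
    ok₁ : OkT (upd f z v γ)
    ok₁ = recolour-ok ok e (≤-trans γ< (n≤1+n p)) mz mv
    γ≢T : γ ≢ T
    γ≢T q = <-irrefl q γ<
    missing : Misses G (upd f z v γ) v T
    missing s = case sees-split s of λ where
      (inj₁ (_ , q)) → γ≢T (sym q)
      (inj₂ (see y (mkE (g , q)) t)) → q (subst (Pair z v v) (proper ok (E-sym e) g (trans (trans (sym (symm ok e)) r) (sym t))) bwd)
    sub : ∀ {u} → Sees G (upd f z v γ) u T → Sees G f u T
    sub s = case sees-split s of λ where
      (inj₁ (_ , q)) → ⊥-elim (γ≢T (sym q))
      (inj₂ s′) → sees-sub s′
  shift-down {f} {z} {v} {v′ ∷ L} {γ} ok F′@(ext F e v∉ m) γ< mz mv =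
      let f′ , k , lt = shift-down ok₁ (fan-upd v∉ F) (below ok e (top≢T ok F′)) mz₁ (misses-upd v′≢z v′≢v m) in
      f′ , step-kempe {a = f z v} {γ} ok ok₁ (upd-K ok e (inj₁ refl) (inj₂ refl)) ◅◅ k , <-≤-trans lt (τ-same G T sub)
    where
    v′≢z : v′ ≢ z
    v′≢z refl = E-irr (fan-E F (here refl))
    v′≢v : v′ ≢ v
    v′≢v refl = v∉ (here refl)
    ok₁ : OkT (upd f z v γ)
    ok₁ = recolour-ok ok e (≤-trans γ< (n≤1+n p)) mz mv
    mz₁ : Misses G (upd f z v γ) z (f z v)
    mz₁ s = case sees-split s of λ where
      (inj₁ (_ , q)) → mz (see v e q)
      (inj₂ (see y (mkE (g , q)) t)) → q (subst (Pair z v z) (proper ok e g (sym t)) fwd)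
    sub : ∀ {u} → Sees G (upd f z v γ) u T → Sees G f u T
    sub s = case sees-split s of λ where
      (inj₁ (_ , q)) → ⊥-elim (<-irrefl (sym q) γ<)
      (inj₂ s′) → sees-sub s′

  record Pres (x : ℕ) (f g : Col {n}) : Set where
    constructor mkPres
    field
      pres⇒ : ∀ {u v} → E G u v → f u v ≡ x → g u v ≡ x
      pres⇐ : ∀ {u v} → E G u v → g u v ≡ x → f u v ≡ x
  open Pres

  pres-K : ∀ {a b x f g} → K a b G f g → ¬ In a b x → Pres x f g
  pres-K {a} {b} k ¬i = mkPres
    (λ e r → trans (sym (K-out k e (¬i ∘ subst (In a b) r))) r)
    (λ e r → trans (sym (K-out (K-sym k) e (¬i ∘ subst (In a b) r))) r)

  -- Once `T` is on `zv`, the chain from `v` in `T` and the colour of the next fan edge `zw` starts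
  -- with `vz`, `zw`. Interchanging along it moves `T` to `zw`, and the potential cannot grow
  -- because only the far end may gain `T`.
  slide : ∀ {f z v L} → OkT f → Fan f z (v ∷ L) →
          ∃ λ g → OkT g × Kempe (suc p) G f g × τ G T g ≤ τ G T f × g z v ≡ T × (∀ {x} → (∀ {y} → y ∈ v ∷ L → f z y ≢ x) → Pres x f g)
  slide {f} {z} {v} ok (base e r) = f , ok , ε , ≤-refl , r , λ _ → mkPres (λ _ q → q) (λ _ q → q)
  slide {f} {z} {w} {v ∷ L} ok F′@(ext F e w∉ m) with slide ok F
  ... | g , okg , kf , le , gT , pr = chCol ch , chOk ch , kf ◅◅ step-kempe okg (chOk ch) (chMove ch) , ≤-trans τ≤ le , zw , pres
    where
    α : ℕ
    α = f z w
    pα : Pres α f g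
    pα = pr (λ {y} y∈ r → w∉ (subst (_∈ v ∷ L) (proper ok (fan-E F y∈) e r) y∈))
    α≢T : α ≢ T
    α≢T = top≢T ok F′
    mg : Misses G g v α
    mg (see y h r) = m (see y h (pres⇐ pα h r))
    ch : Chain (suc p) G g α T v
    ch = chain okg (bound ok e) ≤-refl α≢T mg
    zv : E G z v
    zv = fan-E F (here refl)
    vT : g v z ≡ T
    vT = trans (sym (symm okg zv)) gT
    vα : chCol ch v z ≡ α
    vα with K-in (chMove ch) (E-sym zv) (inj₂ vT)
    ... | inj₁ r = r
    ... | inj₂ r = ⊥-elim (mg (b⇐a (chStart ch) (see z (E-sym zv) r)))
    zw : chCol ch z w ≡ T
    zw with K-in (chMove ch) e (inj₁ (pres⇒ pα e refl))
    ... | inj₂ r = r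
    ... | inj₁ r = ⊥-elim (w∉ (here (proper (chOk ch) e zv (trans r (sym (trans (symm (chOk ch) zv) vα))))))
    τ≤ : τ G T (chCol ch) ≤ τ G T g
    τ≤ = τ-exchange G T {v = v} {chEnd ch} (see z (E-sym zv) vT) (λ s → mg (b⇐a (chStart ch) s)) λ u u≢ s → case chRest ch u of λ where
      (inj₁ refl) → ⊥-elim (mg (b⇐a (chStart ch) s))
      (inj₂ (inj₁ r)) → ⊥-elim (u≢ r)
      (inj₂ (inj₂ sm)) → same⇐ sm (inj₂ refl) s
    pres : ∀ {x} → (∀ {y} → y ∈ w ∷ v ∷ L → f z y ≢ x) → Pres x f (chCol ch)
    pres {x} h = mkPres (λ e → pres⇒ P₂ e ∘ pres⇒ P₁ e) (λ e → pres⇐ P₁ e ∘ pres⇐ P₂ e)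
      where
      P₁ : Pres x f g
      P₁ = pr (h ∘ there)
      P₂ : Pres x g (chCol ch)
      P₂ = pres-K (chMove ch) λ { (inj₁ r) → h (here refl) (sym r) ; (inj₂ r) → let v₀ , v₀∈ , r₀ = fan-T F in h (there v₀∈) (trans r₀ (sym r)) }

  fan-K : ∀ {f g z a b L} → K a b G f g → (∀ {y} → y ∈ L → ¬ In a b (f z y)) → Fan f z L → Fan g z L
  fan-K k h (base e r) = base e (trans (sym (K-out k e (h (here refl)))) r)
  fan-K {g = g} k h (ext {v} F e w∉ m) = ext (fan-K k (h ∘ there) F) e w∉ (subst (Misses G g v) (K-out k e (h (here refl))) (K-misses k (h (here refl)) m))

  -- The vertex before a fan vertex w: either the fan up to it survives an interchange of β and α = f z w, or the whole fan does.
  break : ∀ {f g z β t L₀ w} → OkT f → Fan f z (t ∷ L₀) → w ∈ t ∷ L₀ → f z w ≢ T → Misses G f z β → β ≢ T → K β (f z w) G f g → g z w ≡ β →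
          ∃ λ v → ∃ λ L′ → Fan g z (v ∷ L′) × Misses G f v (f z w) × v ∈ L₀ × (Misses G g v β → Fan g z (t ∷ L₀))
  break ok (base _ r) (here refl) w≢T _ _ _ _ = ⊥-elim (w≢T r)
  break {f} {g} {z} {β} {w} {v ∷ L} ok (ext F e w∉ m) (here refl) w≢T mz β≢T k zw = v , L , fan-K k off F , m , here refl ,
      λ mv → ext (fan-K k off F) e w∉ (subst (Misses G g v) (sym zw) mv)
    where
    off : ∀ {y} → y ∈ v ∷ L → ¬ In β (f z w) (f z y)
    off y∈ (inj₁ r) = mz (see _ (fan-E F y∈) r)
    off y∈ (inj₂ r) = w∉ (subst (_∈ v ∷ L) (proper ok (fan-E F y∈) e r) y∈)
  break {f} {g} {z} {β} {w = w} ok (ext {v′} {w′} F e w∉ m) (there w∈) w≢T mz β≢T k zw with break ok F w∈ w≢T mz β≢T k zw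
  ... | v , L′ , F′ , mv , v∈ , whole = v , L′ , F′ , mv , there v∈ , λ mβ → ext (whole mβ) e w∉ (subst (Misses G g v′) (K-out k e off) (K-misses k off m))
    where
    off : ¬ In β (f z w) (f z w′)
    off (inj₁ r) = mz (see w′ e r)
    off (inj₂ r) = w∉ (subst (_∈ _) (proper ok (fan-E F w∈) e (sym r)) w∈)

  fan-unique : ∀ {f z L} → Fan f z L → Unique L
  fan-unique (base _ _) = [] ∷ []
  fan-unique (ext F _ w∉ _) = ∉⇒All≢ w∉ ∷ fan-unique F

  fan-head : ∀ {f z L v₀} → OkT f → Fan f z L → E G z v₀ → f z v₀ ≡ T → v₀ ∈ L
  fan-head ok F e r = let v , v∈ , r′ = fan-T F in subst (_∈ _) (proper ok (fan-E F v∈) e (trans r′ (sym r))) v∈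

  -- The harvest of a failing fan: it stops at a `w` that sees every colour below `T` and hence is
  -- big, and `T` has been brought to `zw`.
  Moved : Col {n} → Fin n → Fin n → Set
  Moved f z v₀ = ∃ λ w → ∃ λ g → E G z w × w ≢ v₀ × Big G w × OkT g × Kempe (suc p) G f g × τ G T g ≤ τ G T f × g z w ≡ T

  -- Vizing's argument. If the α-edge of `z` returns into the fan, the (β,α)-chain from `z` is
  -- interchanged. Either the fan vertex before the return still misses α and the fan up to it is
  -- shifted, or that vertex is the far end of the chain; then the whole fan survives and its last
  -- vertex still misses α.
  grow : ∀ fuel {f z v₀ v L α β} → n < fuel + length (v ∷ L) → OkT f → E G z v₀ → f z v₀ ≡ T → Fan f z (v ∷ L) → α < p → Misses G f v α → β < p → Misses G f z β →
         Reduced f ⊎ Moved f z v₀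
  grow zero {v = v} {L} lt ok e₀ r₀ F α< mv β< mz = ⊥-elim (<⇒≱ lt (unique-length-≤n (v ∷ L) (fan-unique F)))
  grow (suc fuel) {f} {z} {v₀} {v} {L} {α} {β} lt ok e₀ r₀ F α< mv β< mz = decide (sees? G f z α)
    where
    open import Data.List.Membership.DecPropositional (Fin._≟_ {n}) using (_∈?_)
    decide : Dec (Sees G f z α) → Reduced f ⊎ Moved f z v₀
    decide (no m) = inj₁ (shift-down ok F α< m mv)
    decide (yes (see w e refl)) = locate (w ∈? (v ∷ L)) (full? w ok)
      where
      w≢T : f z w ≢ T
      w≢T r = <-irrefl r α<
      locate : Dec (w ∈ v ∷ L) → (∃ λ α → α < p × Misses G f w α) ⊎ Big G w → Reduced f ⊎ Moved f z v₀
      locate (no w∉) (inj₁ (_ , α′< , m′)) = grow fuel (≤-trans lt (≤-reflexive (sym (+-suc fuel _)))) ok e₀ r₀ (ext F e w∉ mv) α′< m′ β< mz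
      locate (no w∉) (inj₂ big) = let g , okg , k , le , gT , _ = slide ok (ext F e w∉ mv) in
        inj₂ (w , g , e , (λ { refl → w∉ (fan-head ok F e₀ r₀) }) , big , okg , k , le , gT)
      locate (yes w∈) _ = inj₁ (finish (chRest ch v′) )
        where
        β≢α : β ≢ f z w
        β≢α refl = mz (see w e refl)
        ch : Chain (suc p) G f β (f z w) z
        ch = chain ok (≤-trans β< (n≤1+n p)) (bound ok e) β≢α mz
        g : Col
        g = chCol ch
        zα : Misses G g z (f z w)
        zα s = mz (b⇐a (chStart ch) s)
        zw : g z w ≡ β
        zw with K-in (chMove ch) e (inj₂ refl)
        ... | inj₁ r = r
        ... | inj₂ r = ⊥-elim (zα (see w e r))
        br : ∃ λ v′ → ∃ λ L′ → Fan g z (v′ ∷ L′) × Misses G f v′ (f z w) × v′ ∈ L × (Misses G g v′ β → Fan g z (v ∷ L))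
        br = break ok F w∈ w≢T mz (λ r → <-irrefl r β<) (chMove ch) zw
        v′ : Fin n
        v′ = proj₁ br
        F′ : Fan g z (v′ ∷ _)
        F′ = proj₁ (proj₂ (proj₂ br))
        mv′ : Misses G f v′ (f z w)
        mv′ = proj₁ (proj₂ (proj₂ (proj₂ br)))
        wrap : Reduced g → Reduced f
        wrap (h , k , lt) = h , step-kempe ok (chOk ch) (chMove ch) ◅◅ k ,
          <-≤-trans lt (τ-same G T λ s → K-sees (K-sym (chMove ch)) (λ { (inj₁ r) → <-irrefl (sym r) β< ; (inj₂ r) → w≢T (sym r) }) s)
        short : Same β (f z w) G f g v′ → Reduced f
        short s = wrap (shift-down (chOk ch) F′ α< zα (mv′ ∘ same⇐ s (inj₂ refl)))
        finish : v′ ≡ z ⊎ v′ ≡ chEnd ch ⊎ Same β (f z w) G f g v′ → Reduced f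
        finish (inj₁ r) = ⊥-elim (E-irr (subst (E G z) r (fan-E F′ (here refl))))
        finish (inj₂ (inj₂ s)) = short s
        finish (inj₂ (inj₁ r)) with chEach ch v′
        ... | inj₁ s = short s
        ... | inj₂ fl = wrap (shift-down (chOk ch) whole α< zα mv₁)
          where
          v′∈ : v′ ∈ L
          v′∈ = proj₁ (proj₂ (proj₂ (proj₂ (proj₂ br))))
          whole : Fan g z (v ∷ L)
          whole = proj₂ (proj₂ (proj₂ (proj₂ (proj₂ br)))) (mv′ ∘ a⇐b fl)
          v≢v′ : v ≢ v′
          v≢v′ q = All.lookup (AllPairs.head (fan-unique F)) v′∈ q
          mv₁ : Misses G g v (f z w)
          mv₁ t with chRest ch v
          ... | inj₁ q = E-irr (subst (E G z) q (fan-E F (here refl)))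
          ... | inj₂ (inj₁ q) = v≢v′ (trans q (sym r))
          ... | inj₂ (inj₂ sm) = mv (same⇐ sm (inj₂ refl) t)

  center : ∀ {f z v₀} → OkT f → E G z v₀ → f z v₀ ≡ T → Reduced f ⊎ Moved f z v₀
  center {f} {z} {v₀} ok e r =
    let β , β< , mz = T-misses ok (see v₀ e r) ; α , α< , mv = T-misses ok (see z (E-sym e) (trans (sym (symm ok e)) r)) in
    grow (suc n) (s≤s (≤-trans (n≤1+n n) (≤-reflexive (+-comm 1 n)))) ok e r (base e r) α< mv β< mz

  record Walk (z v₀ : Fin n) (P : List (Fin n)) : Set where
    constructor mkWalk
    field
      wU : Unique (z ∷ v₀ ∷ P)
      wB : All (Big G) (z ∷ v₀ ∷ P)
      wL : Linked (E G) (z ∷ v₀ ∷ P)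

  reduced-∘ : ∀ {f g} → Kempe (suc p) G f g → τ G T g ≤ τ G T f → Reduced g → Reduced f
  reduced-∘ k le (h , k′ , lt) = h , k ◅◅ k′ , <-≤-trans lt le

  walk : ∀ fuel {f z v₀ P} → n < fuel + length P → OkT f → E G z v₀ → f z v₀ ≡ T → Walk z v₀ P → Reduced f
  walk zero {P = P} lt ok e r (mkWalk (_ ∷ _ ∷ u) _ _) = ⊥-elim (<⇒≱ lt (unique-length-≤n P u))
  walk (suc fuel) lt ok e r (mkWalk u b l) with center ok e r
  ... | inj₁ red = red
  ... | inj₂ (w , g , e′ , w≢ , big , okg , k , le , gT) =
      reduced-∘ k le (walk fuel (≤-trans lt (≤-reflexive (sym (+-suc fuel _)))) okg (E-sym e′) (trans (sym (symm okg e′)) gT)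
        (mkWalk (∉⇒All≢ (no-return nc u b l e′ w≢) ∷ u) (big ∷ b) (E-sym e′ ∷ l)))

  -- The ends of the given `T`-edge need not be big. After two failing fans both ends of the current
  -- one are, and only then does the walk in the forest start.
  reduce-one : ∀ {f z v₀} → OkT f → E G z v₀ → f z v₀ ≡ T → Reduced f
  reduce-one ok e r with center ok e r
  ... | inj₁ red = red
  ... | inj₂ (w , g , e′ , _ , big , okg , k , le , gT) with center okg (E-sym e′) (trans (sym (symm okg e′)) gT)
  ...   | inj₁ red = reduced-∘ k le red
  ...   | inj₂ (w₂ , g₂ , e₂ , _ , big₂ , okg₂ , k₂ , le₂ , gT₂) = reduced-∘ k le (reduced-∘ k₂ le₂
          (walk (suc n) (s≤s (≤-reflexive (sym (+-identityʳ n)))) okg₂ (E-sym e₂) (trans (sym (symm okg₂ e₂)) gT₂)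
            (mkWalk ((≢-sym (E-≢ e₂) ∷ []) ∷ [] ∷ []) (big₂ ∷ big ∷ []) (E-sym e₂ ∷ [-]))))

  drop-top : ∀ {f} → OkT f → (∀ {u} → Misses G f u T) → Ok p G f
  symm (drop-top ok m) = symm ok
  bound (drop-top ok m) e = below ok e (λ r → m (see _ e r))
  proper (drop-top ok m) = proper ok

  reduce : ∀ fuel {f} → OkT f → τ G T f < fuel → ∃ λ g → Ok p G g × Kempe (suc p) G f g
  reduce (suc fuel) {f} ok lt with Finₚ.any? (λ u → sees? G f u T)
  ... | no none = f , drop-top ok (λ {u} s → none (u , s)) , ε
  ... | yes (u , see v e r) with reduce-one ok e r
  ...   | g , k , lt′ with reduce fuel (Kempe-ok ok k) (<-≤-trans lt′ (≤-pred lt))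
  ...     | h , okh , k′ = h , okh , k ◅◅ k′

  fournier : ∀ {f} → OkT f → ∃ λ g → Ok p G g × Kempe (suc p) G f g
  fournier ok = reduce _ ok ≤-refl

-- Recolouring a matching, and induction on the number of colours.

unique-map : ∀ {A : Set} (f : A → ℕ) {xs : List A} → (∀ {x y} → x ∈ xs → y ∈ xs → f x ≡ f y → x ≡ y) → Unique xs → Unique (map f xs)
unique-map f inj [] = []
unique-map f {x ∷ xs} inj (p ∷ u) = map⁺ (All.tabulate (λ y∈ r → All.lookup p y∈ (inj (here refl) (there y∈) r))) ∷ unique-map f (λ a b → inj (there a) (there b)) u

module _ {n : ℕ} where

  -- A matching is an involution that fixes exactly the uncovered vertices.
  record Mat (G : Gph {n}) : Set where
    no-eta-equality
    field
      mate   : Fin n → Fin n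
      invol  : ∀ v → mate (mate v) ≡ v
      mate-E : ∀ {v} → mate v ≢ v → E G v (mate v)
  open Mat public

  mate-sym : ∀ {G : Gph {n}} (M : Mat G) {u v} → mate M u ≡ v → mate M v ≡ u
  mate-sym M {u} refl = invol M u

  _⊟_ : (G : Gph {n}) → Mat G → Gph
  rel (G ⊟ M) u v = E G u v × mate M u ≢ v
  rel? (G ⊟ M) u v = E? G u v ×-dec ¬? (mate M u Fin.≟ v)
  rel-sym (G ⊟ M) (e , m) = E-sym e , m ∘ mate-sym M
  rel-irr (G ⊟ M) (e , _) = E-irr e

  ⊟-⊆ : ∀ {G : Gph {n}} {M : Mat G} {u v} → E (G ⊟ M) u v → E G u v
  ⊟-⊆ (mkE (e , _)) = e

  module _ {G : Gph {n}} (M : Mat G) where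

    glue : ℕ → Col {n} → Col {n}
    glue p φ u v with mate M u Fin.≟ v
    ... | yes _ = p
    ... | no _ = φ u v

    glue-on : ∀ {p φ u v} → mate M u ≡ v → glue p φ u v ≡ p
    glue-on {u = u} {v} m with mate M u Fin.≟ v
    ... | yes _ = refl
    ... | no ¬m = ⊥-elim (¬m m)

    glue-off : ∀ {p φ u v} → mate M u ≢ v → glue p φ u v ≡ φ u v
    glue-off {u = u} {v} ¬m with mate M u Fin.≟ v
    ... | yes m = ⊥-elim (¬m m)
    ... | no _ = refl

    glue-ok : ∀ {p φ} → Ok p (G ⊟ M) φ → Ok (suc p) G (glue p φ)
    symm (glue-ok {p} {φ} ok) {u} {v} e with mate M u Fin.≟ v
    ... | yes m = sym (glue-on (mate-sym M m))
    ... | no ¬m = trans (symm ok (mkE (e , ¬m))) (sym (glue-off (¬m ∘ mate-sym M)))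
    bound (glue-ok {p} {φ} ok) {u} {v} e with mate M u Fin.≟ v
    ... | yes _ = ≤-refl
    ... | no ¬m = ≤-trans (bound ok (mkE (e , ¬m))) (n≤1+n p)
    proper (glue-ok {p} {φ} ok) {u} {v} {w} e f q with mate M u Fin.≟ v | mate M u Fin.≟ w
    ... | yes m | yes m′ = trans (sym m) m′
    ... | yes _ | no ¬m = ⊥-elim (<-irrefl (sym q) (bound ok (mkE (f , ¬m))))
    ... | no ¬m | yes _ = ⊥-elim (<-irrefl q (bound ok (mkE (e , ¬m))))
    ... | no ¬m | no ¬m′ = proper ok (mkE (e , ¬m)) (mkE (f , ¬m′)) q

    glue-K : ∀ {p a b φ ψ} → K a b (G ⊟ M) φ ψ → K a b G (glue p φ) (glue p ψ)
    glue-K {p} {a} {b} {φ} {ψ} k = mkK λ {u} {v} e → aux e (mate M u Fin.≟ v)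
      where
      aux : ∀ {u v} → E G u v → Dec (mate M u ≡ v) → Rel a b (glue p φ u v) (glue p ψ u v)
      aux e (yes m) = inj₁ (trans (glue-on m) (sym (glue-on m)))
      aux e (no ¬m) = subst₂ (Rel a b) (sym (glue-off ¬m)) (sym (glue-off ¬m)) (at k (mkE (e , ¬m)))

    glue-kempe : ∀ {p φ ψ} → Ok p (G ⊟ M) φ → Kempe p (G ⊟ M) φ ψ → Kempe (suc p) G (glue p φ) (glue p ψ)
    glue-kempe ok ε = ε
    glue-kempe ok ((o , o′ , a , b , k) ◅ r) = step-kempe (glue-ok o) (glue-ok o′) (glue-K k) ◅◅ glue-kempe o′ r

    -- Interpolates between `f` and `glue p f`: only matching edges of colour below `k` have been
    -- repainted, so raising `k` by one interchanges just `k` and `p`.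
    part : ℕ → ℕ → Col {n} → Col {n}
    part k p f u v with mate M u Fin.≟ v | f u v ℕ.<? k
    ... | yes _ | yes _ = p
    ... | yes _ | no _ = f u v
    ... | no _ | _ = f u v

    data PView (k p : ℕ) (f : Col {n}) (u v : Fin n) : ℕ → Set where
      hit  : mate M u ≡ v → f u v < k → PView k p f u v p
      miss : ¬ (mate M u ≡ v × f u v < k) → PView k p f u v (f u v)

    pview : ∀ k p f u v → PView k p f u v (part k p f u v)
    pview k p f u v with mate M u Fin.≟ v | f u v ℕ.<? k
    ... | yes m | yes l = hit m l
    ... | yes _ | no ¬l = miss (¬l ∘ proj₂)
    ... | no ¬m | _ = miss (¬m ∘ proj₁)

    part-ok : ∀ {k p f} → Ok p G f → Ok (suc p) G (part k p f)
    symm (part-ok {k} {p} {f} ok) {u} {v} e with part k p f u v | pview k p f u v | part k p f v u | pview k p f v u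
    ... | _ | hit _ _ | _ | hit _ _ = refl
    ... | _ | hit m l | _ | miss h = ⊥-elim (h (mate-sym M m , subst (_< k) (symm ok e) l))
    ... | _ | miss h | _ | hit m l = ⊥-elim (h (mate-sym M m , subst (_< k) (sym (symm ok e)) l))
    ... | _ | miss _ | _ | miss _ = symm ok e
    bound (part-ok {k} {p} {f} ok) {u} {v} e with part k p f u v | pview k p f u v
    ... | _ | hit _ _ = ≤-refl
    ... | _ | miss _ = ≤-trans (bound ok e) (n≤1+n p)
    proper (part-ok {k} {p} {f} ok) {u} {v} {w} e e′ q with part k p f u v | pview k p f u v | part k p f u w | pview k p f u w
    ... | _ | hit m _ | _ | hit m′ _ = trans (sym m) m′
    ... | _ | hit _ _ | _ | miss _ = ⊥-elim (<-irrefl (sym q) (bound ok e′))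
    ... | _ | miss _ | _ | hit _ _ = ⊥-elim (<-irrefl q (bound ok e))
    ... | _ | miss _ | _ | miss _ = proper ok e e′ q

    part-step : ∀ {k p f} → Ok p G f → K k p G (part k p f) (part (suc k) p f)
    part-step {k} {p} {f} ok = mkK λ {u} {v} e → aux (pview k p f u v) (pview (suc k) p f u v)
      where
      aux : ∀ {u v x y} → PView k p f u v x → PView (suc k) p f u v y → Rel k p x y
      aux (hit _ _) (hit _ _) = inj₁ refl
      aux (hit m l) (miss h) = ⊥-elim (h (m , ≤-trans l (n≤1+n k)))
      aux (miss h) (miss _) = inj₁ refl
      aux {u} {v} (miss h) (hit m l) with f u v ℕ.≟ k
      ... | yes r = inj₂ (inj₁ r , inj₂ refl)
      ... | no r = ⊥-elim (h (m , ≤∧≢⇒< (≤-pred l) r))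

    part-path : ∀ k {p f} → Ok p G f → Kempe (suc p) G (part 0 p f) (part k p f)
    part-path zero ok = ε
    part-path (suc k) ok = part-path k ok ◅◅ step-kempe (part-ok ok) (part-ok ok) (part-step ok)

    paint : ∀ {p f} → Ok p G f → Kempe (suc p) G f (glue p f)
    paint {p} {f} ok = agree-kempe ok₁ (mkA λ {u} {v} e → start (pview 0 p f u v)) ◅◅ part-path p ok
        ◅◅ agree-kempe (part-ok ok) (mkA λ {u} {v} e → end e (pview p p f u v))
      where
      ok₁ : Ok (suc p) G f
      symm ok₁ = symm ok
      bound ok₁ e = ≤-trans (bound ok e) (n≤1+n p)
      proper ok₁ = proper ok
      start : ∀ {u v x} → PView 0 p f u v x → f u v ≡ x
      start (hit _ ())
      start (miss _) = refl
      end : ∀ {u v x} → E G u v → PView p p f u v x → x ≡ glue p f u v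
      end e (hit m _) = sym (glue-on m)
      end e (miss h) = sym (glue-off (λ m → h (m , bound ok e)))

  colour-class : ∀ {p f} {G : Gph {n}} → Ok p G f → ℕ → Mat G
  colour-class {p} {f} {G} ok a = record { mate = mt ; invol = inv ; mate-E = λ {v} → mE v }
    where
    mt : Fin n → Fin n
    mt v with sees? G f v a
    ... | yes (see w _ _) = w
    ... | no _ = v
    mt-to : ∀ {v w} → E G v w → f v w ≡ a → mt v ≡ w
    mt-to {v} {w} e r with sees? G f v a
    ... | yes (see w′ e′ r′) = proper ok e′ e (trans r′ (sym r))
    ... | no m = ⊥-elim (m (see w e r))
    inv : ∀ v → mt (mt v) ≡ v
    inv v with sees? G f v a in eq
    ... | yes (see w e r) = mt-to (E-sym e) (trans (sym (symm ok e)) r)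
    ... | no m with sees? G f v a
    ...   | yes s = ⊥-elim (m s)
    ...   | no _ = refl
    mE : ∀ v → mt v ≢ v → E G v (mt v)
    mE v ne with sees? G f v a
    ... | yes (see w e r) = e
    ... | no _ = ⊥-elim (ne refl)

  class-mate : ∀ {p f a} {G : Gph {n}} (ok : Ok p G f) {v w} → E G v w → f v w ≡ a → mate (colour-class ok a) v ≡ w
  class-mate {f = f} {a} {G} ok {v} {w} e r with sees? G f v a
  ... | yes (see w′ e′ r′) = proper ok e′ e (trans r′ (sym r))
  ... | no m = ⊥-elim (m (see w e r))

  ok-degLe : ∀ {p f} {G : Gph {n}} → Ok p G f → ∀ v → DegLe G v p
  ok-degLe {p} {f} ok v vs u es = subst (_≤ p) (length-map (f v) vs)
    (unique-bounded-length (unique-map (f v) (λ a b → proper ok (All.lookup es a) (All.lookup es b)) u) (map⁺ (All.map (bound ok) es)))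

  big-⊆ : ∀ {G J : Gph {n}} → (∀ {x y} → E J x y → E G x y) → ∀ {v} → Big J v → Big G v
  big-⊆ f (mkBig vs u es l) = mkBig vs u (All.map f es) l

  noCycle-⊆ : ∀ {G J : Gph {n}} → (∀ {x y} → E J x y → E G x y) → NoCycle G → NoCycle J
  noCycle-⊆ f nc x xs len u b l = nc x xs len u (All.map (big-⊆ f) b) (Linked.map f l)

  ok-weaken : ∀ {p} {G : Gph {n}} {f} → Ok p G f → Ok (suc p) G f
  symm (ok-weaken ok) = symm ok
  bound (ok-weaken {p} ok) e = ≤-trans (bound ok e) (n≤1+n p)
  proper (ok-weaken ok) = proper ok

  Base : Set₁
  Base = (G : Gph {n}) → NoCycle G → ∀ {f g} → Ok 5 G f → Ok 5 G g → Kempe 6 G f g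

  all-complete : Base → ∀ d (G : Gph {n}) → NoCycle G → ∀ {g₀} → Ok (d ℕ.+ 5) G g₀ → Complete (suc (d ℕ.+ 5)) G
  reduced-complete : Base → ∀ d (G : Gph {n}) → NoCycle G → ∀ {f g} → Ok (d ℕ.+ 5) G f → Ok (d ℕ.+ 5) G g → Kempe (suc (d ℕ.+ 5)) G f g
  all-complete b d G nc ok₀ okf okg =
    let f′ , okf′ , kf = Fournier.fournier G (d ℕ.+ 5) (m≤n+m 5 d) (ok-degLe ok₀) nc okf
        g′ , okg′ , kg = Fournier.fournier G (d ℕ.+ 5) (m≤n+m 5 d) (ok-degLe ok₀) nc okg
    in kf ◅◅ reduced-complete b d G nc okf′ okg′ ◅◅ Kempe-sym kg
  reduced-complete b zero G nc okf okg = b G nc okf okg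
  reduced-complete b (suc d) G nc {f} {g} okf okg =
      paint M okf ◅◅ glue-kempe M (Ok-⊆ sub okf) (all-complete b d Q (noCycle-⊆ sub nc) okQ (Ok-⊆ sub okf) (Ok-⊆ sub okg)) ◅◅ Kempe-sym (paint M okg)
    where
    M : Mat G
    M = colour-class okg (d ℕ.+ 5)
    Q : Gph
    Q = G ⊟ M
    sub : ∀ {x y} → E Q x y → E G x y
    sub = ⊟-⊆ {M = M}
    okQ : Ok (d ℕ.+ 5) Q g
    symm okQ e = symm okg (sub e)
    bound okQ (mkE (e , ne)) = ≤∧≢⇒< (≤-pred (bound okg e)) (λ r → ne (class-mate okg e r))
    proper okQ e f = proper okg (sub e) (sub f)

-- Keeping the colour of one edge fixed; overlays and residual cores.

tr : ℕ → ℕ → ℕ → ℕ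
tr a b c with c ℕ.≟ a | c ℕ.≟ b
... | yes _ | _ = b
... | no _ | yes _ = a
... | no _ | no _ = c

tr-1 : ∀ a b → tr a b a ≡ b
tr-1 a b with a ℕ.≟ a | a ℕ.≟ b
... | yes _ | _ = refl
... | no z | _ = ⊥-elim (z refl)

tr-2 : ∀ a b → tr a b b ≡ a
tr-2 a b with b ℕ.≟ a | b ℕ.≟ b
... | yes r | _ = r
... | no _ | yes _ = refl
... | no _ | no z = ⊥-elim (z refl)

tr-o : ∀ {a b c} → c ≢ a → c ≢ b → tr a b c ≡ c
tr-o {a} {b} {c} p q with c ℕ.≟ a | c ℕ.≟ b
... | yes r | _ = ⊥-elim (p r)
... | no _ | yes r = ⊥-elim (q r)
... | no _ | no _ = refl

tr-invol : ∀ a b c → tr a b (tr a b c) ≡ c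
tr-invol a b c with c ℕ.≟ a | c ℕ.≟ b
... | yes refl | _ = tr-2 c b
... | no _ | yes refl = tr-1 a c
... | no p | no q = tr-o p q

tr-inj : ∀ a b {c d} → tr a b c ≡ tr a b d → c ≡ d
tr-inj a b {c} {d} r = trans (sym (tr-invol a b c)) (trans (cong (tr a b) r) (tr-invol a b d))

tr-rel : ∀ a b c → Rel a b c (tr a b c)
tr-rel a b c with c ℕ.≟ a | c ℕ.≟ b
... | yes r | _ = inj₂ (inj₁ r , inj₂ refl)
... | no _ | yes r = inj₂ (inj₂ r , inj₁ refl)
... | no _ | no _ = inj₁ refl

tr-< : ∀ {p a b} → a < p → b < p → ∀ {c} → c < p → tr a b c < p
tr-< {a = a} {b} a< b< {c} c< with c ℕ.≟ a | c ℕ.≟ b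
... | yes _ | _ = b<
... | no _ | yes _ = a<
... | no _ | no _ = c<

-- As permutations the two sides differ by the transposition of `e` and `e′`; this is the second
-- half of a frozen step.
tr-tr : ∀ {b e e′} → e ≢ b → e′ ≢ b → e ≢ e′ → ∀ y → Rel e e′ (tr b e′ (tr e b y)) (tr e′ b y)
tr-tr {b} {e} {e′} e≢b e′≢b e≢e′ y = go (y ℕ.≟ b) (y ℕ.≟ e) (y ℕ.≟ e′)
  where
  go : Dec (y ≡ b) → Dec (y ≡ e) → Dec (y ≡ e′) → Rel e e′ (tr b e′ (tr e b y)) (tr e′ b y)
  go (yes refl) _ _ = inj₂ (inj₁ (trans (cong (tr y e′) (tr-2 e y)) (tr-o e≢b e≢e′)) , inj₂ (tr-2 e′ y))
  go (no _) (yes refl) _ = inj₂ (inj₂ (trans (cong (tr b e′) (tr-1 y b)) (tr-1 b e′)) , inj₁ (tr-o e≢e′ e≢b))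
  go (no p) (no q) (yes refl) = inj₁ (trans (cong (tr b y) (tr-o q p)) (trans (tr-2 b y) (sym (tr-1 y b))))
  go (no p) (no q) (no r) = inj₁ (trans (cong (tr b e′) (tr-o q p)) (trans (tr-o p r) (sym (tr-o r p))))

tr-id : ∀ a c → tr a a c ≡ c
tr-id a c with tr-rel a a c
... | inj₁ z = sym z
... | inj₂ (i , j) = trans ([ id , id ]′ j) (sym ([ id , id ]′ i))

module _ {n : ℕ} where

  perm : ℕ → ℕ → Col {n} → Col {n}
  perm a b φ u v = tr a b (φ u v)

  perm-ok : ∀ {p a b} {G : Gph {n}} {φ} → a < p → b < p → Ok p G φ → Ok p G (perm a b φ)
  symm (perm-ok {a = a} {b} _ _ ok) e = cong (tr a b) (symm ok e)
  bound (perm-ok a< b< ok) e = tr-< a< b< (bound ok e)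
  proper (perm-ok {a = a} {b} _ _ ok) e f r = proper ok e f (tr-inj a b r)

  perm-K : ∀ {a b s t} {G : Gph {n}} {φ ψ} → K s t G φ ψ → K (tr a b s) (tr a b t) G (perm a b φ) (perm a b ψ)
  perm-K {a} {b} k = mkK λ e → Sum.map (cong (tr a b)) (λ (i , j) → Sum.map (cong (tr a b)) (cong (tr a b)) i , Sum.map (cong (tr a b)) (cong (tr a b)) j) (at k e)

  perm-self : ∀ {a b} {G : Gph {n}} {φ} → K a b G φ (perm a b φ)
  perm-self {a} {b} {φ = φ} = mkK λ {u} {v} _ → tr-rel a b (φ u v)

  record StepF (p : ℕ) (G : Gph {n}) (x x′ : Fin n) (b : ℕ) (φ ψ : Col {n}) : Set where
    constructor mkF
    field
      fstep : Step p G φ ψ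
      fix₁  : φ x x′ ≡ b
      fix₂  : ψ x x′ ≡ b
  open StepF public

  module _ {p : ℕ} {G : Gph {n}} {x x′ : Fin n} (ex : E G x x′) {b : ℕ} (b< : b < p) where

    private
      Path : Col → Col → Set
      Path = Star (StepF p G x x′ b)

      norm : Col → Col
      norm φ = perm (φ x x′) b φ

      norm-b : ∀ φ → norm φ x x′ ≡ b
      norm-b φ = tr-1 (φ x x′) b

      norm-ok : ∀ {φ} → Ok p G φ → Ok p G (norm φ)
      norm-ok ok = perm-ok (bound ok ex) b< ok

    -- Renaming colours so that `xx′` always has `b` turns an interchange into an interchange as
    -- long as `xx′` keeps its colour. If it changes from `e` to `e′`, the renaming changes too, and
    -- the difference takes at most two interchanges, both leaving `b` on `xx′`.
    frozen-step : ∀ {φ φ₁} → Step p G φ φ₁ → Path (norm φ) (norm φ₁)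
    frozen-step {φ} {φ₁} (o , o₁ , s , t , k) = decide (e ℕ.≟ e′) (e ℕ.≟ b) (e′ ℕ.≟ b)
      where
      e e′ : ℕ
      e = φ x x′
      e′ = φ₁ x x′
      one : ∀ {s t} → K s t G (norm φ) (norm φ₁) → Path (norm φ) (norm φ₁)
      one k = mkF (norm-ok o , norm-ok o₁ , _ , _ , k) (norm-b φ) (norm-b φ₁) ◅ ε
      trivial : ∀ {ψ a s t} → a ≡ b → K s t G ψ (perm a b ψ)
      trivial {ψ} refl = mkK λ {u} {v} _ → inj₁ (sym (tr-id b (ψ u v)))
      pair : e ≢ e′ → K e e′ G φ φ₁
      pair ne with at k ex
      ... | inj₁ r = ⊥-elim (ne r)
      ... | inj₂ (i , j) = mkK λ f → Sum.map₂ (λ (i′ , j′) → in-third i j ne i′ , in-third i j ne j′) (at k f)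
      decide : Dec (e ≡ e′) → Dec (e ≡ b) → Dec (e′ ≡ b) → Path (norm φ) (norm φ₁)
      decide (yes r) _ _ = one (subst (λ z → K (tr e b s) (tr e b t) G (norm φ) (perm z b φ₁)) r (perm-K k))
      decide (no ne) (yes r) _ = one {e} {e′} (K-trans (K-sym (trivial r)) (K-trans (pair ne) (K-swap (subst (λ z → K e′ z G φ₁ (norm φ₁)) (sym r) perm-self))))
      decide (no ne) (no _) (yes r) = one {e} {e′} (K-trans (K-sym (subst (λ z → K e z G φ (norm φ)) (sym r) perm-self)) (K-trans (pair ne) (trivial r)))
      decide (no ne) (no e≢b) (no e′≢b) =
          mkF (norm-ok o , okχ , _ , _ , k₁) (norm-b φ) χb ◅ mkF (okχ , norm-ok o₁ , _ , _ , k₂) χb (norm-b φ₁) ◅ ε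
        where
        χ : Col
        χ = perm b e′ (perm e b φ₁)
        okχ : Ok p G χ
        okχ = perm-ok b< (bound o₁ ex) (perm-ok (bound o ex) b< o₁)
        k₁ : K b e′ G (norm φ) χ
        k₁ = K-trans (subst₂ (λ s t → K s t G (norm φ) (perm e b φ₁)) (tr-1 e b) (tr-o (≢-sym ne) e′≢b) (perm-K (pair ne))) perm-self
        k₂ : K e e′ G χ (norm φ₁)
        k₂ = mkK λ {u} {v} _ → tr-tr e≢b e′≢b ne (φ₁ u v)
        χb : χ x x′ ≡ b
        χb = trans (cong (tr b e′) (tr-o (≢-sym ne) e′≢b)) (tr-2 b e′)

    frozen-path : ∀ {φ ψ} → Kempe p G φ ψ → Path (norm φ) (norm ψ)
    frozen-path ε = ε
    frozen-path (s ◅ r) = frozen-step s ◅◅ frozen-path r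

    frozen : ∀ {φ ψ} → Ok p G φ → Ok p G ψ → φ x x′ ≡ b → ψ x x′ ≡ b → Kempe p G φ ψ → Path φ ψ
    frozen {φ} {ψ} o o′ r r′ path = ends o r ◅ (frozen-path path ◅◅ (flip (ends o′ r′) ◅ ε))
      where
      ends : ∀ {φ} → Ok p G φ → φ x x′ ≡ b → StepF p G x x′ b φ (norm φ)
      ends {φ} o r = mkF (o , norm-ok o , _ , _ , perm-self) r (norm-b φ)
      flip : ∀ {φ ψ} → StepF p G x x′ b φ ψ → StepF p G x x′ b ψ φ
      flip (mkF (o , o′ , a , c , k) r r′) = mkF (o′ , o , a , c , K-sym k) r′ r

  overlay : Gph {n} → Col {n} → Col {n} → Col {n}
  overlay R f ψ u v with E? R u v
  ... | yes _ = ψ u v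
  ... | no _ = f u v

  overlay-on : ∀ {R : Gph {n}} {f ψ u v} → E R u v → overlay R f ψ u v ≡ ψ u v
  overlay-on {R} {u = u} {v} e with E? R u v
  ... | yes _ = refl
  ... | no ¬e = ⊥-elim (¬e e)

  overlay-off : ∀ {R : Gph {n}} {f ψ u v} → ¬ E R u v → overlay R f ψ u v ≡ f u v
  overlay-off {R} {u = u} {v} ¬e with E? R u v
  ... | yes e = ⊥-elim (¬e e)
  ... | no _ = refl

  overlay-same : ∀ (R : Gph {n}) f u v → f u v ≡ overlay R f f u v
  overlay-same R f u v with E? R u v
  ... | yes _ = refl
  ... | no _ = refl

  record Apart (G R : Gph {n}) (f ψ : Col {n}) : Set where
    constructor mkApart
    field differ : ∀ {u v w} → E R u v → E G u w → ¬ E R u w → ψ u v ≢ f u w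
  open Apart public

  overlay-ok : ∀ {p} {G R : Gph {n}} {f ψ} → Ok p G f → Ok p R ψ → Apart G R f ψ → Ok p G (overlay R f ψ)
  symm (overlay-ok {G = G} {R} okf okψ ap) {u} {v} e with E? R u v
  ... | yes r = trans (symm okψ r) (sym (overlay-on (E-sym r)))
  ... | no ¬r = trans (symm okf e) (sym (overlay-off {R} (¬r ∘ E-sym)))
  bound (overlay-ok {G = G} {R} okf okψ ap) {u} {v} e with E? R u v
  ... | yes r = bound okψ r
  ... | no _ = bound okf e
  proper (overlay-ok {G = G} {R} okf okψ ap) {u} {v} {w} e e′ q with E? R u v | E? R u w
  ... | yes r | yes r′ = proper okψ r r′ q
  ... | yes r | no ¬r = ⊥-elim (differ ap r e′ ¬r q)
  ... | no ¬r | yes r = ⊥-elim (differ ap r e ¬r (sym q))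
  ... | no _ | no _ = proper okf e e′ q

  overlay-K : ∀ {a b} {G R : Gph {n}} {f φ ψ} → K a b R φ ψ → K a b G (overlay R f φ) (overlay R f ψ)
  overlay-K {a} {b} {G} {R} {f} {φ} {ψ} k = mkK λ {u} {v} _ → aux u v
    where
    aux : ∀ u v → Rel a b (overlay R f φ u v) (overlay R f ψ u v)
    aux u v with E? R u v
    ... | yes r = at k r
    ... | no _ = inj₁ refl

  overlay-path : ∀ {p} {G R : Gph {n}} {f φ ψ} {S : Col → Col → Set} → Ok p G f → (∀ {χ χ′} → S χ χ′ → Step p R χ χ′ × Apart G R f χ × Apart G R f χ′) →
                 Star S φ ψ → Kempe p G (overlay R f φ) (overlay R f ψ)
  overlay-path okf g ε = ε
  overlay-path okf g (s ◅ r) = let (o , o′ , _ , _ , k) , ap , ap′ = g s in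
    step-kempe (overlay-ok okf o ap) (overlay-ok okf o′ ap′) (overlay-K k) ◅◅ overlay-path okf g r

  infix 4 _∈ˢ_
  _∈ˢ_ : Fin n → (Fin n → Bool) → Set
  x ∈ˢ s = s x ≡ true

  _∈ˢ?_ : ∀ x s → Dec (x ∈ˢ s)
  x ∈ˢ? s = s x Bool.≟ true

  size : (Fin n → Bool) → ℕ
  size s = length (filter (_∈ˢ? s) (allFin n))

  size-< : ∀ {s s′ x} → (∀ {y} → y ∈ˢ s′ → y ∈ˢ s) → x ∈ˢ s → ¬ x ∈ˢ s′ → size s′ < size s
  size-< {s} {s′} {x} sub x∈ x∉ = ≤-<-trans
    (unique-⊆-length (filter (_∈ˢ? s′) (allFin n)) (filter ≢x? (filter (_∈ˢ? s) (allFin n))) (filter⁺ (_∈ˢ? s′) (allFin⁺ n))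
      (λ y∈ → let y∈′ = proj₂ (∈-filter⁻ (_∈ˢ? s′) {xs = allFin n} y∈) in
         ∈-filter⁺ ≢x? (∈-filter⁺ (_∈ˢ? s) (∈-allFin _) (sub y∈′)) (λ { refl → x∉ y∈′ })))
    (filter-notAll ≢x? (filter (_∈ˢ? s) (allFin n)) (lose (∈-filter⁺ (_∈ˢ? s) (∈-allFin x) x∈) (λ z → z refl)))
    where
    ≢x? : ∀ y → Dec (y ≢ x)
    ≢x? y = ¬? (y Fin.≟ x)

  remove : Fin n → (Fin n → Bool) → Fin n → Bool
  remove q s y with y Fin.≟ q
  ... | yes _ = false
  ... | no _ = s y

  remove⁻ : ∀ {q s y} → y ∈ˢ remove q s → y ∈ˢ s × y ≢ q
  remove⁻ {q} {s} {y} p with y Fin.≟ q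
  ... | no ne = p , ne

  remove⁺ : ∀ {q s y} → y ∈ˢ s → y ≢ q → y ∈ˢ remove q s
  remove⁺ {q} {s} {y} p ne with y Fin.≟ q
  ... | yes r = ⊥-elim (ne r)
  ... | no _ = p

  -- A partition of the edges rather than of the vertices: edges between `s` and its complement
  -- count as outside.
  inside outside : Gph {n} → (Fin n → Bool) → Gph {n}
  rel (inside A s) x y = E A x y × x ∈ˢ s × y ∈ˢ s
  rel? (inside A s) x y = E? A x y ×-dec (x ∈ˢ? s) ×-dec (y ∈ˢ? s)
  rel-sym (inside A s) (e , p , q) = E-sym e , q , p
  rel-irr (inside A s) (e , _) = E-irr e
  rel (outside A s) x y = E A x y × ¬ (x ∈ˢ s × y ∈ˢ s)
  rel? (outside A s) x y = E? A x y ×-dec ¬? ((x ∈ˢ? s) ×-dec (y ∈ˢ? s))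
  rel-sym (outside A s) (e , p) = E-sym e , λ (a , b) → p (b , a)
  rel-irr (outside A s) (e , _) = E-irr e

  inside-⊆ : ∀ {A : Gph {n}} {s x y} → E (inside A s) x y → E A x y
  inside-⊆ (mkE (e , _)) = e

  outside-⊆ : ∀ {A : Gph {n}} {s x y} → E (outside A s) x y → E A x y
  outside-⊆ (mkE (e , _)) = e

  nbrs-mono : ∀ {G J : Gph {n}} {x} → (∀ {y} → E G x y → E J x y) → length (nbrs G x) ≤ length (nbrs J x)
  nbrs-mono {G} {J} {x} f = unique-⊆-length (nbrs G x) (nbrs J x) (nbrs-unique G x) (λ y∈ → ∈-nbrs (f (nbrs-∈ y∈)))

  -- What remains when vertices of degree at most 3 are deleted as long as possible
  record Residual (A : Gph {n}) (s₀ : Fin n → Bool) : Set where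
    constructor mkRes
    field
      s     : Fin n → Bool
      sub   : ∀ {x} → x ∈ˢ s → x ∈ˢ s₀
      core  : ∀ {x} → x ∈ˢ s → 4 ≤ length (nbrs (inside A s) x)
      compl : Complete 5 (outside A s)

  peel : ∀ fuel (A : Gph {n}) (s₀ : Fin n → Bool) → size s₀ < fuel → (∀ v → DegLe A v 4) → (∀ {x y} → E A x y → x ∈ˢ s₀) → Residual A s₀
  peel (suc fuel) A s₀ lt deg cov with Finₚ.any? (λ q → (q ∈ˢ? s₀) ×-dec (length (nbrs A q) ℕ.≤? 3))
  ... | no none = mkRes s₀ id
        (λ {x} x∈ → ≤-trans (≰⇒> (λ le → none (x , x∈ , le))) (nbrs-mono (λ e → mkE (e , cov e , cov (E-sym e)))))
        (λ ok _ → agree-kempe ok (mkA λ { (mkE (e , out)) → ⊥-elim (out (cov e , cov (E-sym e))) }))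
  ... | yes (q , q∈ , le) = mkRes (Residual.s ih) (λ x∈ → proj₁ (remove⁻ {q} {s₀} (Residual.sub ih x∈)))
        (λ x∈ → ≤-trans (Residual.core ih x∈) (nbrs-mono (λ { (mkE (mkE (e , _) , p)) → mkE (e , p) })))
        (degree-3 (λ v → degLe-⊆ outside-⊆ (deg v))
          (degLe-⊆ outside-⊆ (λ vs u es → ≤-trans (degLe-list (nbrs A q) ∈-nbrs vs u es) le))
          (complete-cong (λ { (mkE (mkE (e , a , b) , out)) → mkE (mkE (e , out) , a , b) })
                         (λ { (mkE (mkE (e , out) , a , b)) → mkE (mkE (e , a , b) , out) }) (Residual.compl ih)))
    where
    ih : Residual (A ⊖ q) (remove q s₀)
    ih = peel fuel (A ⊖ q) (remove q s₀)
           (<-≤-trans (size-< (λ y∈ → proj₁ (remove⁻ {q} {s₀} y∈)) q∈ (λ z → proj₂ (remove⁻ {q} {s₀} z) refl)) (≤-pred lt))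
           (λ v → degLe-⊆ ⊖-⊆ (deg v)) (λ { (mkE (e , a , b)) → remove⁺ (cov e) a })

-- Matchings without short augmenting paths.

module _ {n : ℕ} {G : Gph {n}} where

  module _ (M : Mat G) (x : Fin n) where

    opaque
      private
        mt : Fin n → Fin n
        mt w with w Fin.≟ x | w Fin.≟ mate M x
        ... | yes _ | _ = w
        ... | no _ | yes _ = w
        ... | no _ | no _ = mate M w

        mt-x : mt x ≡ x
        mt-x with x Fin.≟ x | x Fin.≟ mate M x
        ... | yes _ | _ = refl
        ... | no z | _ = ⊥-elim (z refl)

        mt-x′ : mt (mate M x) ≡ mate M x
        mt-x′ with mate M x Fin.≟ x | mate M x Fin.≟ mate M x
        ... | yes _ | _ = refl
        ... | no _ | yes _ = refl
        ... | no _ | no z = ⊥-elim (z refl)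

        mt-o : ∀ {w} → w ≢ x → w ≢ mate M x → mt w ≡ mate M w
        mt-o {w} p q with w Fin.≟ x | w Fin.≟ mate M x
        ... | yes r | _ = ⊥-elim (p r)
        ... | no _ | yes r = ⊥-elim (q r)
        ... | no _ | no _ = refl

      unpair : Mat G
      mate unpair = mt
      invol unpair v with v Fin.≟ x | v Fin.≟ mate M x
      ... | yes refl | _ = mt-x
      ... | no _ | yes refl = mt-x′
      ... | no p | no q = trans (mt-o (λ r → q (sym (mate-sym M r))) (λ r → p (trans (sym (invol M v)) (trans (cong (mate M) r) (invol M x))))) (invol M v)
      mate-E unpair {v} ne with v Fin.≟ x | v Fin.≟ mate M x
      ... | yes _ | _ = ⊥-elim (ne refl)
      ... | no _ | yes _ = ⊥-elim (ne refl)
      ... | no _ | no _ = mate-E M ne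

      unpair-x : mate unpair x ≡ x
      unpair-x = mt-x

      unpair-x′ : mate unpair (mate M x) ≡ mate M x
      unpair-x′ = mt-x′

      unpair-o : ∀ {w} → w ≢ x → w ≢ mate M x → mate unpair w ≡ mate M w
      unpair-o = mt-o

      unpair-fixed : ∀ {w} → mate M w ≡ w → mate unpair w ≡ w
      unpair-fixed {w} r with w Fin.≟ x | w Fin.≟ mate M x
      ... | yes refl | _ = refl
      ... | no _ | yes refl = refl
      ... | no _ | no _ = r

  module _ (M : Mat G) {u v : Fin n} (e : E G u v) (mu : mate M u ≡ u) (mv : mate M v ≡ v) where

    opaque
      private
        mt : Fin n → Fin n
        mt w with w Fin.≟ u | w Fin.≟ v
        ... | yes _ | _ = v
        ... | no _ | yes _ = u
        ... | no _ | no _ = mate M w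

        mt-u : mt u ≡ v
        mt-u with u Fin.≟ u | u Fin.≟ v
        ... | yes _ | _ = refl
        ... | no z | _ = ⊥-elim (z refl)

        mt-v : mt v ≡ u
        mt-v with v Fin.≟ u | v Fin.≟ v
        ... | yes r | _ = r
        ... | no _ | yes _ = refl
        ... | no _ | no z = ⊥-elim (z refl)

        mt-o : ∀ {w} → w ≢ u → w ≢ v → mt w ≡ mate M w
        mt-o {w} p q with w Fin.≟ u | w Fin.≟ v
        ... | yes r | _ = ⊥-elim (p r)
        ... | no _ | yes r = ⊥-elim (q r)
        ... | no _ | no _ = refl

      pair : Mat G
      mate pair = mt
      invol pair w with w Fin.≟ u | w Fin.≟ v
      ... | yes refl | _ = mt-v
      ... | no _ | yes refl = mt-u
      ... | no p | no q = trans (mt-o (λ r → p (trans (sym (mate-sym M r)) mu)) (λ r → q (trans (sym (mate-sym M r)) mv))) (invol M w)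
      mate-E pair {w} ne with w Fin.≟ u | w Fin.≟ v
      ... | yes refl | _ = e
      ... | no _ | yes refl = E-sym e
      ... | no _ | no _ = mate-E M ne

      pair-u : mate pair u ≡ v
      pair-u = mt-u

      pair-v : mate pair v ≡ u
      pair-v = mt-v

      pair-o : ∀ {w} → w ≢ u → w ≢ v → mate pair w ≡ mate M w
      pair-o = mt-o

      pair-fixed : ∀ {w} → mate pair w ≡ w → mate M w ≡ w × w ≢ u × w ≢ v
      pair-fixed {w} r with w Fin.≟ u | w Fin.≟ v
      ... | yes refl | _ = ⊥-elim (E-irr (subst (E G u) r e))
      ... | no _ | yes refl = ⊥-elim (E-irr (subst (λ z → E G z v) r e))
      ... | no p | no q = r , p , q

  uncov : Mat G → Fin n → Bool
  uncov M v = does (mate M v Fin.≟ v)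

  uncov⁺ : ∀ M {v} → mate M v ≡ v → v ∈ˢ uncov M
  uncov⁺ M {v} r = dec-true (mate M v Fin.≟ v) r

  uncov⁻ : ∀ M {v} → v ∈ˢ uncov M → mate M v ≡ v
  uncov⁻ M {v} r with mate M v Fin.≟ v
  ... | yes q = q

  -- There are no augmenting paths with one or three edges.
  record Good (M : Mat G) : Set where
    constructor mkGood
    field
      low  : ∀ {v} → mate M v ≡ v → DegLe G v 4
      aug₁ : ∀ {u v} → E G u v → mate M u ≡ u → mate M v ≢ v
      aug₃ : ∀ {u x u′} → E G u x → mate M x ≢ x → E G (mate M x) u′ → mate M u ≡ u → mate M u′ ≡ u′ → u ≡ u′
  open Good public

  -- Augmenting never uncovers a vertex, so the degree bound on uncovered vertices persists while
  -- their number drops.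
  augment : ∀ fuel (M : Mat G) → size (uncov M) < fuel → (∀ {v} → mate M v ≡ v → DegLe G v 4) → Σ (Mat G) Good
  augment (suc fuel) M lt lw
    with Finₚ.any? (λ u → Finₚ.any? λ v → E? G u v ×-dec (mate M u Fin.≟ u) ×-dec (mate M v Fin.≟ v))
  ... | yes (u , v , e , mu , mv) = augment fuel M′
          (<-≤-trans (size-< {s = uncov M} {uncov M′} {u} (λ {w} w∈ → uncov⁺ M {w} (proj₁ (pair-fixed M e mu mv (uncov⁻ M′ w∈)))) (uncov⁺ M mu)
             (λ u∈ → proj₁ (proj₂ (pair-fixed M e mu mv (uncov⁻ M′ u∈))) refl)) (≤-pred lt))
          (λ r → lw (proj₁ (pair-fixed M e mu mv r)))
    where
    M′ : Mat G
    M′ = pair M e mu mv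
  ... | no none₁ with Finₚ.any? (λ u → Finₚ.any? λ x → Finₚ.any? λ u′ → E? G u x ×-dec ¬? (mate M x Fin.≟ x) ×-dec E? G (mate M x) u′
                             ×-dec (mate M u Fin.≟ u) ×-dec (mate M u′ Fin.≟ u′) ×-dec ¬? (u Fin.≟ u′))
  ...   | no none₃ = M , mkGood lw (λ e mu mv → none₁ (_ , _ , e , mu , mv)) λ {u} {x} {u′} e c e′ mu mu′ → case u Fin.≟ u′ of λ where
          (yes r) → r
          (no r) → ⊥-elim (none₃ (u , x , u′ , e , c , e′ , mu , mu′ , r))
  ...   | yes (u , x , u′ , e , c , e′ , mu , mu′ , u≢u′) = augment fuel M₃
          (<-≤-trans (size-< {s = uncov M} {uncov M₃} {u} (λ {w} w∈ → uncov⁺ M {w} (proj₁ (fixed (uncov⁻ M₃ w∈)))) (uncov⁺ M mu) (λ u∈ → proj₂ (fixed (uncov⁻ M₃ u∈)) refl)) (≤-pred lt))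
          (λ r → lw (proj₁ (fixed r)))
    where
    M₁ M₂ M₃ : Mat G
    M₁ = unpair M x
    x′≢x : mate M x ≢ x
    x′≢x = c
    x′≢u : mate M x ≢ u
    x′≢u refl = c (trans (sym mu) (invol M x))
    m₁u : mate M₁ u ≡ u
    m₁u = unpair-fixed M x mu
    m₁x : mate M₁ x ≡ x
    m₁x = unpair-x M x
    M₂ = pair M₁ e m₁u m₁x
    m₂x′ : mate M₂ (mate M x) ≡ mate M x
    m₂x′ = trans (pair-o M₁ e m₁u m₁x x′≢u x′≢x) (unpair-x′ M x)
    u′≢x : u′ ≢ x
    u′≢x refl = c mu′
    m₂u′ : mate M₂ u′ ≡ u′
    m₂u′ = trans (pair-o M₁ e m₁u m₁x (≢-sym u≢u′) u′≢x) (unpair-fixed M x mu′)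
    M₃ = pair M₂ e′ m₂x′ m₂u′
    fixed : ∀ {w} → mate M₃ w ≡ w → mate M w ≡ w × w ≢ u
    fixed {w} r = let r₂ , w≢x′ , _ = pair-fixed M₂ e′ m₂x′ m₂u′ r ; r₁ , w≢u , w≢x = pair-fixed M₁ e m₁u m₁x r₂ in
      trans (sym (unpair-o M x w≢x w≢x′)) r₁ , w≢u

  -- A colour class of a 5-colouring is a start: a vertex it leaves uncovered misses that colour and
  -- has degree at most 4.
  good-matching : ∀ {f} → Ok 5 G f → Σ (Mat G) Good
  good-matching {f} ok = augment (suc (size (uncov (colour-class {f = f} ok 0)))) (colour-class ok 0) ≤-refl (λ {v} → lw {v})
    where
    lw : ∀ {v} → mate (colour-class ok 0) v ≡ v → DegLe G v 4
    lw {v} r vs u es = ≤-pred (subst (λ k → suc k ≤ 5) (length-map (f v) vs) (unique-bounded-length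
        (∉⇒All≢ {x = 0} no0 ∷ unique-map (f v) {xs = vs} (λ a b → proper ok (All.lookup es a) (All.lookup es b)) u) (s≤s z≤n ∷ map⁺ (All.map (bound ok) es))))
      where
      no0 : 0 ∉ map (f v) vs
      no0 0∈ with ∈-map⁻ (f v) 0∈
      ... | w , w∈ , q = E-≢ (All.lookup es w∈) (trans (sym r) (class-mate ok (All.lookup es w∈) (sym q)))

pick≢ : ∀ {n} {xs : List (Fin n)} → Unique xs → 2 ≤ length xs → ∀ p → ∃ λ y → y ∈ xs × y ≢ p
pick≢ {xs = a ∷ b ∷ xs} ((ab ∷ _) ∷ _) _ p with a Fin.≟ p
... | no z = a , here refl , z
... | yes refl = b , there (here refl) , ≢-sym ab
pick≢ {xs = _ ∷ []} _ (s≤s ())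

degLe-sub : ∀ {n} {G J : Gph {n}} {v k} → (∀ {y} → E J v y → E G v y) → DegLe G v k → DegLe J v k
degLe-sub f dg vs u es = dg vs u (All.map f es)

-- A matching edge that leaves the 4-regular core.

module Core {n : ℕ} {G : Gph {n}} (M : Mat G) (good : Good M) (deg : ∀ v → DegLe G v 5) (nc : NoCycle G) where

  Q : Gph
  Q = G ⊟ M

  Q-G : ∀ {x y} → E Q x y → E G x y
  Q-G = ⊟-⊆ {M = M}

  not-mate : ∀ {x y} → E Q x y → mate M x ≢ y
  not-mate (mkE (_ , p)) = p

  degQ : ∀ v → DegLe Q v 4
  degQ v with mate M v Fin.≟ v
  ... | yes r = degLe-⊆ Q-G (low good r)
  ... | no r = degLe-drop Q-G (mate-E M r) (λ e → not-mate e refl) (deg v)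

  HasCore : (Fin n → Bool) → Set
  HasCore s = ∀ {x} → x ∈ˢ s → 4 ≤ length (nbrs (inside Q s) x)

  module _ (s : Fin n → Bool) (core : HasCore s) where

    -- The four neighbours inside already exhaust the degree, so `s` is a union of components of
    -- `Q`.
    closed : ∀ {x y} → x ∈ˢ s → E Q x y → y ∈ˢ s
    closed {x} {y} x∈ e with y ∈ˢ? s
    ... | yes y∈ = y∈
    ... | no y∉ = ⊥-elim (<⇒≱ (core x∈) (degLe-drop inside-⊆ e (λ { (mkE (_ , _ , y∈)) → y∉ y∈ }) (degQ x) (nbrs (inside Q s) x) (nbrs-unique _ x) (All.tabulate nbrs-∈)))

    nbr≢ : ∀ {x} → x ∈ˢ s → ∀ p → ∃ λ y → E Q x y × y ≢ p
    nbr≢ {x} x∈ p = let y , y∈ , ne = pick≢ (nbrs-unique (inside Q s) x) (≤-trans (s≤s (s≤s z≤n)) (core x∈)) p in y , inside-⊆ (nbrs-∈ y∈) , ne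

    Exit : Set
    Exit = ∃ λ x → ∃ λ u → x ∈ˢ s × E Q x u × mate M u ≡ u × ¬ mate M x ∈ˢ s

    -- Otherwise a core vertex with an uncovered neighbour always has its mate in the core. Then
    -- from every live vertex one can go on without turning back, along a `Q`-edge to a covered
    -- neighbour or along the matching edge. Live vertices have four `Q`-edges and a mate, so this
    -- contradicts acyclicity.
    exit : ∀ {x₀} → x₀ ∈ˢ s → Exit
    exit {x₀} x₀∈ with Finₚ.any? (λ x → Finₚ.any? λ u → (x ∈ˢ? s) ×-dec E? Q x u ×-dec (mate M u Fin.≟ u) ×-dec ¬? (mate M x ∈ˢ? s))
    ... | yes found = found
    ... | no none = ⊥-elim (absurd start)
      where
      kept : ∀ {x u} → x ∈ˢ s → E Q x u → mate M u ≡ u → mate M x ∈ˢ s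
      kept {x} {u} x∈ e mu with mate M x ∈ˢ? s
      ... | yes p = p
      ... | no p = ⊥-elim (none (x , u , x∈ , e , mu , p))

      record Live (v : Fin n) : Set where
        constructor mkLive
        field
          in-s : v ∈ˢ s
          cov  : mate M v ≢ v
          nb   : Fin n
          nbE  : E Q v nb
          nbC  : mate M nb ≢ nb
      open Live

      live-nbr : ∀ {v w} → v ∈ˢ s → mate M v ≢ v → E Q v w → mate M w ≢ w → Live w
      live-nbr {v} v∈ c e c′ = mkLive (closed v∈ e) c′ v (E-sym e) c

      -- An uncovered neighbour of the mate other than `u` would complete an augmenting path of
      -- three edges.
      live-mate : ∀ {v u} → v ∈ˢ s → mate M v ≢ v → E Q v u → mate M u ≡ u → Live (mate M v)
      live-mate {v} {u} v∈ c e mu with kept v∈ e mu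
      ... | m∈ with nbr≢ m∈ u
      ...   | u′ , e′ , u′≢u with mate M u′ Fin.≟ u′
      ...     | yes mu′ = ⊥-elim (u′≢u (sym (aug₃ good (Q-G (E-sym e)) c (Q-G e′) mu mu′)))
      ...     | no c′ = mkLive m∈ (λ r → c (trans (sym r) (invol M v))) u′ e′ c′

      big : ∀ {v} → Live v → Big G v
      big {v} l = mkBig (mate M v ∷ vs) (∉⇒All≢ (λ m∈ → not-mate (inside-⊆ (nbrs-∈ m∈)) refl) ∷ nbrs-unique _ v)
        (mate-E M (cov l) ∷ All.tabulate (λ y∈ → Q-G (inside-⊆ (nbrs-∈ y∈)))) (s≤s (core (in-s l)))
        where
        vs : List (Fin n)
        vs = nbrs (inside Q s) v

      next : ∀ {v} → Live v → ∀ p → ∃ λ w → E G v w × w ≢ p × Live w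
      next {v} l p with Finₚ.any? (λ y → E? Q v y ×-dec ¬? (mate M y Fin.≟ y) ×-dec ¬? (y Fin.≟ p))
      ... | yes (y , e , c , ne) = y , Q-G e , ne , live-nbr (in-s l) (cov l) e c
      ... | no none′ with nbr≢ (in-s l) p
      ...   | u , e , u≢p with mate M u Fin.≟ u
      ...     | no c = ⊥-elim (none′ (u , e , c , u≢p))
      ...     | yes mu = mate M v , mate-E M (cov l) , m≢p , live-mate (in-s l) (cov l) e mu
        where
        -- If every covered `Q`-neighbour of `v` is `p`, then `p` is joined to `v` in `Q` and so is
        -- not its mate; the matching edge does not turn back.
        m≢p : mate M v ≢ p
        m≢p r with nb l Fin.≟ p
        ... | yes q = not-mate (nbE l) (trans r (sym q))
        ... | no q = none′ (nb l , nbE l , nbC l , q)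

      walk : ∀ fuel {v p P} → n < fuel + length P → Unique (v ∷ p ∷ P) → All (Big G) (v ∷ p ∷ P) → Linked (E G) (v ∷ p ∷ P) → Live v → ⊥
      walk zero {P = P} lt (_ ∷ _ ∷ u) _ _ _ = <⇒≱ lt (unique-length-≤n P u)
      walk (suc fuel) {v} {p} lt u b lk l with next l p
      ... | w , e , ne , l′ = walk fuel (≤-trans lt (≤-reflexive (sym (+-suc fuel _)))) (∉⇒All≢ (no-return nc u b lk e ne) ∷ u) (big l′ ∷ b) (E-sym e ∷ lk) l′

      absurd : (∃ λ v → Live v) → ⊥
      absurd (v , l) with next l v
      ... | w , e , ne , l′ = walk (suc n) (s≤s (≤-reflexive (sym (+-identityʳ n)))) ((ne ∷ []) ∷ [] ∷ []) (big l′ ∷ big l ∷ []) (E-sym e ∷ [-]) l′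

      from-covered : ∀ {v} → v ∈ˢ s → mate M v ≢ v → ∃ λ v → Live v
      from-covered {v} v∈ c with nbr≢ v∈ v
      ... | y , e , _ with mate M y Fin.≟ y
      ...   | yes my = mate M v , live-mate v∈ c e my
      ...   | no cy = v , mkLive v∈ c y e cy

      start : ∃ λ v → Live v
      start with mate M x₀ Fin.≟ x₀
      ... | no c = from-covered x₀∈ c
      ... | yes mx with nbr≢ x₀∈ x₀
      ...   | y , e , _ = from-covered (closed x₀∈ e) (aug₁ good (Q-G e) mx)

pair-right : ∀ {n} {v w y : Fin n} → v ≢ w → Pair v w w y → y ≡ v
pair-right _ bwd = refl
pair-right ne fwd = ⊥-elim (ne refl)

-- Since x′ lies outside S, exchanging the colours b of xu and 5 of xx′ changes only the degrees of x and u
-- inside S, which then drop to 3.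
module Swap {n : ℕ} {G : Gph {n}} (M : Mat G) (good : Good M) (deg : ∀ v → DegLe G v 5) (nc : NoCycle G)
            (S : Fin n → Bool) (core : Core.HasCore M good deg nc S) {x u : Fin n} (x∈ : x ∈ˢ S) (exu : E (G ⊟ M) x u) (mu : mate M u ≡ u)
            (x′∉ : ¬ mate M x ∈ˢ S) where
  open Core M good deg nc

  x′ : Fin n
  x′ = mate M x

  u∈ : u ∈ˢ S
  u∈ = closed S core x∈ exu

  x≢x′ : x ≢ x′
  x≢x′ r = x′∉ (subst (_∈ˢ S) r x∈)

  u≢x′ : u ≢ x′
  u≢x′ r = x′∉ (subst (_∈ˢ S) r u∈)

  x≢u : x ≢ u
  x≢u = E-≢ exu

  exx′ : E G x x′
  exx′ = mate-E M (≢-sym x≢x′)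

  M₁ M′ : Mat G
  M₁ = unpair M x
  M′ = pair M₁ (Q-G exu) (unpair-x M x) (unpair-fixed M x mu)

  mx : mate M′ x ≡ u
  mx = pair-u M₁ (Q-G exu) (unpair-x M x) (unpair-fixed M x mu)

  mu′ : mate M′ u ≡ x
  mu′ = pair-v M₁ (Q-G exu) (unpair-x M x) (unpair-fixed M x mu)

  mx′ : mate M′ x′ ≡ x′
  mx′ = trans (pair-o M₁ (Q-G exu) (unpair-x M x) (unpair-fixed M x mu) (≢-sym x≢x′) (≢-sym u≢x′)) (unpair-x′ M x)

  mo : ∀ {w} → w ≢ x → w ≢ u → w ≢ x′ → mate M′ w ≡ mate M w
  mo p q r = trans (pair-o M₁ (Q-G exu) (unpair-x M x) (unpair-fixed M x mu) p q) (unpair-o M x p r)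

  Q′ : Gph
  Q′ = G ⊟ M′

  Q′-G : ∀ {a c} → E Q′ a c → E G a c
  Q′-G = ⊟-⊆ {M = M′}

  mate′⇒ : ∀ {a c} → E G a c → ¬ Pair x u a c → mate M′ a ≡ c → mate M a ≡ c
  mate′⇒ {a} {c} e np r = go (a Fin.≟ x) (a Fin.≟ u) (a Fin.≟ x′)
    where
    go : Dec (a ≡ x) → Dec (a ≡ u) → Dec (a ≡ x′) → mate M a ≡ c
    go (yes refl) _ _ = ⊥-elim (np (subst (Pair x u x) (trans (sym mx) r) fwd))
    go (no _) (yes refl) _ = ⊥-elim (np (subst (Pair x u u) (trans (sym mu′) r) bwd))
    go (no _) (no _) (yes refl) = ⊥-elim (E-irr (subst (E G x′) (trans (sym r) mx′) e))
    go (no p) (no q) (no s) = trans (sym (mo p q s)) r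

  mate⇒ : ∀ {a c} → E G a c → ¬ Pair x x′ a c → mate M a ≡ c → mate M′ a ≡ c
  mate⇒ {a} {c} e np r = go (a Fin.≟ x) (a Fin.≟ u) (a Fin.≟ x′)
    where
    go : Dec (a ≡ x) → Dec (a ≡ u) → Dec (a ≡ x′) → mate M′ a ≡ c
    go (yes refl) _ _ = ⊥-elim (np (subst (Pair x x′ x) r fwd))
    go (no _) (yes refl) _ = ⊥-elim (E-irr (subst (E G u) (trans (sym r) mu) e))
    go (no _) (no _) (yes refl) = ⊥-elim (np (subst (Pair x x′ x′) (trans (sym (invol M x)) r) bwd))
    go (no p) (no q) (no s) = trans (mo p q s) r

  Q⇒Q′ : ∀ {a c} → E Q a c → ¬ Pair x u a c → E Q′ a c
  Q⇒Q′ (mkE (e , m)) np = mkE (e , m ∘ mate′⇒ e np)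

  Q′⇒Q : ∀ {a c} → E Q′ a c → ¬ Pair x x′ a c → E Q a c
  Q′⇒Q (mkE (e , m)) np = mkE (e , m ∘ mate⇒ e np)

  exx′₂ : E Q′ x x′
  exx′₂ = mkE (exx′ , λ r → u≢x′ (trans (sym mx) r))

  not-xx′ : ∀ {a c} → E Q a c → ¬ Pair x x′ a c
  not-xx′ e fwd = not-mate e refl
  not-xx′ e bwd = not-mate e (invol M x)

  not-xu : ∀ {a c} → E Q′ a c → ¬ Pair x u a c
  not-xu (mkE (_ , m)) fwd = m mx
  not-xu (mkE (_ , m)) bwd = m mu′

  module _ {b : ℕ} (b<5 : b < 5) where

    swap-step : ∀ {χ χ′} → Ok 5 Q χ → Ok 5 Q′ χ′ → χ x u ≡ b → χ′ x x′ ≡ b → (∀ {a c} → E Q a c → ¬ Pair x u a c → χ a c ≡ χ′ a c) →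
                Kempe 6 G (glue M 5 χ) (glue M′ 5 χ′)
    swap-step {χ} {χ′} ok ok′ r r′ ag = step-kempe (glue-ok M ok) (glue-ok M′ ok′) (mkK λ {a} {c} e → aux e (pair? x x′ a c) (pair? x u a c) (mate M a Fin.≟ c))
      where
      aux : ∀ {a c} → E G a c → Dec (Pair x x′ a c) → Dec (Pair x u a c) → Dec (mate M a ≡ c) → Rel b 5 (glue M 5 χ a c) (glue M′ 5 χ′ a c)
      aux e (yes fwd) _ _ = inj₂ (inj₂ (glue-on M refl) , inj₁ (trans (glue-off M′ (λ q → u≢x′ (trans (sym mx) q))) r′))
      aux e (yes bwd) _ _ = inj₂ (inj₂ (glue-on M (invol M x)) , inj₁ (trans (glue-off M′ (λ q → x≢x′ (trans (sym q) mx′))) (trans (sym (symm ok′ exx′₂)) r′)))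
      aux e (no _) (yes fwd) _ = inj₂ (inj₁ (trans (glue-off M (not-mate exu)) r) , inj₂ (glue-on M′ mx))
      aux e (no _) (yes bwd) _ = inj₂ (inj₁ (trans (glue-off M (not-mate (E-sym exu))) (trans (sym (symm ok exu)) r)) , inj₂ (glue-on M′ mu′))
      aux e (no p) (no _) (yes m) = inj₁ (trans (glue-on M m) (sym (glue-on M′ (mate⇒ e p m))))
      aux e (no _) (no q) (no m) = inj₁ (trans (glue-off M m) (trans (ag (mkE (e , m)) q) (sym (glue-off M′ (m ∘ mate′⇒ e q)))))

    forward-ok : ∀ {χ} → Ok 5 Q χ → χ x u ≡ b → Misses Q χ x′ b → Ok 5 Q′ (upd χ x x′ b)
    forward-ok {χ} ok r m = upd-ok x≢x′ (Ok-⊆ sub ok) b<5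
      (λ { (see y (mkE (e , p)) q) → not-xu e (subst (Pair x u x) (proper ok exu (Q′⇒Q e p) (trans r (sym q))) fwd) })
      (λ { (see y e q) → m (see y (sub e) q) })
      where
      sub : ∀ {a c} → E (Q′ ∖ (x , x′)) a c → E Q a c
      sub (mkE (e , p)) = Q′⇒Q e p

    -- Colours may be transposed inside `S` alone because `S` is a union of components of `Q`; this
    -- prepares `xu` for the exchange with `xx′`.
    permute : ∀ {χ} → Ok 5 Q χ → ∃ λ χ₁ → Ok 5 Q χ₁ × χ₁ x u ≡ b × Kempe 5 Q χ χ₁ × (∀ {a c} → ¬ (a ∈ˢ S × c ∈ˢ S) → χ₁ a c ≡ χ a c)
    permute {χ} ok = χ₁ , ok₁ , trans (overlay-on {R = inside Q S} (mkE (exu , x∈ , u∈))) (tr-1 e b) , step-kempe ok ok₁ k ,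
        λ out → overlay-off {R = inside Q S} (λ { (mkE (_ , p , q)) → out (p , q) })
      where
      e : ℕ
      e = χ x u
      χ₁ : Col
      χ₁ = overlay (inside Q S) χ (perm e b χ)
      ok₁ : Ok 5 Q χ₁
      ok₁ = overlay-ok {R = inside Q S} ok (perm-ok (bound ok exu) b<5 (Ok-⊆ inside-⊆ ok))
        (mkApart λ { (mkE (f , p , q)) g ¬in _ → ¬in (mkE (g , p , closed S core p g)) })
      k : K e b Q χ χ₁
      k = mkK λ {a} {c} f → aux a c
        where
        aux : ∀ a c → Rel e b (χ a c) (χ₁ a c)
        aux a c with E? (inside Q S) a c
        ... | yes _ = tr-rel e b (χ a c)
        ... | no _ = inj₁ refl

  -- The vertex `x′` is added so that `xx′` belongs to the graph being rearranged and its colour can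
  -- be frozen; `x′` is pendant there.
  S⁺ : Fin n → Bool
  S⁺ v with v Fin.≟ x′
  ... | yes _ = true
  ... | no _ = S v

  S⁺-x′ : x′ ∈ˢ S⁺
  S⁺-x′ with x′ Fin.≟ x′
  ... | yes _ = refl
  ... | no z = ⊥-elim (z refl)

  S⁺-S : ∀ {v} → v ∈ˢ S → v ∈ˢ S⁺
  S⁺-S {v} p with v Fin.≟ x′
  ... | yes _ = refl
  ... | no _ = p

  S⁺⇒ : ∀ {v} → v ∈ˢ S⁺ → v ≡ x′ ⊎ v ∈ˢ S
  S⁺⇒ {v} p with v Fin.≟ x′
  ... | yes r = inj₁ r
  ... | no _ = inj₂ p

  A : Gph
  A = inside Q′ S⁺

  A-Q′ : ∀ {a c} → E A a c → E Q′ a c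
  A-Q′ = inside-⊆

  x′-nbr : ∀ {y} → E A x′ y → y ≡ x
  x′-nbr {y} (mkE (e , _ , y∈)) with S⁺⇒ {y} y∈ | pair? x x′ x′ y
  ... | inj₁ refl | _ = ⊥-elim (E-irr e)
  ... | inj₂ _ | yes p = pair-right x≢x′ p
  ... | inj₂ y∈S | no p = ⊥-elim (x′∉ (closed S core y∈S (E-sym (Q′⇒Q e p))))

  closed′ : ∀ {v w} → v ∈ˢ S → E Q′ v w → E A v w
  closed′ {v} {w} v∈ e with pair? x x′ v w
  ... | yes fwd = mkE (e , S⁺-S {v} v∈ , S⁺-x′)
  ... | yes bwd = ⊥-elim (x′∉ v∈)
  ... | no p = mkE (e , S⁺-S {v} v∈ , S⁺-S {w} (closed S core v∈ (Q′⇒Q e p)))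

  degA : ∀ v → DegLe A v 4
  degA v with v Fin.≟ x′ | v Fin.≟ x
  ... | yes refl | _ = λ vs us es → ≤-trans (degLe-list (x ∷ []) (λ e → here (x′-nbr e)) vs us es) (s≤s z≤n)
  ... | no _ | yes refl = degLe-drop (Q′-G ∘ A-Q′) (Q-G exu) (λ e → not-xu (A-Q′ e) fwd) (deg x)
  ... | no p | no q = degLe-sub (λ e → Q′⇒Q (A-Q′ e) λ { fwd → q refl ; bwd → p refl }) (degQ v)

  opaque
    res : Residual A S⁺
    res = peel (suc (size S⁺)) A S⁺ ≤-refl degA (λ { (mkE (_ , p , _)) → p })

  open Residual res using () renaming (s to s; sub to s⊆; core to s-core; compl to s-complete) public

  s-four : ∀ {v} → DegLe (inside A s) v 3 → ¬ v ∈ˢ s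
  s-four {v} dg v∈ = <⇒≱ (s-core v∈) (dg (nbrs (inside A s) v) (nbrs-unique _ v) (All.tabulate nbrs-∈))

  x′∉s : ¬ x′ ∈ˢ s
  x′∉s = s-four (λ vs us es → ≤-trans (degLe-list (x ∷ []) (λ e → here (x′-nbr (inside-⊆ e))) vs us es) (s≤s z≤n))

  x∉s : ¬ x ∈ˢ s
  x∉s = s-four (degLe-drop inside-⊆ (closed′ x∈ exx′₂) (λ { (mkE (_ , _ , p)) → x′∉s p }) (degA x))

  u∉s : ¬ u ∈ˢ s
  u∉s = s-four (degLe-drop {w = x} sub (E-sym exu) (λ e → not-xu (A-Q′ (inside-⊆ e)) bwd) (degQ u))
    where
    sub : ∀ {a c} → E (inside A s) a c → E Q a c
    sub (mkE (e , p , q)) = Q′⇒Q (A-Q′ e) λ { fwd → x′∉s q ; bwd → x′∉s p }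

  s⊆S : ∀ {v} → v ∈ˢ s → v ∈ˢ S
  s⊆S {v} v∈ with S⁺⇒ {v} (s⊆ v∈)
  ... | inj₁ refl = ⊥-elim (x′∉s v∈)
  ... | inj₂ p = p

  smaller : size s < size S
  smaller = size-< {s = S} {s} {x} s⊆S x∈ x∉s

  core-s : HasCore s
  core-s {v} v∈ = ≤-trans (s-core v∈) (nbrs-mono {G = inside A s} {inside Q s} (λ { (mkE (e , p , q)) → mkE (Q′⇒Q (A-Q′ e) (λ { fwd → x′∉s q ; bwd → x′∉s p }) , p , q) }))

  R : Gph
  R = outside A s

  eR : E R x x′
  eR = mkE (closed′ x∈ exx′₂ , λ (_ , q) → x′∉s q)

  R-Q′ : ∀ {a c} → E R a c → E Q′ a c
  R-Q′ e = A-Q′ (outside-⊆ e)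

  closed-s : ∀ {v w} → v ∈ˢ s → E A v w → w ∈ˢ s
  closed-s {v} {w} v∈ e with w ∈ˢ? s
  ... | yes p = p
  ... | no p = ⊥-elim (s-four (degLe-drop inside-⊆ e (λ { (mkE (_ , _ , q)) → p q }) (degA v)) v∈)

  module _ {b : ℕ} (b<5 : b < 5) where

    -- Edges of `R` meet the other edges only at `x′`, since `s` is a union of components of `A`.
    -- There the sole `R`-edge is `xx′`, and it has the same colour `b` in both colourings.
    apart : ∀ {φ′ χ} → Ok 5 Q′ φ′ → φ′ x x′ ≡ b → Ok 5 R χ → χ x x′ ≡ b → Apart Q′ R φ′ χ
    apart {φ′} {χ} ok r okχ r′ = mkApart go
      where
      φ′b : φ′ x′ x ≡ b
      φ′b = trans (sym (symm ok exx′₂)) r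
      go : ∀ {a c w} → E R a c → E Q′ a w → ¬ E R a w → χ a c ≢ φ′ a w
      go {a} {c} {w} (mkE (e , out)) f ¬R q with S⁺⇒ {a} (proj₁ (proj₂ (unE e)))
      ... | inj₂ a∈ = out (a∈s , closed-s a∈s e)
        where
        ea : E A a w
        ea = closed′ a∈ f
        a∈s : a ∈ˢ s
        a∈s with a ∈ˢ? s
        ... | yes p = p
        ... | no p = ⊥-elim (¬R (mkE (ea , λ (p′ , _) → p p′)))
      ... | inj₁ refl = ¬R (subst (E R x′) (proper ok (E-sym exx′₂) f (trans φ′b (trans (sym χb) q))) (E-sym eR))
        where
        χb : χ x′ c ≡ b
        χb = trans (cong (χ x′) (x′-nbr e)) (trans (sym (symm okχ eR)) r′)

    -- A conjugation: pass from `M` to `M′`, rearrange `R` to match ω with `xx′` frozen at `b`, and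
    -- pass back. Disagreement with ω survives only inside `s`.
    round : ∀ {χ ω} → Ok 5 Q χ → Ok 5 Q ω → χ x u ≡ b → ω x u ≡ b → Misses Q χ x′ b → Misses Q ω x′ b →
            (∀ {a c} → E Q a c → ¬ (a ∈ˢ S × c ∈ˢ S) → χ a c ≡ ω a c) →
            ∃ λ χ₂ → Ok 5 Q χ₂ × Kempe 6 G (glue M 5 χ) (glue M 5 χ₂) × (∀ {a c} → E Q a c → ¬ (a ∈ˢ s × c ∈ˢ s) → χ₂ a c ≡ ω a c)
    round {χ} {ω} okχ okω χb ωb χm ωm ag = χ₂ , ok₂ ,
        (swap-step b<5 okχ okχ′ χb χ′b (λ e p → sym (upd-off χ (not-xx′ e)))
         ◅◅ subst-start (glue-kempe M′ (overlay-ok okχ′ (Ok-⊆ R-Q′ okχ′) (apart okχ′ χ′b (Ok-⊆ R-Q′ okχ′) χ′b))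
              (overlay-path okχ′ (λ { (mkF st@(o , o′ , _) r r′) → st , apart okχ′ χ′b o r , apart okχ′ χ′b o′ r′ })
                (frozen eR b<5 (Ok-⊆ R-Q′ okχ′) (Ok-⊆ R-Q′ okω′) χ′b ω′b (s-complete (Ok-⊆ R-Q′ okχ′) (Ok-⊆ R-Q′ okω′)))))
         ◅◅ Kempe-sym (swap-step b<5 ok₂ okχ″ (upd-on χ″ {x} {u} fwd) χ″b (λ e p → upd-off χ″ p))) , agree
      where
      χ′ ω′ χ″ χ₂ : Col
      χ′ = upd χ x x′ b
      ω′ = upd ω x x′ b
      okχ′ : Ok 5 Q′ χ′
      okχ′ = forward-ok b<5 okχ χb χm
      okω′ : Ok 5 Q′ ω′
      okω′ = forward-ok b<5 okω ωb ωm
      χ′b : χ′ x x′ ≡ b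
      χ′b = upd-on χ {x} {x′} fwd
      ω′b : ω′ x x′ ≡ b
      ω′b = upd-on ω {x} {x′} fwd
      χ″ = overlay R χ′ ω′
      okχ″ : Ok 5 Q′ χ″
      okχ″ = overlay-ok okχ′ (Ok-⊆ R-Q′ okω′) (apart okχ′ χ′b (Ok-⊆ R-Q′ okω′) ω′b)
      χ″b : χ″ x x′ ≡ b
      χ″b = trans (overlay-on {R = R} eR) ω′b
      χ₂ = upd χ″ x u b
      subst-start : ∀ {ρ} → Kempe 6 G (glue M′ 5 (overlay R χ′ χ′)) ρ → Kempe 6 G (glue M′ 5 χ′) ρ
      subst-start k = glue-kempe M′ okχ′ (agree-kempe okχ′ (mkA λ {a} {c} _ → overlay-same R χ′ a c)) ◅◅ k
      u-R : ∀ {w} → E Q′ u w → E R u w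
      u-R e = mkE (closed′ u∈ e , λ (p , _) → u∉s p)
      ok₂ : Ok 5 Q χ₂
      ok₂ = upd-ok x≢u (Ok-⊆ (λ { (mkE (e , p)) → Q⇒Q′ e p }) okχ″) b<5
        (λ { (see y (mkE (e , p)) q) → not-xx′ e (subst (Pair x x′ x) (proper okχ″ exx′₂ (Q⇒Q′ e p) (trans χ″b (sym q))) fwd) })
        (λ { (see y (mkE (e , p)) q) → p (subst (Pair x u u) (proper okω (E-sym exu) e
               (trans (trans (sym (symm okω exu)) ωb) (trans (sym q) (trans (overlay-on {R = R} (u-R (Q⇒Q′ e p))) (upd-off ω (not-xx′ e)))))) bwd) })
      agree : ∀ {a c} → E Q a c → ¬ (a ∈ˢ s × c ∈ˢ s) → χ₂ a c ≡ ω a c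
      agree {a} {c} e out = go (pair? x u a c) (E? R a c)
        where
        go : Dec (Pair x u a c) → Dec (E R a c) → χ₂ a c ≡ ω a c
        go (yes fwd) _ = trans (upd-on χ″ {x} {u} fwd) (sym ωb)
        go (yes bwd) _ = trans (upd-on χ″ {x} {u} bwd) (sym (trans (sym (symm okω exu)) ωb))
        go (no p) (yes r) = trans (upd-off χ″ p) (trans (overlay-on {R = R} r) (upd-off ω (not-xx′ e)))
        go (no p) (no ¬r) = trans (upd-off χ″ p) (trans (overlay-off {R = R} ¬r) (trans (upd-off χ (not-xx′ e))
          (ag e λ (a∈ , c∈) → ¬r (mkE (mkE (Q⇒Q′ e p , S⁺-S {a} a∈ , S⁺-S {c} c∈) , out)))))

module _ {n : ℕ} {G : Gph {n}} (M : Mat G) (good : Good M) (deg : ∀ v → DegLe G v 5) (nc : NoCycle G) where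
  open Core M good deg nc

  -- `S` confines the remaining disagreement, and each round replaces it by a strictly smaller core.
  off-core : ∀ fuel S → size S < fuel → HasCore S → ∀ {φ ψ} → Ok 5 Q φ → Ok 5 Q ψ → (∀ {a c} → E Q a c → ¬ (a ∈ˢ S × c ∈ˢ S) → φ a c ≡ ψ a c) →
             Kempe 6 G (glue M 5 φ) (glue M 5 ψ)
  off-core (suc fuel) S lt core {φ} {ψ} okφ okψ ag with Finₚ.any? (_∈ˢ? S)
  ... | no none = glue-kempe M okφ (agree-kempe okφ (mkA λ e → ag e (λ (p , _) → none (_ , p))))
  ... | yes (_ , x₀∈) with exit S core x₀∈
  ...   | x , u , x∈ , exu , mu , x′∉ with one-missing okφ (degQ (mate M x))
  ...     | b , b< , mb =
    let open Swap M good deg nc S core x∈ exu mu x′∉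
        -- The mate of `x` lies outside `S`, where φ and ψ agree, so one colour `b` serves both.
        mbψ : Misses Q ψ (mate M x) b
        mbψ = λ { (see y e r) → mb (see y e (trans (ag e (x′∉ ∘ proj₁)) r)) }
        χ , okχ , χb , kχ , χ-off = permute b< okφ
        ω , okω , ωb , kω , ω-off = permute b< okψ
        χ₂ , ok₂ , k , ag₂ = round b< okχ okω χb ωb
           (λ { (see y e r) → mb (see y e (trans (sym (χ-off (x′∉ ∘ proj₁))) r)) })
           (λ { (see y e r) → mbψ (see y e (trans (sym (ω-off (x′∉ ∘ proj₁))) r)) })
           (λ e out → trans (χ-off out) (trans (ag e out) (sym (ω-off out))))
    in glue-kempe M okφ kχ ◅◅ k ◅◅ off-core fuel s (<-≤-trans smaller (≤-pred lt)) core-s ok₂ okω ag₂ ◅◅ Kempe-sym (glue-kempe M okψ kω)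

  -- Outside the core of `Q` the colourings are first made to agree; no clash arises, because the
  -- core is a union of components of `Q`.
  five-colourings : ∀ {f g} → Ok 5 G f → Ok 5 G g → Kempe 6 G f g
  five-colourings {f} {g} okf okg = paint M okf ◅◅ glue-kempe M okf₀ (agree-kempe okf₀ (mkA λ {a} {c} _ → overlay-same (outside Q s) f a c))
      ◅◅ glue-kempe M (overlay-ok okf₀ (Ok-⊆ outside-⊆ okf₀) ap)
           (overlay-path okf₀ (λ st → st , ap , ap) (compl (Ok-⊆ outside-⊆ okf₀) (Ok-⊆ outside-⊆ okg₀)))
      ◅◅ off-core (suc (size s)) s ≤-refl core (overlay-ok okf₀ (Ok-⊆ outside-⊆ okg₀) ap) okg₀
           (λ e out → overlay-on {R = outside Q s} (mkE (e , out)))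
      ◅◅ Kempe-sym (paint M okg)
    where
    okf₀ : Ok 5 Q f
    okf₀ = Ok-⊆ Q-G okf
    okg₀ : Ok 5 Q g
    okg₀ = Ok-⊆ Q-G okg
    all : Fin n → Bool
    all _ = true
    open Residual (peel (suc (size all)) Q all ≤-refl degQ (λ _ → refl))
    ap : ∀ {χ} → Apart Q (outside Q s) f χ
    ap {χ} = mkApart go
      where
      go : ∀ {a c w} → E (outside Q s) a c → E Q a w → ¬ E (outside Q s) a w → χ a c ≢ f a w
      go {a} {c} {w} (mkE (e , out)) f ¬o _ = out (a∈ , closed s core a∈ e)
        where
        a∈ : a ∈ˢ s
        a∈ with a ∈ˢ? s
        ... | yes p = p
        ... | no p = ⊥-elim (¬o (mkE (f , p ∘ proj₁)))

base-case : ∀ {n} → Base {n}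
base-case G nc okf okg = let M , good = good-matching okf in five-colourings M good (ok-degLe okf) nc okf okg

-- Translation back to edge colourings and interchanges of single components.

module _ {A : Set} {P Q : A → Set} (P? : Decidable P) (Q? : Decidable Q) (sub : ∀ {x} → P x → Q x) where

  filter-≤ : ∀ xs → length (filter P? xs) ≤ length (filter Q? xs)
  filter-≤ [] = z≤n
  filter-≤ (x ∷ xs) with P? x | Q? x
  ... | yes _ | yes _ = s≤s (filter-≤ xs)
  ... | yes p | no ¬q = ⊥-elim (¬q (sub p))
  ... | no _ | yes _ = m≤n⇒m≤1+n (filter-≤ xs)
  ... | no _ | no _ = filter-≤ xs

  filter-< : ∀ {x} xs → x ∈ xs → Q x → ¬ P x → length (filter P? xs) < length (filter Q? xs)
  filter-< (x ∷ xs) (here refl) q ¬p with P? x | Q? x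
  ... | yes p | _ = ⊥-elim (¬p p)
  ... | no _ | yes _ = s≤s (filter-≤ xs)
  ... | no _ | no ¬q = ⊥-elim (¬q q)
  filter-< (y ∷ xs) (there x∈) q ¬p with P? y | Q? y
  ... | yes _ | yes _ = s≤s (filter-< xs x∈ q ¬p)
  ... | yes p′ | no ¬q = ⊥-elim (¬q (sub p′))
  ... | no _ | yes _ = m≤n⇒m≤1+n (filter-< xs x∈ q ¬p)
  ... | no _ | no _ = filter-< xs x∈ q ¬p

module Reach {A : Set} (xs : List A) (all : ∀ x → x ∈ xs) (_≟_ : ∀ (x y : A) → Dec (x ≡ y)) {R : A → A → Set} (R? : ∀ x y → Dec (R x y)) (x₀ : A) where

  open import Data.List.Membership.DecPropositional _≟_ using (_∈?_)

  -- An explicit finite list of what `Star R` reaches from `x₀`; it makes membership in a Kempe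
  -- component decidable.
  record Closure : Set where
    constructor mkClosure
    field
      found  : List A
      start  : x₀ ∈ found
      sound  : ∀ {y} → y ∈ found → Star R x₀ y
      closed : ∀ {y z} → y ∈ found → R y z → z ∈ found

  close : ∀ fuel (L : List A) → length xs < fuel + length L → Unique L → x₀ ∈ L → (∀ {y} → y ∈ L → Star R x₀ y) → Closure
  close zero L lt u x∈ s = ⊥-elim (<⇒≱ lt (unique-⊆-length L xs u (λ {x} _ → all x)))
  close (suc fuel) L lt u x∈ s with Any.any? (λ z → ¬? (z ∈? L) ×-dec Any.any? (λ y → R? y z) L) xs
  ... | yes some = let z , _ , z∉ , any = find some ; y , y∈ , r = find any in
        close fuel (z ∷ L) (≤-trans lt (≤-reflexive (sym (+-suc fuel (length L))))) (All.tabulate (λ { y∈ refl → z∉ y∈ }) ∷ u) (there x∈)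
          (λ { (here refl) → s y∈ ◅◅ (r ◅ ε) ; (there p) → s p })
  ... | no none = mkClosure L x∈ s (λ {y} {z} y∈ r → case z ∈? L of λ where
        (yes p) → p
        (no p) → ⊥-elim (none (lose (all z) (p , lose y∈ r))))

  closure : Closure
  closure = close (suc (length xs)) (x₀ ∷ []) (s≤s (≤-trans (n≤1+n _) (≤-reflexive (trans (cong suc (sym (+-identityʳ _))) (sym (+-suc (length xs) 0)))))) ([] ∷ []) (here refl) (λ { (here refl) → ε })

module Edges {n : ℕ} (G : Graph n) where
  open Edge
  open UIP.Decidable⇒UIP Bool._≟_ using (≡-irrelevant)

  edge-≡ : ∀ {e e′ : Edge G} → u e ≡ u e′ → v e ≡ v e′ → e ≡ e′
  edge-≡ {edge a b p q} {edge a b p′ q′} refl refl = cong₂ (edge a b) (≤-irrelevant p p′) (≡-irrelevant q q′)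

  _≟ᵉ_ : ∀ (e e′ : Edge G) → Dec (e ≡ e′)
  e ≟ᵉ e′ = map′ (λ (p , q) → edge-≡ p q) (λ { refl → refl , refl }) ((u e Fin.≟ u e′) ×-dec (v e Fin.≟ v e′))

  edges-at : Fin n × Fin n → List (Edge G)
  edges-at (a , b) with a Finₚ.<? b | Graph.adj G a b Bool.≟ true
  ... | yes p | yes q = edge a b p q ∷ []
  ... | _ | _ = []

  edges : List (Edge G)
  edges = concatMap edges-at (cartesianProduct (allFin n) (allFin n))

  ∈-edges : ∀ e → e ∈ edges
  ∈-edges e = ∈-concatMap⁺ edges-at (lose (∈-cartesianProduct⁺ (∈-allFin (u e)) (∈-allFin (v e))) (here′ e))
    where
    here′ : ∀ e → e ∈ edges-at (u e , v e)
    here′ (edge a b p q) with a Finₚ.<? b | Graph.adj G a b Bool.≟ true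
    ... | yes p′ | yes q′ = here (edge-≡ refl refl)
    ... | yes _ | no ¬q = ⊥-elim (¬q q)
    ... | no ¬p | _ = ⊥-elim (¬p p)

  incident? : ∀ w e → Dec (Incident G w e)
  incident? w e = (u e Fin.≟ w) ⊎-dec (v e Fin.≟ w)

  adjEdges? : ∀ e e′ → Dec (AdjEdges G e e′)
  adjEdges? e e′ = ¬? ((u e Fin.≟ u e′) ×-dec (v e Fin.≟ v e′)) ×-dec Finₚ.any? (λ w → incident? w e ×-dec incident? w e′)

  adjEdges-sym : ∀ {e e′ : Edge G} → AdjEdges G e e′ → AdjEdges G e′ e
  adjEdges-sym (ne , w , i , j) = (λ (p , q) → ne (sym p , sym q)) , w , j , i

  module _ {t : ℕ} where

    swap-1 : ∀ (a b : Fin t) → swap G a b a ≡ b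
    swap-1 a b with a Fin.≟ a
    ... | yes _ = refl
    ... | no z = ⊥-elim (z refl)

    swap-2 : ∀ (a b : Fin t) → swap G a b b ≡ a
    swap-2 a b with b Fin.≟ a
    ... | yes r = r
    ... | no _ with b Fin.≟ b
    ...   | yes _ = refl
    ...   | no z = ⊥-elim (z refl)

    module _ (f g : Coloring G t) (a b : Fin t) where

      Both : Edge G → Set
      Both e = f e ≡ g e ⊎ (ColAB G f a b e × ColAB G g a b e)

    swap-diff : ∀ {f g : Coloring G t} {a b e} → Both f g a b e → f e ≢ g e → g e ≡ swap G a b (f e)
    swap-diff (inj₁ r) ne = ⊥-elim (ne r)
    swap-diff {a = a} {b} (inj₂ (inj₁ r , inj₁ s)) ne = ⊥-elim (ne (trans r (sym s)))
    swap-diff {a = a} {b} (inj₂ (inj₁ r , inj₂ s)) ne = trans s (sym (trans (cong (swap G a b) r) (swap-1 a b)))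
    swap-diff {a = a} {b} (inj₂ (inj₂ r , inj₁ s)) ne = trans s (sym (trans (cong (swap G a b) r) (swap-2 a b)))
    swap-diff (inj₂ (inj₂ r , inj₂ s)) ne = ⊥-elim (ne (trans r (sym s)))

    two-values : ∀ {a b x y z : Fin t} → x ≡ a ⊎ x ≡ b → y ≡ a ⊎ y ≡ b → z ≡ a ⊎ z ≡ b → x ≢ y → x ≢ z → y ≡ z
    two-values (inj₁ refl) (inj₁ refl) _ p _ = ⊥-elim (p refl)
    two-values (inj₁ refl) (inj₂ refl) (inj₁ refl) _ q = ⊥-elim (q refl)
    two-values (inj₁ refl) (inj₂ refl) (inj₂ refl) _ _ = refl
    two-values (inj₂ refl) (inj₂ refl) _ p _ = ⊥-elim (p refl)
    two-values (inj₂ refl) (inj₁ refl) (inj₂ refl) _ q = ⊥-elim (q refl)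
    two-values (inj₂ refl) (inj₁ refl) (inj₁ refl) _ _ = refl

    colAB? : ∀ (f : Coloring G t) a b e → Dec (ColAB G f a b e)
    colAB? f a b e = (f e Fin.≟ a) ⊎-dec (f e Fin.≟ b)

    diffs : Coloring G t → Coloring G t → List (Edge G)
    diffs f g = filter (λ e → ¬? (f e Fin.≟ g e)) edges

    -- The set of edges where f and g differ is a union of components, so interchanging on the component of
    -- e₀ makes f agree with g there.
    interchange : ∀ {f g : Coloring G t} {a b} → Proper G f → Proper G g → (∀ e → Both f g a b e) → ∀ e₀ → f e₀ ≢ g e₀ →
                  ∃ λ h → Interchange G f h × Proper G h × (∀ e → Both h g a b e) × length (diffs h g) < length (diffs f g)
    interchange {f} {g} {a} {b} pf pg both e₀ ne₀ = h , (a , b , a≢b , e₀ , col₀ , λ e → (λ (_ , p) → h-in (complete p)) , (λ ¬p → h-out (λ e∈ → ¬p (col₀ , sound e∈)))) ,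
        proper-h , both-h , filter-< (λ e → ¬? (h e Fin.≟ g e)) (λ e → ¬? (f e Fin.≟ g e)) less edges (∈-edges e₀) ne₀ (λ z → z (h-g start))
      where
      link? : ∀ e e′ → Dec (LinkAB G f a b e e′)
      link? e e′ = colAB? f a b e ×-dec colAB? f a b e′ ×-dec adjEdges? e e′
      open Reach edges ∈-edges _≟ᵉ_ link? e₀
      open Closure closure
      open import Data.List.Membership.DecPropositional _≟ᵉ_ using (_∈?_)
      col-of : ∀ {e} → f e ≢ g e → ColAB G f a b e × ColAB G g a b e
      col-of {e} ne with both e
      ... | inj₁ r = ⊥-elim (ne r)
      ... | inj₂ p = p
      col₀ : ColAB G f a b e₀
      col₀ = proj₁ (col-of ne₀)
      a≢b : a ≢ b
      a≢b refl = ne₀ (let p , q = col-of ne₀ in trans ([ id , id ]′ p) (sym ([ id , id ]′ q)))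
      complete-from : ∀ {e e′} → e ∈ found → Star (LinkAB G f a b) e e′ → e′ ∈ found
      complete-from e∈ ε = e∈
      complete-from e∈ (l ◅ r) = complete-from (closed e∈ l) r
      complete : ∀ {e} → Star (LinkAB G f a b) e₀ e → e ∈ found
      complete = complete-from start
      -- If `f` and `g` differ at `e`, then the colour of `e` under `g` is that of the adjacent
      -- linked edge under `f`. Agreement on that edge would make `g` improper.
      spread : ∀ {e e′} → f e ≢ g e → Star (LinkAB G f a b) e e′ → f e′ ≢ g e′
      spread ne ε = ne
      spread {e} ne (_◅_ {j = e₁} (c , c₁ , adj) r) = spread (λ same₁ → pg e e₁ adj
        (trans (two-values c (proj₂ (col-of ne)) c₁ ne (pf e e₁ adj)) same₁)) r
      differs : ∀ {e} → e ∈ found → f e ≢ g e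
      differs e∈ = spread ne₀ (sound e∈)
      h : Coloring G t
      h e with e ∈? found
      ... | yes _ = swap G a b (f e)
      ... | no _ = f e
      h-in : ∀ {e} → e ∈ found → h e ≡ swap G a b (f e)
      h-in {e} e∈ with e ∈? found
      ... | yes _ = refl
      ... | no z = ⊥-elim (z e∈)
      h-out : ∀ {e} → e ∉ found → h e ≡ f e
      h-out {e} e∉ with e ∈? found
      ... | yes z = ⊥-elim (e∉ z)
      ... | no _ = refl
      h-g : ∀ {e} → e ∈ found → h e ≡ g e
      h-g {e} e∈ = trans (h-in e∈) (sym (swap-diff {f = f} {g} (both e) (differs e∈)))
      cross : ∀ {e e′} → e ∈ found → e′ ∉ found → AdjEdges G e e′ → h e ≢ h e′
      cross {e} {e′} e∈ e′∉ adj r = e′∉ (closed e∈ (proj₁ (col-of (differs e∈)) ,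
        subst (λ z → z ≡ a ⊎ z ≡ b) (trans (sym (h-g e∈)) (trans r (h-out e′∉))) (proj₂ (col-of (differs e∈))) , adj))
      proper-h : Proper G h
      proper-h e e′ adj = go (e ∈? found) (e′ ∈? found)
        where
        go : Dec (e ∈ found) → Dec (e′ ∈ found) → h e ≢ h e′
        go (yes p) (yes q) r = pg e e′ adj (trans (sym (h-g p)) (trans r (h-g q)))
        go (yes p) (no q) = cross p q adj
        go (no p) (yes q) r = cross q p (adjEdges-sym {e} {e′} adj) (sym r)
        go (no p) (no q) r = pf e e′ adj (trans (sym (h-out p)) (trans r (h-out q)))
      both-h : ∀ e → Both h g a b e
      both-h e = go (e ∈? found)
        where
        go : Dec (e ∈ found) → Both h g a b e
        go (yes p) = inj₁ (h-g p)
        go (no p) = Sum.map (trans (h-out p)) (λ (x , y) → subst (λ z → z ≡ a ⊎ z ≡ b) (sym (h-out p)) x , y) (both e)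
      less : ∀ {e} → h e ≢ g e → f e ≢ g e
      less {e} ne r = go (e ∈? found)
        where
        go : Dec (e ∈ found) → ⊥
        go (yes p) = ne (h-g p)
        go (no p) = ne (trans (h-out p) r)

    interchanges : ∀ fuel {f g : Coloring G t} {a b} → length (diffs f g) < fuel → Proper G f → Proper G g → (∀ e → Both f g a b e) → KempeEquivalent G f g
    interchanges (suc fuel) {f} {g} lt pf pg both with Any.any? (λ e → ¬? (f e Fin.≟ g e)) edges
    ... | no none = f , ε , λ e → case f e Fin.≟ g e of λ where
          (yes r) → r
          (no r) → ⊥-elim (none (lose (∈-edges e) r))
    ... | yes some with find some
    ...   | e₀ , _ , ne with interchange pf pg both e₀ ne
    ...     | h , ch , ph , both′ , lt′ with interchanges fuel (<-≤-trans lt′ (≤-pred lt)) ph pg both′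
    ...       | k , path , eq = k , ch ◅ path , eq

    -- `KempeEquivalent` ends at a colouring that is only pointwise equal to its target, so the next
    -- interchange has to start from that copy.
    interchange-cong : ∀ {f f′ g : Coloring G t} → (∀ e → f′ e ≡ f e) → Interchange G f g → Interchange G f′ g
    interchange-cong {f} {f′} {g} eq (a , b , a≢b , e₀ , c , h) = a , b , a≢b , e₀ , back c , λ e →
        (λ (c , p) → trans (proj₁ (h e) (forth c , Star-map-link p)) (cong (swap G a b) (sym (eq e)))) ,
        (λ ¬p → trans (proj₂ (h e) (λ (c , p) → ¬p (back c , Star-map-link′ p))) (sym (eq e)))
      where
      forth : ∀ {e} → ColAB G f′ a b e → ColAB G f a b e
      forth {e} = subst (λ z → z ≡ a ⊎ z ≡ b) (eq e)
      back : ∀ {e} → ColAB G f a b e → ColAB G f′ a b e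
      back {e} = subst (λ z → z ≡ a ⊎ z ≡ b) (sym (eq e))
      Star-map-link : ∀ {e e′} → Star (LinkAB G f′ a b) e e′ → Star (LinkAB G f a b) e e′
      Star-map-link = Star.map (λ (c , c′ , r) → forth c , forth c′ , r)
      Star-map-link′ : ∀ {e e′} → Star (LinkAB G f a b) e e′ → Star (LinkAB G f′ a b) e e′
      Star-map-link′ = Star.map (λ (c , c′ , r) → back c , back c′ , r)

    equivalent-trans : ∀ {f g k : Coloring G t} → KempeEquivalent G f g → KempeEquivalent G g k → KempeEquivalent G f k
    equivalent-trans (h , p , eq) (h′ , ε , eq′) = h , p , λ e → trans (eq e) (eq′ e)
    equivalent-trans (h , p , eq) (h′ , s ◅ q , eq′) = h′ , p ◅◅ (interchange-cong eq s ◅ q) , eq′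

  Γ : Gph {n}
  rel Γ a b = Adj G a b
  rel? Γ a b = Graph.adj G a b Bool.≟ true
  rel-sym Γ {a} {b} r = trans (sym (Graph.sym G a b)) r
  rel-irr Γ {a} r = case trans (sym (Graph.irrefl G a)) r of λ ()

  E-edge : ∀ (e : Edge G) → E Γ (u e) (v e)
  E-edge e = mkE (uv e)

  join : ∀ {a b} → E Γ a b → ∃ λ (e : Edge G) → (u e ≡ a × v e ≡ b) ⊎ (u e ≡ b × v e ≡ a)
  join {a} {b} (mkE r) with Finₚ.<-cmp a b
  ... | tri< p _ _ = edge a b p r , inj₁ (refl , refl)
  ... | tri≈ _ refl _ = ⊥-elim (rel-irr Γ r)
  ... | tri> _ _ p = edge b a p (rel-sym Γ r) , inj₂ (refl , refl)

  join-sym : ∀ {a b} (r : E Γ a b) (s : E Γ b a) → proj₁ (join r) ≡ proj₁ (join s)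
  join-sym r s = go (join r) (join s)
    where
    go : ∀ {a b} (x : ∃ λ (e : Edge G) → (u e ≡ a × v e ≡ b) ⊎ (u e ≡ b × v e ≡ a)) (y : ∃ λ (e : Edge G) → (u e ≡ b × v e ≡ a) ⊎ (u e ≡ a × v e ≡ b)) → proj₁ x ≡ proj₁ y
    go (e , inj₁ (refl , refl)) (e′ , inj₁ (p , q)) = ⊥-elim (<-asym (u<v e) (subst₂ Fin._<_ p q (u<v e′)))
    go (e , inj₁ (p , q)) (e′ , inj₂ (p′ , q′)) = edge-≡ (trans p (sym p′)) (trans q (sym q′))
    go (e , inj₂ (p , q)) (e′ , inj₁ (p′ , q′)) = edge-≡ (trans p (sym p′)) (trans q (sym q′))
    go (e , inj₂ (refl , refl)) (e′ , inj₂ (p , q)) = ⊥-elim (<-asym (u<v e) (subst₂ Fin._<_ p q (u<v e′)))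

  join-incident : ∀ {a b} (r : E Γ a b) → Incident G a (proj₁ (join r))
  join-incident r with proj₂ (join r)
  ... | inj₁ (p , _) = inj₁ p
  ... | inj₂ (_ , q) = inj₂ q

  join-inj : ∀ {a b c} (r : E Γ a b) (s : E Γ a c) → u (proj₁ (join r)) ≡ u (proj₁ (join s)) × v (proj₁ (join r)) ≡ v (proj₁ (join s)) → b ≡ c
  join-inj r s (p , q) with proj₂ (join r) | proj₂ (join s)
  ... | inj₁ (_ , y) | inj₁ (_ , y′) = trans (sym y) (trans q y′)
  ... | inj₂ (x , _) | inj₂ (x′ , _) = trans (sym x) (trans p x′)
  ... | inj₁ (x , y) | inj₂ (x′ , y′) = ⊥-elim (E-irr (subst (λ z → E Γ z _) (trans (sym y′) (trans (sym q) y)) r))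
  ... | inj₂ (x , y) | inj₁ (x′ , y′) = ⊥-elim (E-irr (subst (λ z → E Γ z _) (trans (sym x′) (trans (sym p) x)) r))

  record Induces {t : ℕ} (f : Coloring G t) (c : Col {n}) : Set where
    constructor mkInd
    field ind : ∀ e → c (u e) (v e) ≡ toℕ (f e)
  open Induces public

  module _ {t : ℕ} where

    induced : Coloring G t → Col {n}
    induced f a b with a Finₚ.<? b | b Finₚ.<? a | Graph.adj G a b Bool.≟ true
    ... | yes p | _ | yes q = toℕ (f (edge a b p q))
    ... | no _ | yes p | yes q = toℕ (f (edge b a p (trans (sym (Graph.sym G a b)) q)))
    ... | _ | _ | _ = 0

    induced-< : ∀ (f : Coloring G t) {a b} (p : a Fin.< b) (q : Adj G a b) → induced f a b ≡ toℕ (f (edge a b p q))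
    induced-< f {a} {b} p q with a Finₚ.<? b | b Finₚ.<? a | Graph.adj G a b Bool.≟ true
    ... | yes p′ | _ | yes q′ = cong (toℕ ∘ f) (edge-≡ refl refl)
    ... | yes _ | _ | no ¬q = ⊥-elim (¬q q)
    ... | no ¬p | _ | _ = ⊥-elim (¬p p)

    induced-> : ∀ (f : Coloring G t) {a b} (p : b Fin.< a) (q : Adj G b a) → induced f a b ≡ toℕ (f (edge b a p q))
    induced-> f {a} {b} p q with a Finₚ.<? b | b Finₚ.<? a | Graph.adj G a b Bool.≟ true
    ... | yes p′ | _ | _ = ⊥-elim (<-asym p p′)
    ... | no _ | yes p′ | yes q′ = cong (toℕ ∘ f) (edge-≡ refl refl)
    ... | no _ | yes _ | no ¬q = ⊥-elim (¬q (trans (Graph.sym G a b) q))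
    ... | no _ | no ¬p | _ = ⊥-elim (¬p p)

    induces : ∀ (f : Coloring G t) → Induces f (induced f)
    induces f = mkInd λ e → induced-< f (u<v e) (uv e)

    induced-at : ∀ (f : Coloring G t) {a b} (j : E Γ a b) → induced f a b ≡ toℕ (f (proj₁ (join j)))
    induced-at f {a} {b} (mkE r) with Finₚ.<-cmp a b
    ... | tri< p _ _ = induced-< f p r
    ... | tri≈ _ refl _ = ⊥-elim (rel-irr Γ r)
    ... | tri> _ _ p = induced-> f p (rel-sym Γ r)

    induced-ok : ∀ {f} → Proper G f → Ok t Γ (induced f)
    symm (induced-ok {f} pf) r = trans (induced-at f r) (trans (cong (toℕ ∘ f) (join-sym r (E-sym r))) (sym (induced-at f (E-sym r))))
    bound (induced-ok {f} pf) r = subst (_< t) (sym (induced-at f r)) (Finₚ.toℕ<n (f (proj₁ (join r))))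
    proper (induced-ok {f} pf) {a} {b} {c} r s q with (u (proj₁ (join r)) Fin.≟ u (proj₁ (join s))) ×-dec (v (proj₁ (join r)) Fin.≟ v (proj₁ (join s)))
    ... | yes same₁ = join-inj r s same₁
    ... | no ne = ⊥-elim (pf _ _ (ne , a , join-incident r , join-incident s)
                    (Finₚ.toℕ-injective (trans (sym (induced-at f r)) (trans q (induced-at f s)))))

    restrict : ∀ {c} → Ok t Γ c → Coloring G t
    restrict ok e = fromℕ< (bound ok (E-edge e))

    restrict-induces : ∀ {c} (ok : Ok t Γ c) → Induces {t} (restrict ok) c
    restrict-induces ok = mkInd λ e → sym (Finₚ.toℕ-fromℕ< (bound ok (E-edge e)))

    induces-proper : ∀ {f : Coloring G t} {c} → Ok t Γ c → Induces f c → Proper G f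
    induces-proper {f} {c} ok i e e′ (ne , w , x , y) q = go x y
      where
      q′ : c (u e) (v e) ≡ c (u e′) (v e′)
      q′ = trans (ind i e) (trans (cong toℕ q) (sym (ind i e′)))
      eE : E Γ (v e) (u e)
      eE = E-sym (E-edge e)
      eE′ : E Γ (v e′) (u e′)
      eE′ = E-sym (E-edge e′)
      core : ∀ {a b a′ b′} → E Γ a b → E Γ a′ b′ → a ≡ a′ → c a b ≡ c a′ b′ → b ≡ b′
      core r s refl = proper ok r s
      go : Incident G w e → Incident G w e′ → ⊥
      go (inj₁ x) (inj₁ y) = ne (trans x (sym y) , core (E-edge e) (E-edge e′) (trans x (sym y)) q′)
      go (inj₂ x) (inj₂ y) = ne (core eE eE′ (trans x (sym y)) (trans (symm ok eE) (trans q′ (symm ok (E-edge e′)))) , trans x (sym y))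
      go (inj₁ x) (inj₂ y) = cross (trans x (sym y)) (core (E-edge e) eE′ (trans x (sym y)) (trans q′ (symm ok (E-edge e′))))
        where
        cross : u e ≡ v e′ → v e ≡ u e′ → ⊥
        cross r s = <-asym (u<v e) (subst₂ Fin._<_ (sym s) (sym r) (u<v e′))
      go (inj₂ x) (inj₁ y) = cross (trans x (sym y)) (core eE (E-edge e′) (trans x (sym y)) (trans (symm ok eE) q′))
        where
        cross : v e ≡ u e′ → u e ≡ v e′ → ⊥
        cross r s = <-asym (u<v e) (subst₂ Fin._<_ (sym r) (sym s) (u<v e′))

    both-K : ∀ {f g : Coloring G t} {c d a b} (a< : a < t) (b< : b < t) → Induces f c → Induces g d → K a b Γ c d → ∀ e → Both f g (fromℕ< a<) (fromℕ< b<) e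
    both-K {f} {g} {c} {d} {a} {b} a< b< i j k e = Sum.map (λ r → Finₚ.toℕ-injective (trans (sym (ind i e)) (trans r (ind j e)))) (λ (x , y) → lift i x , lift j y) (at k (E-edge e))
      where
      lift : ∀ {h : Coloring G t} {c} → Induces h c → In a b (c (u e) (v e)) → h e ≡ fromℕ< a< ⊎ h e ≡ fromℕ< b<
      lift i = Sum.map (λ r → Finₚ.toℕ-injective (trans (sym (ind i e)) (trans r (sym (Finₚ.toℕ-fromℕ< a<)))))
                       (λ r → Finₚ.toℕ-injective (trans (sym (ind i e)) (trans r (sym (Finₚ.toℕ-fromℕ< b<)))))

    equivalent : ∀ {f g : Coloring G t} {c d} → 0 < t → Proper G f → Proper G g → Induces f c → Induces g d → Kempe t Γ c d → KempeEquivalent G f g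
    equivalent {f} {g} 0<t pf pg i j ε = f , ε , λ e → Finₚ.toℕ-injective (trans (sym (ind i e)) (ind j e))
    equivalent 0<t pf pg i j ((o , o′ , _ , _ , k) ◅ r) with K-bounded 0<t o o′ k
    ... | a , b , a< , b< , k′ = let pm = induces-proper o′ (restrict-induces o′) in
      equivalent-trans (interchanges _ ≤-refl pf pm (both-K a< b< i (restrict-induces o′) k′)) (equivalent 0<t pm pg (restrict-induces o′) j r)

  neighbours : Fin n → List (Fin n)
  neighbours w = filterᵇ (Graph.adj G w) (allFin n)

  ∈-neighbours⁺ : ∀ {w x} → E Γ w x → x ∈ neighbours w
  ∈-neighbours⁺ {w} {x} (mkE r) = ∈-filter⁺ (Bool.T? ∘ Graph.adj G w) (∈-allFin x) (subst Bool.T (sym r) _)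

  ∈-neighbours⁻ : ∀ {w x} → x ∈ neighbours w → E Γ w x
  ∈-neighbours⁻ {w} {x} x∈ = mkE (to-≡ (Graph.adj G w x) (proj₂ (∈-filter⁻ (Bool.T? ∘ Graph.adj G w) {xs = allFin n} x∈)))
    where
    to-≡ : ∀ b → Bool.T b → b ≡ true
    to-≡ true _ = refl

  neighbours-unique : ∀ w → Unique (neighbours w)
  neighbours-unique w = filter⁺ (Bool.T? ∘ Graph.adj G w) (allFin⁺ n)

  noCycle : HighDegreeAcyclic G → NoCycle Γ
  noCycle acyclic x xs len un big link = acyclic record
    { x = x ; xs = xs ; long = len ; unique = un
    ; inP = All.map (λ { (mkBig vs us es l) → ≤-trans l (unique-⊆-length vs (neighbours _) us (λ y∈ → ∈-neighbours⁺ (All.lookup es y∈))) }) big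
    ; closed = Linked.map unE link }

  degree-≤ : ∀ {k} → Colorable G k → ∀ w → deg G w ≤ k
  degree-≤ (f , pf) w = ok-degLe (induced-ok pf) w (neighbours w) (neighbours-unique w) (All.tabulate ∈-neighbours⁻)

theorem1p6 : (n : ℕ) (G : Graph n) →
    MaxDegreeAtLeast G 5 →
    HighDegreeAcyclic G →
    (k : ℕ) → IsChromaticIndex G k →
    (f g : Coloring G (suc k)) → Proper G f → Proper G g →
    KempeEquivalent G f g
theorem1p6 n G (w , 5≤deg) acyclic k (colorable@(h , ph) , _) f g pf pg =
    equivalent (s≤s z≤n) pf pg (induces f) (induces g) (complete (induced-ok pf) (induced-ok pg))
  where
  open Edges G
  -- The edges at a vertex of degree at least 5 need distinct colours, so `k` is at least 5 and the
  -- truncated subtraction is exact.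
  k≡ : k ∸ 5 + 5 ≡ k
  k≡ = m∸n+n≡m (≤-trans 5≤deg (degree-≤ colorable w))
  complete : Complete (suc k) Γ
  complete = subst (λ m → Complete (suc m) Γ) k≡
    (all-complete base-case (k ∸ 5) Γ (noCycle acyclic) (subst (λ m → Ok m Γ (induced h)) (sym k≡) (induced-ok ph)))
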